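{- For a natural number $n$, let $\rho(n)=|\mathcal{X}'_n|/|\mathcal{X}_n|$ be the proportion of Dirichlet characters modulo $n$ that are primitive, and let $\omega(n)$ be the number of distinct prime divisors of $n$. For $k\ge 1$ let $n_k$ be the product of the first $k$ primes. Then for every integer $k>1$ and every natural number $n$ with $n\not\equiv 2\pmod 4$ and $\omega(n)=k$, one has $$\rho(2n_k)\log\log(2n_k)\le\rho(n)\log\log n.$$
   Context: $\mathcal{X}_n$ is the set of all Dirichlet characters modulo $n$, and $\mathcal{X}'_n\subseteq\mathcal{X}_n$ is the subset of primitive characters (those whose conductor equals $n$). -}

module Defs where

module Primes where

  open import Data.Nat.Base using (ℕ; zero; suc; _+_; _*_; _<_; _≤_; _!; NonZero; NonTrivial; nonTrivial⇒nonZero; ≢-nonZero⁻¹; n>1⇒nonTrivial; >-nonZero⁻¹)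
  open import Data.Nat.Properties
  open import Data.Nat.Divisibility
  open import Data.Nat.Primality using (Prime; prime?; prime⇒nonZero; ¬prime[1])
  open import Data.Nat.Primality.Factorisation using (factorise; PrimeFactorisation)
  open import Data.Nat.ListAction using (product)
  open import Data.Nat.Induction using (<-rec)
  open import Data.List.Base using ([]; _∷_; length; filter; upTo; applyUpTo)
  open import Data.List.Relation.Unary.All using (All; []; _∷_)
  open import Data.Nat.ListAction.Properties using (product≢0)
  open import Data.List.Relation.Unary.All.Properties using (applyUpTo⁺₂)
  open import Data.Product.Base
  open import Relation.Unary using (Decidable)
  open import Relation.Nullary
  open import Relation.Nullary.Decidable using (_×-dec_)
  open import Relation.Binary.PropositionalEquality

  ω : ℕ → ℕ
  ω n = length (filter (λ p → prime? p ×-dec p ∣? n) (upTo (suc n)))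

  least : ∀ {P : ℕ → Set} → Decidable P → ∀ n → P n → ∃[ m ] P m × (∀ k → P k → m ≤ k)
  least {P} P? = <-rec _ step
    where
    step : ∀ n → (∀ {m} → m < n → P m → ∃[ l ] P l × (∀ k → P k → l ≤ k)) → P n → ∃[ l ] P l × (∀ k → P k → l ≤ k)
    step n rec Pn with anyUpTo? P? n
    ... | yes (m , m<n , Pm) = rec m<n Pm
    ... | no ¬smaller        = n , Pn , λ k Pk → ≮⇒≥ λ k<n → ¬smaller (k , k<n , Pk)

  euclid : ∀ n → ∃[ p ] Prime p × n < p
  euclid n with factorise (suc (n !))
  ... | record { factors = [] ; isFactorisation = e } = contradiction (suc-injective e) (n!≢0 n)
    where
    n!≢0 : ∀ n → n ! ≢ 0
    n!≢0 n = ≢-nonZero⁻¹ (n !) {{n !≢0}}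
  ... | record { factors = p ∷ ps ; isFactorisation = e ; factorsPrime = pr ∷ _ } = p , pr , ≰⇒> λ p≤n →
    ¬prime[1] (subst Prime (∣1⇒≡1 (∣m+n∣m⇒∣n {p} {n !} {1} (subst (p ∣_) (trans (sym e) (+-comm 1 (n !))) (m∣m*n (product ps))) (∣-trans (p∣p! p pr) (m≤n⇒m!∣n! p≤n)))) pr)
    where
    p∣p! : ∀ p → Prime p → p ∣ p !
    p∣p! zero q = contradiction refl (≢-nonZero⁻¹ 0 {{prime⇒nonZero q}})
    p∣p! (suc p) _ = m∣m*n (p !)

  nextPrime : ∀ n → ∃[ p ] (Prime p × n < p) × (∀ q → Prime q × n < q → p ≤ q)
  nextPrime n = least (λ p → prime? p ×-dec n <? p) (proj₁ (euclid n)) (proj₂ (euclid n))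

  -- 0-indexed: nthPrime 0 = 2, and nthPrime (k + 1) is the least prime exceeding nthPrime k
  nthPrime : ℕ → ℕ
  nthPrime zero    = 2
  nthPrime (suc k) = proj₁ (nextPrime (nthPrime k))

  primorial : ℕ → ℕ
  primorial k = product (applyUpTo nthPrime k)

  nthPrime≢0 : ∀ k → NonZero (nthPrime k)
  nthPrime≢0 zero    = _
  nthPrime≢0 (suc k) = prime⇒nonZero (proj₁ (proj₁ (proj₂ (nextPrime (nthPrime k)))))

  2*primorial>1 : ∀ k → NonTrivial (2 * primorial k)
  2*primorial>1 k = n>1⇒nonTrivial (*-monoʳ-≤ 2 (>-nonZero⁻¹ (primorial k) {{product≢0 (applyUpTo⁺₂ nthPrime k nthPrime≢0)}}))

  2*primorial≢0 : ∀ k → NonZero (2 * primorial k)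
  2*primorial≢0 k = nonTrivial⇒nonZero (2 * primorial k) {{2*primorial>1 k}}

module Reals where

  open import Data.Nat.Base as ℕ using (ℕ; zero; suc)
  import Data.Nat.Properties as ℕₚ
  open import Data.Integer.Base as ℤ using (ℤ; -[1+_])
  import Data.Integer.Properties as ℤₚ
  open import Data.Rational.Base using (ℚ; mkℚ; 0ℚ; 1ℚ; _+_; _*_; -_; _-_; _<_; _≤_; *<*; *≤*; 1/_; NonNegative; Positive; positive; nonNegative; _⊔_; _⊓_; _/_; ∣_∣; nonPositive; negative; +-*-rawSemiring; NonZero; >-nonZero)
  open import Data.Rational.Properties
  open import Data.Rational.Literals using (fromℤ)
  open import Data.Rational.Solver using (module +-*-Solver)
  open import Algebra.Bundles using (CommutativeRing)
  open import Algebra.Definitions.RawSemiring +-*-rawSemiring using (_^_)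
  open import Relation.Binary.PropositionalEquality
  import Algebra.Properties.CommutativeSemiring.Exp (CommutativeRing.commutativeSemiring +-*-commutativeRing) as Exp
  open import Data.Product.Base using (Σ; ∃; ∃-syntax; Σ-syntax; _×_; _,_; proj₁; proj₂)
  open import Data.Sum.Base using (_⊎_; inj₁; inj₂; [_,_]′)
  open import Data.Empty using (⊥; ⊥-elim)
  open import Relation.Nullary using (¬_; Dec; yes; no)
  open import Relation.Binary.Definitions using (Tri; tri<; tri≈; tri>)

  fromℕ : ℕ → ℚ
  fromℕ n = fromℤ (ℤ.+ n)

  -- 1 + q/(m+1)
  compound : ℚ → ℕ → ℚ
  compound q m = 1ℚ + q * 1/ fromℕ (suc m)

  -- As n → ∞, (1 + q/n)ⁿ increases to e^q over the n with 1 + q/n > 0, strictly unless q = 0. Hence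
  -- r < e^q iff r < (1 + q/n)ⁿ for some such n, and, since e^q = 1/e^(-q), e^q < r iff
  -- 1 < r (1 - q/n)ⁿ for some n with 1 - q/n > 0.
  _<exp_ : ℚ → ℚ → Set
  r <exp q = ∃[ m ] 0ℚ < compound q m × r < compound q m ^ suc m

  exp_<_ : ℚ → ℚ → Set
  exp q < r = ∃[ m ] 0ℚ < compound (- q) m × 1ℚ < r * compound (- q) m ^ suc m

  0<1 : 0ℚ < 1ℚ
  0<1 = *<* (ℤ.+<+ (ℕ.s≤s ℕ.z≤n))

  *-monoˡ : ∀ {c a b} → 0ℚ < c → a < b → c * a < c * b
  *-monoˡ {c} 0<c = *-monoʳ-<-pos c {{positive 0<c}}

  *-monoʳ : ∀ {c a b} → 0ℚ < c → a < b → a * c < b * c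
  *-monoʳ {c} 0<c = *-monoˡ-<-pos c {{positive 0<c}}

  *-pos : ∀ {a b} → 0ℚ < a → 0ℚ < b → 0ℚ < a * b
  *-pos {a} {b} 0<a 0<b = subst (_< a * b) (*-zeroʳ a) (*-monoˡ 0<a 0<b)

  *-monoˡ-≤ : ∀ {c a b} → 0ℚ ≤ c → a ≤ b → c * a ≤ c * b
  *-monoˡ-≤ {c} 0≤c = *-monoˡ-≤-nonNeg c {{nonNegative 0≤c}}

  *-monoʳ-≤ : ∀ {c a b} → 0ℚ ≤ c → a ≤ b → a * c ≤ b * c
  *-monoʳ-≤ {c} 0≤c = *-monoʳ-≤-nonNeg c {{nonNegative 0≤c}}

  *-nonNeg : ∀ {a b} → 0ℚ ≤ a → 0ℚ ≤ b → 0ℚ ≤ a * b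
  *-nonNeg {a} {b} 0≤a 0≤b = subst (_≤ a * b) (*-zeroʳ a) (*-monoˡ-≤ 0≤a 0≤b)

  recip : ∀ {a} → 0ℚ < a → ∃[ i ] 0ℚ < i × a * i ≡ 1ℚ
  recip {a} 0<a = let instance
                        p = positive 0<a
                        nz = pos⇒nonZero a
                  in 1/ a , positive⁻¹ (1/ a) {{1/pos⇒pos a}} , *-inverseʳ a

  frac : ∀ {a} c → 0ℚ < a → ∃[ d ] a * d ≡ c
  frac {a} c 0<a with recip 0<a
  ... | i , _ , e = i * c , trans (sym (*-assoc a i c)) (trans (cong (_* c) e) (*-identityˡ c))

  *-cancelˡ : ∀ {c a b} → 0ℚ < c → c * a < c * b → a < b
  *-cancelˡ {c} 0<c = *-cancelˡ-<-nonNeg c {{nonNegative (<⇒≤ 0<c)}}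

  ^-pos : ∀ {a} n → 0ℚ < a → 0ℚ < a ^ n
  ^-pos zero    0<a = 0<1
  ^-pos (suc n) 0<a = *-pos 0<a (^-pos n 0<a)

  ^-mono-≤ : ∀ {a b} n → 0ℚ ≤ a → a ≤ b → a ^ n ≤ b ^ n
  ^-nonNeg : ∀ {a} n → 0ℚ ≤ a → 0ℚ ≤ a ^ n
  ^-nonNeg zero    _   = <⇒≤ 0<1
  ^-nonNeg (suc n) 0≤a = *-nonNeg 0≤a (^-nonNeg n 0≤a)
  ^-mono-≤ zero    0≤a a≤b = ≤-refl
  ^-mono-≤ (suc n) 0≤a a≤b = ≤-trans (*-monoˡ-≤ 0≤a (^-mono-≤ n 0≤a a≤b))
                                     (*-monoʳ-≤ (^-nonNeg n (≤-trans 0≤a a≤b)) a≤b)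


  fromℤ-/1 : ∀ z → z / 1 ≡ fromℤ z
  fromℤ-/1 z = ↥p/↧p≡p (fromℤ z)

  fromℤ-+ : ∀ a b → fromℤ (a ℤ.+ b) ≡ fromℤ a + fromℤ b
  fromℤ-+ a b = trans (sym (fromℤ-/1 _)) (cong (_/ 1) (sym (cong₂ ℤ._+_ (ℤₚ.*-identityʳ a) (ℤₚ.*-identityʳ b))))

  fromℤ-* : ∀ a b → fromℤ (a ℤ.* b) ≡ fromℤ a * fromℤ b
  fromℤ-* a b = sym (fromℤ-/1 _)

  fromℕ-suc : ∀ n → fromℕ (suc n) ≡ 1ℚ + fromℕ n
  fromℕ-suc n = fromℤ-+ (ℤ.+ 1) (ℤ.+ n)

  fromℕ-* : ∀ m n → fromℕ (m ℕ.* n) ≡ fromℕ m * fromℕ n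
  fromℕ-* m n = trans (cong fromℤ (ℤₚ.pos-* m n)) (fromℤ-* (ℤ.+ m) (ℤ.+ n))

  fromℕ-pos : ∀ n → 0ℚ < fromℕ (suc n)
  fromℕ-pos n = positive⁻¹ (fromℕ (suc n))

  archimedean : ∀ p → ∃[ n ] p < fromℕ (suc n)
  archimedean p@(mkℚ (ℤ.+ k) d _) = k , *<* (subst₂ ℤ._<_ (sym (ℤₚ.*-identityʳ (ℤ.+ k))) (ℤₚ.pos-* (suc k) (suc d))
    (ℤ.+<+ (ℕₚ.<-≤-trans (ℕₚ.n<1+n k) (ℕₚ.m≤m*n (suc k) (suc d)))))
  archimedean (mkℚ -[1+ k ] d _) = 0 , *<* ℤ.-<+

  half : ∀ {a b} → a < b → ∃[ c ] a < c × c < b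
  half a<b = let c , p , q = <-dense a<b in c , p , q

  p<p+q : ∀ p {q} → 0ℚ < q → p < p + q
  p<p+q p {q} 0<q = subst (_< p + q) (+-identityʳ p) (+-monoʳ-< p 0<q)

  p-1<p : ∀ p → p - 1ℚ < p
  p-1<p p = subst (p - 1ℚ <_) (+-identityʳ p) (+-monoʳ-< p (neg-antimono-< 0<1))

  p-q>0 : ∀ {p q} → q < p → 0ℚ < p - q
  p-q>0 {p} {q} q<p = subst (_< p - q) (+-inverseʳ q) (+-monoˡ-< (- q) q<p)

  p-q>0⁻¹ : ∀ {p q} → 0ℚ < p - q → q < p
  p-q>0⁻¹ {p} {q} h = subst₂ _<_ (+-identityˡ q) (solve 2 (λ p q → (p :- q) :+ q := p) refl p q) (+-monoˡ-< q h)
    where open +-*-Solver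

  p-q≥0⁻¹ : ∀ {p q} → 0ℚ ≤ p - q → q ≤ p
  p-q≥0⁻¹ {p} {q} h = subst₂ _≤_ (+-identityˡ q) (solve 2 (λ p q → (p :- q) :+ q := p) refl p q) (+-monoˡ-≤ q h)
    where open +-*-Solver

  neg-involutive : ∀ p → - - p ≡ p
  neg-involutive = solve 1 (λ p → :- :- p := p) refl
    where open +-*-Solver

  square≥0 : ∀ p → 0ℚ ≤ p * p
  square≥0 p with ≤-total 0ℚ p
  ... | inj₁ 0≤p = *-nonNeg 0≤p 0≤p
  ... | inj₂ p≤0 = subst (0ℚ ≤_) (solve 1 (λ p → (:- p) :* (:- p) := p :* p) refl p) (*-nonNeg (neg-antimono-≤ p≤0) (neg-antimono-≤ p≤0))
    where open +-*-Solver

  bernoulli : ∀ n {x} → 0ℚ ≤ 1ℚ + x → 1ℚ + fromℕ n * x ≤ (1ℚ + x) ^ n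
  bernoulli zero {x} 0≤1+x = ≤-reflexive (trans (cong (1ℚ +_) (*-zeroˡ x)) (+-identityʳ 1ℚ))
  bernoulli (suc n) {x} 0≤1+x = ≤-trans (p-q≥0⁻¹ (subst (0ℚ ≤_) eq (*-nonNeg n≥0 (square≥0 x)))) (*-monoˡ-≤ {1ℚ + x} 0≤1+x (bernoulli n {x} 0≤1+x))
    where
    n≥0 : 0ℚ ≤ fromℕ n
    n≥0 = nonNegative⁻¹ (fromℕ n)
    open +-*-Solver
    eq : fromℕ n * (x * x) ≡ (1ℚ + x) * (1ℚ + fromℕ n * x) - (1ℚ + fromℕ (suc n) * x)
    eq = trans (solve 2 (λ n x → n :* (x :* x) := (con 1ℚ :+ x) :* (con 1ℚ :+ n :* x) :- (con 1ℚ :+ (con 1ℚ :+ n) :* x)) refl (fromℕ n) x)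
               (cong (λ m → (1ℚ + x) * (1ℚ + fromℕ n * x) - (1ℚ + m * x)) (sym (fromℕ-suc n)))

  pow-open : ∀ n {a c} → 0ℚ < a → 0ℚ < c → c < a ^ n → ∃[ b ] 0ℚ < b × b < a × c < b ^ n
  pow-open zero 0<a 0<c c< = let b , p , q = half 0<a in b , p , q , c<
  pow-open (suc n) {a} {c} 0<a 0<c c<
    with frac c 0<a
  ... | e , ae≡c with half (*-cancelˡ 0<a (subst (_< a * a ^ n) (sym ae≡c) c<))
  ... | d , e<d , d<aⁿ = result (pow-open n 0<a 0<d d<aⁿ) (half f<a)
    where
    0<e : 0ℚ < e
    0<e = *-cancelˡ 0<a (subst₂ _<_ (sym (*-zeroʳ a)) (sym ae≡c) 0<c)
    0<d = <-trans 0<e e<d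
    f = proj₁ (frac c 0<d)
    df≡c : d * f ≡ c
    df≡c = proj₂ (frac c 0<d)
    f<a : f < a
    f<a = *-cancelˡ 0<d (subst (_< d * a) (trans ae≡c (sym df≡c)) (subst (a * e <_) (*-comm a d) (*-monoˡ 0<a e<d)))
    0<f : 0ℚ < f
    0<f = *-cancelˡ 0<d (subst₂ _<_ (sym (*-zeroʳ d)) (sym df≡c) 0<c)
    result : ∃[ b ] 0ℚ < b × b < a × d < b ^ n → ∃[ g ] f < g × g < a → ∃[ b ] 0ℚ < b × b < a × c < b ^ suc n
    result (b , 0<b , b<a , d<bⁿ) (g , f<g , g<a) = m , 0<m , m<a , c<mⁿ
      where
      m = b ⊔ g
      0<m : 0ℚ < m
      0<m = <-≤-trans 0<b (p≤p⊔q b g)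
      m<a : m < a
      m<a = [ (λ e → subst (_< a) (sym e) b<a) , (λ e → subst (_< a) (sym e) g<a) ]′ (⊔-sel b g)
      c<mⁿ : c < m * m ^ n
      c<mⁿ = subst (_< m * m ^ n) (trans (*-comm f d) df≡c) (<-≤-trans (<-trans (*-monoʳ 0<d f<g) (*-monoˡ (<-trans 0<f f<g) d<bⁿ))
               (≤-trans (*-monoʳ-≤ (^-nonNeg n (<⇒≤ 0<b)) (p≤q⊔p b g)) (*-monoˡ-≤ (<⇒≤ 0<m) (^-mono-≤ n (<⇒≤ 0<b) (p≤p⊔q b g)))))

  div-mul : ∀ q {M i} → M * i ≡ 1ℚ → (1ℚ + q * i - 1ℚ) * M ≡ q
  div-mul q {M} {i} e = trans (solve 3 (λ q r s → (con 1ℚ :+ q :* r :- con 1ℚ) :* s := q :* (s :* r)) refl q i M)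
    (trans (cong (q *_) e) (*-identityʳ q))
    where open +-*-Solver

  mul-div : ∀ b {M i} → M * i ≡ 1ℚ → 1ℚ + (b - 1ℚ) * M * i ≡ b
  mul-div b {M} {i} e = trans (cong (1ℚ +_) (trans (*-assoc (b - 1ℚ) M i) (trans (cong ((b - 1ℚ) *_) e) (*-identityʳ (b - 1ℚ)))))
    (solve 1 (λ b → con 1ℚ :+ (b :- con 1ℚ) := b) refl b)
    where open +-*-Solver

  fromℕ-inverse : ∀ m → fromℕ (suc m) * 1/ fromℕ (suc m) ≡ 1ℚ
  fromℕ-inverse m = *-inverseʳ (fromℕ (suc m))

  compound-inv : ∀ q m → (compound q m - 1ℚ) * fromℕ (suc m) ≡ q
  compound-inv q m = div-mul q {fromℕ (suc m)} {1/ fromℕ (suc m)} (fromℕ-inverse m)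

  compound-surj : ∀ b m → compound ((b - 1ℚ) * fromℕ (suc m)) m ≡ b
  compound-surj b m = mul-div b {fromℕ (suc m)} {1/ fromℕ (suc m)} (fromℕ-inverse m)

  1/pos : ∀ m → 0ℚ < 1/ fromℕ (suc m)
  1/pos m = positive⁻¹ (1/ fromℕ (suc m))

  compound-mono-≤ : ∀ {p q} m → p ≤ q → compound p m ≤ compound q m
  compound-mono-≤ m p≤q = +-monoʳ-≤ 1ℚ (*-monoʳ-≤ (<⇒≤ (1/pos m)) p≤q)

  compound-decrease : ∀ {b} q m → b < compound q m → ∃[ q′ ] q′ < q × compound q′ m ≡ b
  compound-decrease {b} q m b<  = (b - 1ℚ) * fromℕ (suc m) ,
    subst ((b - 1ℚ) * fromℕ (suc m) <_) (compound-inv q m) (*-monoʳ (fromℕ-pos m) (+-monoˡ-< (- 1ℚ) b<)) ,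
    compound-surj b m

  <exp-mono-≤ : ∀ {r p q} → p ≤ q → r <exp p → r <exp q
  <exp-mono-≤ {r} {p} {q} p≤q (m , 0<b , r<) = m , <-≤-trans 0<b b≤ ,
    <-≤-trans r< (^-mono-≤ {compound p m} {compound q m} (suc m) (<⇒≤ 0<b) b≤)
    where b≤ = compound-mono-≤ {p} {q} m p≤q

  factor-pos : ∀ {r v} → 0ℚ < v → 1ℚ < r * v → 0ℚ < r
  factor-pos {r} {v} 0<v 1< = *-cancelˡ {v} 0<v (subst₂ _<_ (sym (*-zeroʳ v)) (*-comm r v) (<-trans 0<1 1<))

  exp-pos : ∀ {q r} → exp q < r → 0ℚ < r
  exp-pos {q} {r} (m , 0<b , 1<) = factor-pos {r} {compound (- q) m ^ suc m} (^-pos {compound (- q) m} (suc m) 0<b) 1<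

  exp<-anti-≤ : ∀ {r p q} → p ≤ q → exp q < r → exp p < r
  exp<-anti-≤ {r} {p} {q} p≤q h@(m , 0<b , 1<) = m , <-≤-trans 0<b b≤ ,
    <-≤-trans 1< (*-monoˡ-≤ {r} (<⇒≤ (exp-pos {q} {r} h)) (^-mono-≤ {compound (- q) m} {compound (- p) m} (suc m) (<⇒≤ 0<b) b≤))
    where b≤ = compound-mono-≤ { - q} { - p} m (neg-antimono-≤ p≤q)

  <exp-open : ∀ {r q} → 0ℚ < r → r <exp q → ∃[ q′ ] q′ < q × r <exp q′
  <exp-open {r} {q} 0<r (m , 0<b , r<) =
    let c , 0<c , c<b , r<c = pow-open (suc m) {compound q m} {r} 0<b 0<r r<
        q′ , q′<q , e       = compound-decrease {c} q m c<b
    in q′ , q′<q , m , subst (0ℚ <_) (sym e) 0<c , subst (λ b → r < b ^ suc m) (sym e) r<c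

  mul-inverse-< : ∀ {r i v} → 0ℚ < r → r * i ≡ 1ℚ → i < v → 1ℚ < r * v
  mul-inverse-< {r} {i} {v} 0<r e i<v = subst (_< r * v) e (*-monoˡ {r} 0<r i<v)

  mul-inverse-<⁻¹ : ∀ {r i v} → 0ℚ < r → r * i ≡ 1ℚ → 1ℚ < r * v → i < v
  mul-inverse-<⁻¹ {r} {i} {v} 0<r e 1< = *-cancelˡ {r} 0<r (subst (_< r * v) (sym e) 1<)

  exp<-open : ∀ {q r} → exp q < r → ∃[ q′ ] q < q′ × exp q′ < r
  exp<-open {q} {r} h@(m , 0<b , 1<) =
    let 0<r                 = exp-pos {q} {r} h
        i , 0<i , ri≡1      = recip 0<r
        c , 0<c , c<b , i<c = pow-open (suc m) {compound (- q) m} {i} 0<b 0<i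
                                (mul-inverse-<⁻¹ {r} {i} {compound (- q) m ^ suc m} 0<r ri≡1 1<)
        p , p<-q , e        = compound-decrease {c} (- q) m c<b
        e′                  = trans (sym e) (cong (λ z → compound z m) (sym (neg-involutive p)))
    in - p , subst (_< - p) (neg-involutive q) (neg-antimono-< p<-q) , m ,
       subst (0ℚ <_) e′ 0<c ,
       subst (λ b → 1ℚ < r * b ^ suc m) e′ (mul-inverse-< {r} {i} {c ^ suc m} 0<r ri≡1 i<c)

  inverse-factor : ∀ {M iM K N iN} → M * iM ≡ 1ℚ → N * iN ≡ 1ℚ → N ≡ M * K → K * iN ≡ iM
  inverse-factor {M} {iM} {K} {N} {iN} eM eN e = begin
    K * iN             ≡⟨ *-identityˡ (K * iN) ⟨
    1ℚ * (K * iN)      ≡⟨ cong (_* (K * iN)) eM ⟨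
    M * iM * (K * iN)  ≡⟨ solve 4 (λ a b c d → a :* b :* (c :* d) := b :* ((a :* c) :* d)) refl M iM K iN ⟩
    iM * (M * K * iN)  ≡⟨ cong (λ z → iM * (z * iN)) e ⟨
    iM * (N * iN)      ≡⟨ cong (iM *_) eN ⟩
    iM * 1ℚ            ≡⟨ *-identityʳ iM ⟩
    iM                 ∎
    where
    open ≡-Reasoning
    open +-*-Solver

  refine-step : ∀ q {iM iN} k → fromℕ (suc k) * iN ≡ iM → 0ℚ < 1ℚ + q * iM →
                0ℚ < 1ℚ + q * iN × 1ℚ + q * iM ≤ (1ℚ + q * iN) ^ suc k
  refine-step q {iM} {iN} k e 0<b = 0<bN , subst (_≤ (1ℚ + y) ^ suc k) (cong (1ℚ +_) Ky) (bernoulli (suc k) {y} (<⇒≤ 0<bN))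
    where
    open +-*-Solver
    y = q * iN
    K≡ : ∀ K → K * (q * iN) ≡ q * (K * iN)
    K≡ K = solve 3 (λ k q n → k :* (q :* n) := q :* (k :* n)) refl K q iN
    Ky : fromℕ (suc k) * y ≡ q * iM
    Ky = trans (K≡ (fromℕ (suc k))) (cong (q *_) e)
    split : ∀ k y → k * (- y) ≡ y - (1ℚ + k) * y
    split = solve 2 (λ k y → k :* (:- y) := y :- (con 1ℚ :+ k) :* y) refl
    0<bN : 0ℚ < 1ℚ + y
    0<bN with ≤-total 0ℚ y
    ... | inj₁ 0≤y = <-≤-trans 0<1 (≤-trans (≤-reflexive (sym (+-identityʳ 1ℚ))) (+-monoʳ-≤ 1ℚ 0≤y))
    ... | inj₂ y≤0 = <-≤-trans 0<b (+-monoʳ-≤ 1ℚ (subst (_≤ y) Ky Ky≤y))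
      where
      Ky≤y : fromℕ (suc k) * y ≤ y
      Ky≤y = p-q≥0⁻¹ (subst (0ℚ ≤_) (trans (split (fromℕ k) y) (cong (λ z → y - z * y) (sym (fromℕ-suc k))))
               (*-nonNeg (nonNegative⁻¹ (fromℕ k)) (neg-antimono-≤ y≤0)))

  refine : ∀ q m k → 0ℚ < compound q m → let N = k ℕ.+ m ℕ.* suc k in
           0ℚ < compound q N × compound q m ^ suc m ≤ compound q N ^ suc N
  refine q m k 0<b = 0<bN , subst (compound q m ^ suc m ≤_) powN (^-mono-≤ (suc m) (<⇒≤ 0<b) (proj₂ step))
    where
    N = k ℕ.+ m ℕ.* suc k
    step : 0ℚ < compound q N × compound q m ≤ compound q N ^ suc k
    step = refine-step q k (inverse-factor {fromℕ (suc m)} {1/ fromℕ (suc m)} {fromℕ (suc k)} {fromℕ (suc N)} {1/ fromℕ (suc N)}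
             (fromℕ-inverse m) (fromℕ-inverse N) (fromℕ-* (suc m) (suc k))) 0<b
    0<bN = proj₁ step
    powN : (compound q N ^ suc k) ^ suc m ≡ compound q N ^ suc N
    powN = trans (Exp.^-assocʳ (compound q N) (suc k) (suc m)) (cong (compound q N ^_) (ℕₚ.*-comm (suc k) (suc m)))

  ^-≤1 : ∀ n {a} → 0ℚ ≤ a → a ≤ 1ℚ → a ^ n ≤ 1ℚ
  ^-≤1 zero 0≤a a≤1 = ≤-refl
  ^-≤1 (suc n) 0≤a a≤1 = ≤-trans (*-monoˡ-≤ 0≤a (^-≤1 n 0≤a a≤1)) (≤-trans (≤-reflexive (*-identityʳ _)) a≤1)


  1-square : ∀ q h → (1ℚ + q * h) * (1ℚ + - q * h) ≤ 1ℚ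
  1-square q h = p-q≥0⁻¹ (subst (0ℚ ≤_)
    (solve 2 (λ q h → (q :* h) :* (q :* h) := con 1ℚ :- (con 1ℚ :+ q :* h) :* (con 1ℚ :+ (:- q) :* h)) refl q h)
    (square≥0 (q * h)))
    where open +-*-Solver

  -- (1 - q/(m+1))^(m+1) · (1 + q/(k+1))^(k+1) ≤ 1
  bases≤1 : ∀ q m k → 0ℚ < compound (- q) m → 0ℚ < compound q k → compound q k ^ suc k * compound (- q) m ^ suc m ≤ 1ℚ
  bases≤1 q m k 0<b 0<b′ = bound (ℕₚ.suc-injective (ℕₚ.*-comm (suc k) (suc m))) (refine (- q) m k 0<b) (refine q k m 0<b′)
    where
    bound : ∀ {N N′} → N′ ≡ N →
      0ℚ < compound (- q) N × compound (- q) m ^ suc m ≤ compound (- q) N ^ suc N →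
      0ℚ < compound q N′ × compound q k ^ suc k ≤ compound q N′ ^ suc N′ →
      compound q k ^ suc k * compound (- q) m ^ suc m ≤ 1ℚ
    bound {N} refl (0<d , ≤d) (0<c , ≤c) = ≤-trans (*-monoʳ-≤ (^-nonNeg (suc m) (<⇒≤ 0<b)) ≤c)
      (≤-trans (*-monoˡ-≤ (^-nonNeg (suc N) (<⇒≤ 0<c)) ≤d)
      (≤-trans (≤-reflexive (sym (Exp.^-distrib-* (compound q N) (compound (- q) N) (suc N))))
               (^-≤1 (suc N) (*-nonNeg (<⇒≤ 0<c) (<⇒≤ 0<d)) (1-square q (1/ fromℕ (suc N))))))

  exp-cut : ∀ {q r t} → exp q < r → t <exp q → t < r
  exp-cut {q} {r} {t} h@(m , 0<b , 1<) (k , 0<b′ , t<) = ≰⇒> λ r≤t → <-irrefl refl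
    (<-≤-trans 1< (≤-trans (*-monoʳ-≤ (^-nonNeg (suc m) (<⇒≤ 0<b)) (≤-trans r≤t (<⇒≤ t<))) (bases≤1 q m k 0<b 0<b′)))

  ∣p∣≥ : ∀ p → p ≤ ∣ p ∣
  ∣p∣≥ p with ≤-total 0ℚ p
  ... | inj₁ 0≤p = ≤-reflexive (sym (0≤p⇒∣p∣≡p 0≤p))
  ... | inj₂ p≤0 = ≤-trans p≤0 (0≤∣p∣ p)

  compound-pos′ : ∀ p {M i} → M * i ≡ 1ℚ → 0ℚ < i → - p < M → 0ℚ < 1ℚ + p * i
  compound-pos′ p {M} {i} e 0<i -p<M = subst (0ℚ <_)
    (trans (solve 3 (λ p M i → (M :- (:- p)) :* i := (M :* i) :+ p :* i) refl p M i) (cong (_+ p * i) e))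
    (*-pos (p-q>0 -p<M) 0<i)
    where open +-*-Solver

  -- a b - 1 = i ((s - q) - q s i) = i i ((s - q) M - q s) = i i (s - q) (M - x)
  bases>1 : ∀ {M i q s x} → M * i ≡ 1ℚ → 0ℚ < i → q < s → x < M → (s - q) * x ≡ q * s →
            1ℚ < (1ℚ + s * i) * (1ℚ + - q * i)
  bases>1 {M} {i} {q} {s} {x} e 0<i q<s x<M dx≡qs =
    p-q>0⁻¹ (subst (0ℚ <_) eq (*-pos (*-pos 0<i 0<i) (*-pos (p-q>0 q<s) (p-q>0 x<M))))
    where
    open +-*-Solver
    open ≡-Reasoning
    eq : (i * i) * ((s - q) * (M - x)) ≡ (1ℚ + s * i) * (1ℚ + - q * i) - 1ℚ
    eq = begin
      (i * i) * ((s - q) * (M - x))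
        ≡⟨ solve 5 (λ i q s M x → (i :* i) :* ((s :- q) :* (M :- x)) := i :* (M :* i) :* (s :- q) :- (i :* i) :* ((s :- q) :* x)) refl i q s M x ⟩
      i * (M * i) * (s - q) - (i * i) * ((s - q) * x)
        ≡⟨ cong₂ (λ y z → i * y * (s - q) - (i * i) * z) e dx≡qs ⟩
      i * 1ℚ * (s - q) - (i * i) * (q * s)
        ≡⟨ solve 3 (λ i q s → i :* con 1ℚ :* (s :- q) :- (i :* i) :* (q :* s) := (con 1ℚ :+ s :* i) :* (con 1ℚ :+ (:- q) :* i) :- con 1ℚ) refl i q s ⟩
      (1ℚ + s * i) * (1ℚ + - q * i) - 1ℚ ∎

  ^->1 : ∀ n {c} → 1ℚ < c → 1ℚ < c ^ suc n
  ^->1 zero    {c} 1<c = subst (1ℚ <_) (sym (*-identityʳ c)) 1<c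
  ^->1 (suc n) {c} 1<c = <-trans (subst (1ℚ <_) (sym (*-identityʳ c)) 1<c) (*-monoˡ {c} (<-trans 0<1 1<c) (^->1 n 1<c))

  -- for m large, (1 - q/(m+1)) (1 + s/(m+1)) > 1
  exp-separated : ∀ {q s} → q < s → ∃[ r ] ∃[ t ] r < t × exp q < r × t <exp s
  exp-separated {q} {s} q<s
    with frac (q * s) (p-q>0 q<s)
  ... | x , dx≡qs with archimedean (∣ q ∣ + ∣ s ∣ + ∣ x ∣)
  ... | m , <M = let r , t , r<t , 1<ra , t<b = separate {a} {b} 0<a 0<b 1<ba
                   in r , t , r<t , (m , 0<a , 1<ra) , (m , 0<b , t<b)
    where
    M = fromℕ (suc m)
    i = 1/ M
    a = compound (- q) m
    b = compound s m
    below : ∀ {y} → y ≤ ∣ q ∣ + ∣ s ∣ + ∣ x ∣ → y < M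
    below y≤ = ≤-<-trans y≤ <M
    ≤q : ∣ q ∣ ≤ ∣ q ∣ + ∣ s ∣ + ∣ x ∣
    ≤q = ≤-trans (≤-trans (≤-reflexive (sym (+-identityʳ _))) (+-monoʳ-≤ ∣ q ∣ (0≤∣p∣ s))) (≤-trans (≤-reflexive (sym (+-identityʳ _))) (+-monoʳ-≤ (∣ q ∣ + ∣ s ∣) (0≤∣p∣ x)))
    ≤s : ∣ s ∣ ≤ ∣ q ∣ + ∣ s ∣ + ∣ x ∣
    ≤s = ≤-trans (≤-trans (≤-reflexive (sym (+-identityˡ _))) (+-monoˡ-≤ ∣ s ∣ (0≤∣p∣ q))) (≤-trans (≤-reflexive (sym (+-identityʳ _))) (+-monoʳ-≤ (∣ q ∣ + ∣ s ∣) (0≤∣p∣ x)))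
    ≤x : ∣ x ∣ ≤ ∣ q ∣ + ∣ s ∣ + ∣ x ∣
    ≤x = ≤-trans (≤-reflexive (sym (+-identityˡ _))) (+-monoˡ-≤ ∣ x ∣ (+-mono-≤ (0≤∣p∣ q) (0≤∣p∣ s)))
    compound-pos : ∀ p → - p < M → 0ℚ < compound p m
    compound-pos p -p<M = compound-pos′ p {M} {i} (fromℕ-inverse m) (1/pos m) -p<M
    0<a : 0ℚ < a
    0<a = compound-pos (- q) (below (≤-trans (∣p∣≥ (- - q)) (≤-trans (≤-reflexive (trans (∣-p∣≡∣p∣ (- q)) (∣-p∣≡∣p∣ q))) ≤q)))
    0<b : 0ℚ < b
    0<b = compound-pos s (below (≤-trans (∣p∣≥ (- s)) (≤-trans (≤-reflexive (∣-p∣≡∣p∣ s)) ≤s)))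
    x<M : x < M
    x<M = below (≤-trans (∣p∣≥ x) ≤x)
    1<ba : 1ℚ < b * a
    1<ba = bases>1 {M} {i} (fromℕ-inverse m) (1/pos m) q<s x<M dx≡qs
    separate : ∀ {a b} → 0ℚ < a → 0ℚ < b → 1ℚ < b * a →
               ∃[ r ] ∃[ t ] r < t × 1ℚ < r * a ^ suc m × t < b ^ suc m
    separate {a} {b} 0<a 0<b 1<ba = 
      let v                = a ^ suc m
          w                = b ^ suc m
          0<v              = ^-pos {a} (suc m) 0<a
          1<wv             = subst (1ℚ <_) (Exp.^-distrib-* b a (suc m)) (^->1 m {b * a} 1<ba)
          i , 0<i , vi≡1   = recip {v} 0<v
          i<w              = mul-inverse-<⁻¹ {v} {i} {w} 0<v vi≡1 (subst (1ℚ <_) (*-comm w v) 1<wv)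
          r , i<r , r<w    = half i<w
          t , r<t , t<w    = half r<w
      in r , t , r<t , subst (1ℚ <_) (*-comm v r) (mul-inverse-< {v} {i} {r} 0<v vi≡1 i<r) , t<w

  -- two-sided Dedekind cuts: lower q is q < x and upper q is x < q
  record ℝ : Set₁ where
    field
      lower upper   : ℚ → Set
      lower-inhab   : ∃[ q ] lower q
      upper-inhab   : ∃[ q ] upper q
      lower-closed  : ∀ {p q} → p < q → lower q → lower p
      upper-closed  : ∀ {p q} → p < q → upper p → upper q
      lower-open    : ∀ {p} → lower p → ∃[ q ] p < q × lower q
      upper-open    : ∀ {q} → upper q → ∃[ p ] p < q × upper p
      disjoint      : ∀ {q} → ¬ (lower q × upper q)
      located       : ∀ {p q} → p < q → lower p ⊎ upper q

    lower<upper : ∀ {p q} → lower p → upper q → p < q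
    lower<upper {p} {q} l u = ≰⇒> λ q≤p → disjoint {p} (l , upper-≤ q≤p)
      where
      upper-≤ : q ≤ p → upper p
      upper-≤ q≤p with <-cmp q p
      ... | tri< q<p _ _  = upper-closed q<p u
      ... | tri≈ _ refl _ = u
      ... | tri> _ _ p<q  = ⊥-elim (<-irrefl refl (<-≤-trans p<q q≤p))

  open ℝ

  infix 4 _≤ᴿ_
  _≤ᴿ_ : ℝ → ℝ → Set
  x ≤ᴿ y = ∀ {q} → lower x q → lower y q

  fromℚ : ℚ → ℝ
  fromℚ x = record
    { lower        = _< x
    ; upper        = x <_
    ; lower-inhab  = x - 1ℚ , p-1<p x
    ; upper-inhab  = x + 1ℚ , p<p+q x 0<1
    ; lower-closed = <-trans
    ; upper-closed = λ p<q x<p → <-trans x<p p<q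
    ; lower-open   = half
    ; upper-open   = λ x<q → let p , x<p , p<q = half x<q in p , p<q , x<p
    ; disjoint     = λ (q<x , x<q) → <-asym q<x x<q
    ; located      = λ {p} {q} p<q → decide p<q (p <? x)
    }
    where
    decide : ∀ {p q} → p < q → Dec (p < x) → p < x ⊎ x < q
    decide p<q (yes p<x) = inj₁ p<x
    decide p<q (no  p≮x) = inj₂ (≤-<-trans (≮⇒≥ p≮x) p<q)

  -- c x is squeezed between c r and c s whenever r < x < s; the sign of c determines which of the
  -- two bounds is the lower one.
  module Scaling (c : ℚ) (x : ℝ) where

    Lower Upper : ℚ → Set
    Lower q = ∃[ r ] ∃[ s ] (lower x r × upper x s) × (q < c * r × q < c * s)
    Upper q = ∃[ r ] ∃[ s ] (lower x r × upper x s) × (c * r < q × c * s < q)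

    below-⊓ : ∀ {p q r} → p < q → p < r → p < q ⊓ r
    below-⊓ {p} {q} {r} p<q p<r = [ (λ e → subst (p <_) (sym e) p<q) , (λ e → subst (p <_) (sym e) p<r) ]′ (⊓-sel q r)

    above-⊔ : ∀ {p q r} → q < p → r < p → q ⊔ r < p
    above-⊔ {p} {q} {r} q<p r<p = [ (λ e → subst (_< p) (sym e) q<p) , (λ e → subst (_< p) (sym e) r<p) ]′ (⊔-sel q r)

    Lower-inhab : ∃ Lower
    Lower-inhab with lower-inhab x | upper-inhab x
    ... | r , lr | s , us = ((c * r) ⊓ (c * s)) - 1ℚ , r , s , (lr , us) ,
      <-≤-trans (p-1<p ((c * r) ⊓ (c * s))) (p⊓q≤p (c * r) (c * s)) , <-≤-trans (p-1<p ((c * r) ⊓ (c * s))) (p⊓q≤q (c * r) (c * s))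

    Upper-inhab : ∃ Upper
    Upper-inhab with lower-inhab x | upper-inhab x
    ... | r , lr | s , us = ((c * r) ⊔ (c * s)) + 1ℚ , r , s , (lr , us) ,
      ≤-<-trans (p≤p⊔q (c * r) (c * s)) (p<p+q ((c * r) ⊔ (c * s)) 0<1) , ≤-<-trans (p≤q⊔p (c * r) (c * s)) (p<p+q ((c * r) ⊔ (c * s)) 0<1)

    Lower-closed : ∀ {p q} → p < q → Lower q → Lower p
    Lower-closed p<q (r , s , b , q<cr , q<cs) = r , s , b , <-trans p<q q<cr , <-trans p<q q<cs

    Upper-closed : ∀ {p q} → p < q → Upper p → Upper q
    Upper-closed p<q (r , s , b , cr<p , cs<p) = r , s , b , <-trans cr<p p<q , <-trans cs<p p<q

    Lower-open : ∀ {p} → Lower p → ∃[ q ] p < q × Lower q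
    Lower-open (r , s , b , p<cr , p<cs) with half (below-⊓ p<cr p<cs)
    ... | q , p<q , q<m = q , p<q , r , s , b , <-≤-trans q<m (p⊓q≤p (c * r) (c * s)) , <-≤-trans q<m (p⊓q≤q (c * r) (c * s))

    Upper-open : ∀ {q} → Upper q → ∃[ p ] p < q × Upper p
    Upper-open (r , s , b , cr<q , cs<q) with half (above-⊔ cr<q cs<q)
    ... | p , m<p , p<q = p , p<q , r , s , b , ≤-<-trans (p≤p⊔q (c * r) (c * s)) m<p , ≤-<-trans (p≤q⊔p (c * r) (c * s)) m<p

    Disjoint : ∀ {q} → ¬ (Lower q × Upper q)
    Disjoint ((r , s , (lr , us) , q<cr , q<cs) , (r′ , s′ , (lr′ , us′) , cr′<q , cs′<q)) with ≤-total 0ℚ c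
    ... | inj₁ 0≤c = <-irrefl refl (<-≤-trans (<-trans cs′<q q<cr) (*-monoˡ-≤ {c} {r} {s′} 0≤c (<⇒≤ (lower<upper x lr us′))))
    ... | inj₂ c≤0 = <-irrefl refl (<-≤-trans (<-trans cr′<q q<cs) (*-monoˡ-≤-nonPos c {{nonPositive c≤0}} (<⇒≤ (lower<upper x lr′ us))))

    Locate : ℚ → ℚ → Set
    Locate p q = Lower p ⊎ Upper q

    locate-pos : ∀ {p q u v} → 0ℚ < c → p < c * u → c * u < c * v → c * v < q → Locate p q
    locate-pos {p} {q} {u} {v} 0<c p<cu cu<cv cv<q with located x (*-cancelˡ {c} {u} {v} 0<c cu<cv) | lower-inhab x | upper-inhab x
    ... | inj₁ lu | _      | s , us = inj₁ (u , s , (lu , us) , p<cu , <-trans p<cu (*-monoˡ {c} {u} {s} 0<c (lower<upper x lu us)))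
    ... | inj₂ uv | r , lr | _      = inj₂ (r , v , (lr , uv) , <-trans (*-monoˡ {c} {r} {v} 0<c (lower<upper x lr uv)) cv<q , cv<q)

    locate-neg : ∀ {p q u v} → c < 0ℚ → p < c * u → c * u < c * v → c * v < q → Locate p q
    locate-neg {p} {q} {u} {v} c<0 p<cu cu<cv cv<q
      with located x (*-cancelˡ-<-nonPos c {{nonPositive (<⇒≤ c<0)}} cu<cv) | lower-inhab x | upper-inhab x
    ... | inj₁ lv | _      | s , us = inj₂ (v , s , (lv , us) , cv<q , <-trans (*-monoʳ-<-neg c {{negative c<0}} (lower<upper x lv us)) cv<q)
    ... | inj₂ uu | r , lr | _      = inj₁ (r , u , (lr , uu) , <-trans p<cu (*-monoʳ-<-neg c {{negative c<0}} (lower<upper x lr uu)) , p<cu)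

    locate-zero : ∀ {p q} → p < q → (∀ r → c * r ≡ 0ℚ) → Locate p q
    locate-zero {p} {q} p<q c*≡0 with lower-inhab x | upper-inhab x | p <? 0ℚ
    ... | r , lr | s , us | yes p<0 = inj₁ (r , s , (lr , us) , subst (p <_) (sym (c*≡0 r)) p<0 , subst (p <_) (sym (c*≡0 s)) p<0)
    ... | r , lr | s , us | no  p≮0 = inj₂ (r , s , (lr , us) , subst (_< q) (sym (c*≡0 r)) 0<q , subst (_< q) (sym (c*≡0 s)) 0<q)
      where 0<q = ≤-<-trans (≮⇒≥ p≮0) p<q

    fracs : ∀ {p q} → (∀ d → ∃[ e ] c * e ≡ d) → p < q → ∃[ u ] ∃[ v ] p < c * u × c * u < c * v × c * v < q
    fracs {p} {q} div p<q with half p<q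
    ... | d , p<d , d<q with half d<q
    ... | e , d<e , e<q with div d | div e
    ... | u , refl | v , refl = u , v , p<d , d<e , e<q

    frac⁻ : c < 0ℚ → ∀ d → ∃[ e ] c * e ≡ d
    frac⁻ c<0 d with frac { - c} d (neg-antimono-< c<0)
    ... | e , h = - e , trans (solve 2 (λ c e → c :* (:- e) := (:- c) :* e) refl c e) h
      where open +-*-Solver

    Located : ∀ {p q} → p < q → Locate p q
    Located {p} {q} p<q = by-sign (<-cmp 0ℚ c)
      where
      by-sign : Tri (0ℚ < c) (0ℚ ≡ c) (c < 0ℚ) → Locate p q
      by-sign (tri≈ _ e _)   = locate-zero p<q (λ r → trans (cong (_* r) (sym e)) (*-zeroˡ r))
      by-sign (tri< 0<c _ _) = (λ (u , v , h , k , l) → locate-pos {u = u} {v} 0<c h k l) (fracs (λ d → frac d 0<c) p<q)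
      by-sign (tri> _ _ c<0) = (λ (u , v , h , k , l) → locate-neg {u = u} {v} c<0 h k l) (fracs (frac⁻ c<0) p<q)

  infixl 7 _·_
  _·_ : ℚ → ℝ → ℝ
  c · x = record
    { lower        = Lower
    ; upper        = Upper
    ; lower-inhab  = Lower-inhab
    ; upper-inhab  = Upper-inhab
    ; lower-closed = Lower-closed
    ; upper-closed = Upper-closed
    ; lower-open   = Lower-open
    ; upper-open   = Upper-open
    ; disjoint     = Disjoint
    ; located      = Located
    }
    where open Scaling c x

  Positiveᴿ : ℝ → Set
  Positiveᴿ x = lower x 0ℚ

  base₀ : ∀ q → 1ℚ + q ≡ compound q 0
  base₀ = solve 1 (λ q → con 1ℚ :+ q := con 1ℚ :+ q :* con 1ℚ) refl
    where open +-*-Solver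

  exp<-small : ∀ {r i} → 0ℚ < r → 0ℚ < i → r * i ≡ 1ℚ → exp (- i) < r
  exp<-small {r} {i} 0<r 0<i ri≡1 = 0 , subst (0ℚ <_) e (<-trans 0<1 (p<p+q 1ℚ {i} 0<i)) ,
    subst (1ℚ <_) (trans e′ (cong (λ b → r * (b * 1ℚ)) e)) (p<p+q 1ℚ {r} 0<r)
    where
    open +-*-Solver
    e : 1ℚ + i ≡ compound (- - i) 0
    e = trans (cong (1ℚ +_) (sym (neg-involutive i))) (base₀ (- - i))
    e′ : 1ℚ + r ≡ r * ((1ℚ + i) * 1ℚ)
    e′ = trans (cong (_+ r) (sym ri≡1)) (solve 2 (λ r i → r :* i :+ r := r :* ((con 1ℚ :+ i) :* con 1ℚ)) refl r i)

  <exp-large : ∀ {s} → 0ℚ < s → s <exp s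
  <exp-large {s} 0<s = 0 , subst (0ℚ <_) (base₀ s) (<-trans 0<1 (p<p+q 1ℚ {s} 0<s)) ,
    subst (s <_) (trans (trans (+-comm s 1ℚ) (sym (*-identityʳ (1ℚ + s)))) (cong (_* 1ℚ) (base₀ s))) (p<p+q s 0<1)

  module Logarithm (x : ℝ) (0<x : Positiveᴿ x) where

    Lower Upper : ℚ → Set
    Lower q = ∃[ r ] exp q < r × lower x r
    Upper q = ∃[ r ] r <exp q × upper x r

    Lower-inhab : ∃ Lower
    Lower-inhab = inhabit (lower-open x 0<x)
      where
      invert : ∀ {r} → 0ℚ < r → lower x r → ∃[ i ] 0ℚ < i × r * i ≡ 1ℚ → ∃ Lower
      invert {r} 0<r lr (i , 0<i , ri≡1) = - i , r , exp<-small {r} {i} 0<r 0<i ri≡1 , lr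
      inhabit : ∃[ r ] 0ℚ < r × lower x r → ∃ Lower
      inhabit (r , 0<r , lr) = invert 0<r lr (recip 0<r)

    Upper-inhab : ∃ Upper
    Upper-inhab with upper-inhab x
    ... | s , us = s , s , <exp-large {s} (lower<upper x 0<x us) , us

    Lower-closed : ∀ {p q} → p < q → Lower q → Lower p
    Lower-closed {p} {q} p<q (r , e , lr) = r , exp<-anti-≤ {r} {p} {q} (<⇒≤ p<q) e , lr

    Upper-closed : ∀ {p q} → p < q → Upper p → Upper q
    Upper-closed {p} {q} p<q (r , e , ur) = r , <exp-mono-≤ {r} {p} {q} (<⇒≤ p<q) e , ur

    Lower-open : ∀ {p} → Lower p → ∃[ q ] p < q × Lower q
    Lower-open {p} (r , e , lr) = (λ (q , p<q , e′) → q , p<q , r , e′ , lr) (exp<-open {p} {r} e)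

    Upper-open : ∀ {q} → Upper q → ∃[ p ] p < q × Upper p
    Upper-open {q} (r , e , ur) = (λ (p , p<q , e′) → p , p<q , r , e′ , ur) (<exp-open {r} {q} (lower<upper x 0<x ur) e)

    Disjoint : ∀ {q} → ¬ (Lower q × Upper q)
    Disjoint {q} ((r , e , lr) , (s , e′ , us)) = <-asym (lower<upper x lr us) (exp-cut {q} {r} {s} e e′)

    Located : ∀ {p q} → p < q → Lower p ⊎ Upper q
    Located {p} {q} p<q = locate (exp-separated {p} {q} p<q)
      where
      locate : ∃[ r ] ∃[ t ] r < t × exp p < r × t <exp q → Lower p ⊎ Upper q
      locate (r , t , r<t , e , e′) = [ (λ lr → inj₁ (r , e , lr)) , (λ ut → inj₂ (t , e′ , ut)) ]′ (located x r<t)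

  -- q < log x  ⇔  exp q < x,  and  log x < q  ⇔  x < exp q
  log : (x : ℝ) → Positiveᴿ x → ℝ
  log x 0<x = record
    { lower        = Lower
    ; upper        = Upper
    ; lower-inhab  = Lower-inhab
    ; upper-inhab  = Upper-inhab
    ; lower-closed = Lower-closed
    ; upper-closed = Upper-closed
    ; lower-open   = Lower-open
    ; upper-open   = Upper-open
    ; disjoint     = λ {q} → Disjoint {q}
    ; located      = Located
    }
    where open Logarithm x 0<x

  exp0<r : ∀ {r} → 1ℚ < r → exp 0ℚ < r
  exp0<r {r} 1<r = 0 , 0<1 , subst (1ℚ <_) (sym (*-identityʳ r)) 1<r

  log-positive : ∀ x (0<x : Positiveᴿ x) → lower x 1ℚ → Positiveᴿ (log x 0<x)
  log-positive x 0<x 1<x = (λ (r , 1<r , lr) → r , exp0<r {r} 1<r , lr) (lower-open x 1<x)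

  fromℕ-< : ∀ {m n} → m ℕ.< n → fromℕ m < fromℕ n
  fromℕ-< {m} {n} m<n = *<* (subst₂ ℤ._<_ (sym (ℤₚ.*-identityʳ (ℤ.+ m))) (sym (ℤₚ.*-identityʳ (ℤ.+ n))) (ℤ.+<+ m<n))

  loglog : (n : ℕ) .{{_ : ℕ.NonTrivial n}} → ℝ
  loglog n = log (log x 0<x) (log-positive x 0<x 1<x)
    where
    x   = fromℚ (fromℕ n)
    1<x : lower x 1ℚ
    1<x = fromℕ-< {1} {n} (ℕ.nonTrivial⇒n>1 n)
    0<x : Positiveᴿ x
    0<x = <-trans 0<1 1<x

module Characters where

  open Reals using (fromℕ; fromℕ-suc; fromℤ-+; fromℤ-*; fromℕ-inverse)
  open import Data.Nat.Base as ℕ using (ℕ; zero; suc)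
  import Data.Nat.Properties as ℕₚ
  import Data.Nat.Divisibility as ℕ∣
  import Data.Nat.Coprimality as ℕC
  open import Data.Integer.Base as ℤ using (ℤ; 1ℤ; ∣_∣)
  import Data.Integer.Properties as ℤₚ
  open import Data.Integer.DivMod using (_%ℕ_; _/ℕ_; n%ℕd<d; a≡a%ℕn+[a/ℕn]*n)
  open import Data.Integer.Coprimality using (Coprime; coprime?)
  open import Data.Integer.Divisibility.Signed
  import Data.Integer.Solver as ℤSolver
  open import Data.Rational.Base using (ℚ; mkℚ; 0ℚ; 1ℚ; _+_; _*_; -_; _-_; 1/_; _/_)
  open import Data.Rational.Properties
  open import Data.Rational.Literals using (fromℤ)
  open import Data.Rational.Solver using (module +-*-Solver)
  open import Data.Fin.Base as Fin using (Fin; zero; suc; toℕ; fromℕ<)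
  import Data.Fin.Properties as Finₚ
  open import Data.List.Base using (List; []; _∷_; lookup; length; upTo; cartesianProductWith; mapMaybe; map; deduplicate)
  open import Data.List.Relation.Unary.Any as Any using (Any; here; there)
  import Data.List.Relation.Unary.Any.Properties as Anyₚ
  open import Data.List.Relation.Unary.All as All using (All; []; _∷_)
  open import Data.List.Relation.Unary.AllPairs using ([]; _∷_)
  import Data.List.Membership.Propositional.Properties as Mem
  open import Data.List.Relation.Unary.Enumerates.Setoid using (IsEnumeration)
  open import Data.List.Relation.Unary.Enumerates.Setoid.Properties using (lookup-surjective; deduplicate⁺)
  import Data.List.Relation.Unary.Unique.Setoid as Unique
  open import Data.List.Relation.Unary.Unique.DecSetoid.Properties using (deduplicate-!)
  open import Data.Vec.Base as Vec using (Vec; []; _∷_)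
  open import Data.Maybe.Base as Maybe using (Maybe; just; nothing)
  open import Data.Maybe.Relation.Binary.Pointwise as Pointwise using (Pointwise; just; nothing; drop-just)
  import Data.Maybe.Relation.Unary.Any as MAny
  open import Data.Product.Base using (Σ; ∃; ∃-syntax; Σ-syntax; _×_; _,_; proj₁; proj₂)
  open import Data.Sum.Base using (inj₁; inj₂)
  open import Data.Empty using (⊥-elim)
  open import Function.Base using (_∘_; _on_)
  open import Function.Bundles using (_⇔_; mk⇔; Bijection; module Equivalence)
  open import Relation.Nullary using (¬_; Dec; yes; no; contradiction)
  open import Relation.Nullary.Decidable using (map′; _×-dec_; _→-dec_; ¬?; dec⇒maybe)
  open import Relation.Unary using (Pred; Decidable)
  open import Relation.Binary.Bundles using (Setoid; DecSetoid)
  import Relation.Binary.Construct.On as On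
  open import Relation.Binary.PropositionalEquality as ≡ using (_≡_; _≢_; refl; cong; cong₂; subst)
  open import Level using (0ℓ)

  -- equality in ℚ/ℤ
  infix 4 _~_ _~?_
  record _~_ (s t : ℚ) : Set where
    constructor _,_
    field
      shift      : ℤ
      difference : s - t ≡ fromℤ shift

  ~-refl : ∀ {t} → t ~ t
  ~-refl {t} = ℤ.0ℤ , +-inverseʳ t

  fromℤ-neg : ∀ z → fromℤ (ℤ.- z) ≡ - fromℤ z
  fromℤ-neg (ℤ.+ zero) = refl
  fromℤ-neg (ℤ.+ suc n) = refl
  fromℤ-neg ℤ.-[1+ n ] = refl

  ~-sym : ∀ {s t} → s ~ t → t ~ s
  ~-sym {s} {t} (z , e) = ℤ.- z , ≡.trans (solve 2 (λ s t → t :- s := :- (s :- t)) refl s t) (≡.trans (cong -_ e) (≡.sym (fromℤ-neg z)))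
    where open +-*-Solver

  ~-trans : ∀ {s t u} → s ~ t → t ~ u → s ~ u
  ~-trans {s} {t} {u} (y , e) (z , f) = y ℤ.+ z ,
    ≡.trans (solve 3 (λ s t u → s :- u := (s :- t) :+ (t :- u)) refl s t u) (≡.trans (cong₂ _+_ e f) (≡.sym (fromℤ-+ y z)))
    where open +-*-Solver

  ~-+ : ∀ {s t u v} → s ~ t → u ~ v → s + u ~ t + v
  ~-+ {s} {t} {u} {v} (y , e) (z , f) = y ℤ.+ z ,
    ≡.trans (solve 4 (λ s t u v → (s :+ u) :- (t :+ v) := (s :- t) :+ (u :- v)) refl s t u v) (≡.trans (cong₂ _+_ e f) (≡.sym (fromℤ-+ y z)))
    where open +-*-Solver

  integer? : ∀ t → Dec (∃[ z ] t ≡ fromℤ z)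
  integer? (mkℚ z zero _) = yes (z , refl)
  integer? (mkℚ z (suc d) _) = no λ ()

  _~?_ : ∀ s t → Dec (s ~ t)
  s ~? t = map′ (λ (z , e) → z , e) (λ (z , e) → z , e) (integer? (s - t))

  ℚ/ℤ : DecSetoid 0ℓ 0ℓ
  ℚ/ℤ = record
    { Carrier = ℚ
    ; _≈_ = _~_
    ; isDecEquivalence = record
      { isEquivalence = record { refl = ~-refl ; sym = ~-sym ; trans = ~-trans }
      ; _≟_ = _~?_ } }

  -- The values of a Dirichlet character are 0 and roots of unity. The root of unity e^(2πit) is
  -- represented by just t with t taken in ℚ/ℤ, and 0 by nothing, so that products of values are sums
  -- of arguments.
  μ₀ : DecSetoid 0ℓ 0ℓ
  μ₀ = Pointwise.decSetoid ℚ/ℤ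

  open DecSetoid μ₀ public using () renaming (Carrier to Value; _≈_ to infix 4 _≈_; _≟_ to infix 4 _≈?_; refl to ≈-refl; sym to ≈-sym; trans to ≈-trans)

  𝟘 𝟙 : Value
  𝟘 = nothing
  𝟙 = just 0ℚ

  infixl 7 _⊗_
  _⊗_ : Value → Value → Value
  _⊗_ = Maybe.zipWith _+_

  ⊗-cong : ∀ {u v w x} → u ≈ v → w ≈ x → u ⊗ w ≈ v ⊗ x
  ⊗-cong (just p) (just q) = just (~-+ p q)
  ⊗-cong (just p) nothing = nothing
  ⊗-cong nothing q = nothing

  record IsDirichletCharacter (n : ℕ) (χ : ℤ → Value) : Set where
    field
      periodic       : ∀ a b → ℤ.+ n ∣ a ℤ.- b → χ a ≈ χ b
      multiplicative : ∀ a b → χ (a ℤ.* b) ≈ χ a ⊗ χ b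
      support        : ∀ a → χ a ≈ 𝟘 ⇔ (¬ Coprime a (ℤ.+ n))

  record DirichletCharacter (n : ℕ) : Set where
    field
      fun                  : ℤ → Value
      isDirichletCharacter : IsDirichletCharacter n fun
    open IsDirichletCharacter isDirichletCharacter public

  open DirichletCharacter

  -- d is an induced modulus of χ when χ is trivial on the kernel of (ℤ/n)ˣ → (ℤ/d)ˣ, i.e. when χ
  -- comes from a character modulo d; the conductor is the least induced modulus.
  IsInducedModulus : ∀ {n} → DirichletCharacter n → ℕ → Set
  IsInducedModulus {n} χ d = d ℕ∣.∣ n × (∀ a → Coprime a (ℤ.+ n) → ℤ.+ d ∣ a ℤ.- 1ℤ → fun χ a ≈ 𝟙)

  IsConductor : ∀ {n} → DirichletCharacter n → ℕ → Set
  IsConductor χ d = IsInducedModulus χ d × (∀ e → IsInducedModulus χ e → d ℕ.≤ e)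

  IsPrimitive : ∀ {n} → DirichletCharacter n → Set
  IsPrimitive {n} χ = IsConductor χ n

  module Residues (n : ℕ) .{{_ : ℕ.NonZero n}} where

    residue : ℤ → Fin n
    residue a = fromℕ< (n%ℕd<d a n)

    rep : Fin n → ℤ
    rep i = ℤ.+ toℕ i

    rep-residue : ∀ a → ℤ.+ n ∣ a ℤ.- rep (residue a)
    rep-residue a rewrite Finₚ.toℕ-fromℕ< (n%ℕd<d a n) = divides (a /ℕ n) (begin
      a ℤ.- ℤ.+ (a %ℕ n)                     ≡⟨ cong (ℤ._- ℤ.+ (a %ℕ n)) (a≡a%ℕn+[a/ℕn]*n a n) ⟩
      (ℤ.+ (a %ℕ n) ℤ.+ q) ℤ.- ℤ.+ (a %ℕ n)  ≡⟨ solve 2 (λ r q → (r :+ q) :- r := q) refl (ℤ.+ (a %ℕ n)) q ⟩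
      q                                      ∎)
      where
      open ≡.≡-Reasoning
      open ℤSolver.+-*-Solver
      q = (a /ℕ n) ℤ.* ℤ.+ n

    congruent-sym : ∀ {a b} → ℤ.+ n ∣ a ℤ.- b → ℤ.+ n ∣ b ℤ.- a
    congruent-sym {a} {b} h = subst (ℤ.+ n ∣_) (solve 2 (λ a b → :- (a :- b) := b :- a) refl a b) (∣m⇒∣-m h)
      where open ℤSolver.+-*-Solver

    congruent-trans : ∀ {a b c} → ℤ.+ n ∣ a ℤ.- b → ℤ.+ n ∣ b ℤ.- c → ℤ.+ n ∣ a ℤ.- c
    congruent-trans {a} {b} {c} h k = subst (ℤ.+ n ∣_) (solve 3 (λ a b c → (a :- b) :+ (b :- c) := a :- c) refl a b c) (∣m∣n⇒∣m+n h k)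
      where open ℤSolver.+-*-Solver

    congruent-refl : ∀ {a b} → a ≡ b → ℤ.+ n ∣ a ℤ.- b
    congruent-refl {a} refl = divides ℤ.0ℤ (ℤₚ.+-inverseʳ a)

    small-divisible : ∀ i j → toℕ i ℕ.≤ toℕ j → ℤ.+ n ∣ rep j ℤ.- rep i → i ≡ j
    small-divisible i j i≤j h with toℕ j ℕ.∸ toℕ i in e | subst (λ z → n ℕ∣.∣ ∣ z ∣) (≡.trans (ℤₚ.m-n≡m⊖n (toℕ j) (toℕ i)) (ℤₚ.⊖-≥ i≤j)) (∣⇒∣ᵤ h)
    ... | zero  | _   = Finₚ.toℕ-injective (ℕₚ.≤-antisym i≤j (ℕₚ.m∸n≡0⇒m≤n e))
    ... | suc k | n∣k = contradiction (ℕ∣.∣⇒≤ n∣k) (ℕₚ.<⇒≱ (ℕₚ.≤-<-trans (subst (ℕ._≤ toℕ j) e (ℕₚ.m∸n≤m (toℕ j) (toℕ i))) (Finₚ.toℕ<n j)))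

    rep-injective : ∀ i j → ℤ.+ n ∣ rep i ℤ.- rep j → i ≡ j
    rep-injective i j h with ℕₚ.≤-total (toℕ i) (toℕ j)
    ... | inj₁ i≤j = small-divisible i j i≤j (congruent-sym {rep i} {rep j} h)
    ... | inj₂ j≤i = ≡.sym (small-divisible j i j≤i h)

    residue-cong : ∀ a b → ℤ.+ n ∣ a ℤ.- b → residue a ≡ residue b
    residue-cong a b h = rep-injective (residue a) (residue b)
      (congruent-trans {rep (residue a)} {a} (congruent-sym {a} (rep-residue a)) (congruent-trans {a} {b} h (rep-residue b)))

    Periodic : (ℤ → Set) → Set
    Periodic P = ∀ a b → ℤ.+ n ∣ a ℤ.- b → P a → P b

    all-residues? : ∀ {P : ℤ → Set} → Periodic P → Decidable P → Dec (∀ a → P a)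
    all-residues? P-periodic P? = map′
      (λ p a → P-periodic _ a (congruent-sym {a} (rep-residue a)) (p (residue a)))
      (λ p i → p (rep i)) (Finₚ.all? (λ i → P? (rep i)))

    ∣-shift : ∀ {d} → d ∣ ℤ.+ n → ∀ a b → ℤ.+ n ∣ a ℤ.- b → d ∣ a → d ∣ b
    ∣-shift {d} d∣n a b h d∣a = subst (d ∣_) (solve 2 (λ a b → a :- (a :- b) := b) refl a b) (∣m∣n⇒∣m-n d∣a (∣-trans d∣n h))
      where open ℤSolver.+-*-Solver

    coprime-shift : ∀ a b → ℤ.+ n ∣ a ℤ.- b → Coprime a (ℤ.+ n) → Coprime b (ℤ.+ n)
    coprime-shift a b h c {d} (d∣b , d∣n) = c {d} (∣⇒∣ᵤ (∣-shift {ℤ.+ d} (∣ᵤ⇒∣ d∣n) b a (congruent-sym {a} h) (∣ᵤ⇒∣ d∣b)) , d∣n)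

    ¬coprime-shift : ∀ a b → ℤ.+ n ∣ a ℤ.- b → ¬ Coprime a (ℤ.+ n) → ¬ Coprime b (ℤ.+ n)
    ¬coprime-shift a b h ¬c c = ¬c (coprime-shift b a (congruent-sym {a} h) c)

    *-shiftˡ : ∀ c a b → ℤ.+ n ∣ a ℤ.- b → ℤ.+ n ∣ c ℤ.* a ℤ.- c ℤ.* b
    *-shiftˡ c a b h = subst (ℤ.+ n ∣_) (solve 3 (λ c a b → c :* (a :- b) := c :* a :- c :* b) refl c a b) (∣n⇒∣m*n c h)
      where open ℤSolver.+-*-Solver

    *-shiftʳ : ∀ c a b → ℤ.+ n ∣ a ℤ.- b → ℤ.+ n ∣ a ℤ.* c ℤ.- b ℤ.* c
    *-shiftʳ c a b h = subst₂ (λ x y → ℤ.+ n ∣ x ℤ.- y) (ℤₚ.*-comm c a) (ℤₚ.*-comm c b) (*-shiftˡ c a b h)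
      where open ≡ using (subst₂)

    module _ {χ : ℤ → Value} (χ-periodic : ∀ a b → ℤ.+ n ∣ a ℤ.- b → χ a ≈ χ b) where

      isDirichletCharacter? : Dec (IsDirichletCharacter n χ)
      isDirichletCharacter? = map′
        (λ (m , s) → record { periodic = χ-periodic ; multiplicative = m ; support = s })
        (λ c → IsDirichletCharacter.multiplicative c , IsDirichletCharacter.support c)
        (multiplicative? ×-dec support?)
        where
        multiplicative? : Dec (∀ a b → χ (a ℤ.* b) ≈ χ a ⊗ χ b)
        multiplicative? = all-residues?
          (λ a b h p c → ≈-trans (χ-periodic _ _ (*-shiftʳ c b a (congruent-sym {a} h))) (≈-trans (p c) (⊗-cong (χ-periodic a b h) ≈-refl)))
          (λ c → all-residues?
            (λ a b h p → ≈-trans (χ-periodic _ _ (*-shiftˡ c b a (congruent-sym {a} h))) (≈-trans p (⊗-cong (≈-refl {χ c}) (χ-periodic a b h))))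
            (λ a → χ (c ℤ.* a) ≈? χ c ⊗ χ a))
        support? : Dec (∀ a → χ a ≈ 𝟘 ⇔ (¬ Coprime a (ℤ.+ n)))
        support? = all-residues?
          (λ a b h p → mk⇔
             (λ z → ¬coprime-shift a b h (Equivalence.to p (≈-trans (χ-periodic a b h) z)))
             (λ nc → ≈-trans (χ-periodic b a (congruent-sym {a} h)) (Equivalence.from p (¬coprime-shift b a (congruent-sym {a} h) nc))))
          (λ a → map′ (λ (f , g) → mk⇔ f g) (λ e → Equivalence.to e , Equivalence.from e)
             ((χ a ≈? 𝟘 →-dec ¬? (coprime? a (ℤ.+ n))) ×-dec (¬? (coprime? a (ℤ.+ n)) →-dec χ a ≈? 𝟘)))


    module _ (χ : DirichletCharacter n) where

      isInducedModulus? : ∀ d → Dec (IsInducedModulus χ d)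
      isInducedModulus? d with d ℕ∣.∣? n
      ... | no d∤n = no (d∤n ∘ proj₁)
      ... | yes d∣n = map′ (d∣n ,_) proj₂ (all-residues? {P = λ a → Coprime a (ℤ.+ n) → ℤ.+ d ∣ a ℤ.- 1ℤ → fun χ a ≈ 𝟙}
        (λ a b h p c k → ≈-trans (periodic χ b a (congruent-sym {a} h)) (p (coprime-shift b a (congruent-sym {a} h) c)
           (subst (ℤ.+ d ∣_) (solve 2 (λ a b → (a :- b) :+ (b :- con 1ℤ) := a :- con 1ℤ) refl a b) (∣m∣n⇒∣m+n (∣-trans (∣ᵤ⇒∣ d∣n) h) k))))
        (λ a → coprime? a (ℤ.+ n) →-dec (ℤ.+ d ∣? a ℤ.- 1ℤ →-dec fun χ a ≈? 𝟙)))
        where open ℤSolver.+-*-Solver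

      isPrimitive? : Dec (IsPrimitive χ)
      isPrimitive? = isInducedModulus? n ×-dec map′ minimal (λ m i → m (toℕ i))
        (Finₚ.all? (λ (i : Fin n) → isInducedModulus? (toℕ i) →-dec n ℕₚ.≤? toℕ i))
        where
        minimal : (∀ (i : Fin n) → IsInducedModulus χ (toℕ i) → n ℕ.≤ toℕ i) → ∀ e → IsInducedModulus χ e → n ℕ.≤ e
        minimal p e ind with e ℕₚ.<? n
        ... | no e≮n  = ℕₚ.≮⇒≥ e≮n
        ... | yes e<n = subst (n ℕ.≤_) (Finₚ.toℕ-fromℕ< e<n) (p (fromℕ< e<n) (subst (IsInducedModulus χ) (≡.sym (Finₚ.toℕ-fromℕ< e<n)) ind))

  open Residues

  𝓧 : (n : ℕ) .{{_ : ℕ.NonZero n}} → DecSetoid 0ℓ 0ℓ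
  𝓧 n = record
    { Carrier = DirichletCharacter n
    ; _≈_     = λ χ ψ → ∀ a → fun χ a ≈ fun ψ a
    ; isDecEquivalence = record
      { isEquivalence = record
        { refl  = λ _ → ≈-refl
        ; sym   = λ p a → ≈-sym (p a)
        ; trans = λ p q a → ≈-trans (p a) (q a)
        }
      ; _≟_ = λ χ ψ → all-residues? n
          (λ a b h p → ≈-trans (periodic χ b a (congruent-sym n {a} h)) (≈-trans p (periodic ψ a b h)))
          (λ a → fun χ a ≈? fun ψ a)
      }
    }

  𝓧′ : (n : ℕ) .{{_ : ℕ.NonZero n}} → DecSetoid 0ℓ 0ℓ
  𝓧′ n = On.decSetoid (𝓧 n) (proj₁ {B = IsPrimitive})

  Finite : DecSetoid 0ℓ 0ℓ → Set
  Finite S = ∃[ m ] Bijection (≡.setoid (Fin m)) (DecSetoid.setoid S)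

  module _ (S : DecSetoid 0ℓ 0ℓ) where
    open DecSetoid S using (setoid) renaming (Carrier to A; _≈_ to _≋_; sym to ≋-sym; _≟_ to _≋?_; reflexive to ≋-reflexive)
    open Unique setoid using (Unique)

    lookup-injective : ∀ {xs} → Unique xs → ∀ i j → lookup xs i ≋ lookup xs j → i ≡ j
    lookup-injective (x ∷ u) zero    zero    e = refl
    lookup-injective (x ∷ u) zero    (suc j) e = contradiction e (All.lookup x (Mem.∈-lookup j))
    lookup-injective (x ∷ u) (suc i) zero    e = contradiction (≋-sym e) (All.lookup x (Mem.∈-lookup i))
    lookup-injective (x ∷ u) (suc i) (suc j) e = cong suc (lookup-injective u i j e)

    enumerated⇒finite : ∀ {xs} → IsEnumeration setoid xs → Finite S
    enumerated⇒finite {xs} enum = length ys , record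
      { to        = lookup ys
      ; cong      = ≋-reflexive ∘ cong (lookup ys)
      ; bijective = lookup-injective (deduplicate-! S xs) _ _ , lookup-surjective setoid (deduplicate⁺ S enum)
      }
      where ys = deduplicate _≋?_ xs

  vectors : ∀ {A : Set} → List A → ∀ n → List (Vec A n)
  vectors xs zero    = [] ∷ []
  vectors xs (suc n) = cartesianProductWith _∷_ xs (vectors xs n)

  vectors-complete : ∀ {A : Set} {xs : List A} n (P : Fin n → A → Set) → (∀ i → Any (P i) xs) →
                     Any (λ v → ∀ i → P i (Vec.lookup v i)) (vectors xs n)
  vectors-complete zero    P p = here λ ()
  vectors-complete (suc n) P p = Anyₚ.cartesianProductWith⁺ _∷_ (λ { px pv zero → px ; px pv (suc i) → pv i })
    (p zero) (vectors-complete n (P ∘ suc) (p ∘ suc))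

  mapMaybe-complete : ∀ {A B : Set} {P : A → Set} {Q : B → Set} (f : A → Maybe B) →
                      (∀ {x} → P x → MAny.Any Q (f x)) → ∀ {xs} → Any P xs → Any Q (mapMaybe f xs)
  mapMaybe-complete f g {xs} p = Anyₚ.mapMaybe⁺ f xs (Anyₚ.map⁺ (Any.map g p))

  -- root k m = e^(2πik/(m+1))
  root : ℕ → ℕ → Value
  root k m = just (fromℕ k * 1/ fromℕ (suc m))

  candidates : ℕ → List Value
  candidates n = nothing ∷ cartesianProductWith root (upTo n) (upTo n)

  ∈candidates : ∀ {n k m v} → k ℕ.< n → m ℕ.< n → root k m ≈ v → Any (_≈ v) (candidates n)
  ∈candidates k<n m<n e = there (Anyₚ.cartesianProductWith⁺ root (λ { refl refl → e }) (Mem.∈-upTo⁺ k<n) (Mem.∈-upTo⁺ m<n))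

  torsion⇒root : ∀ m t z → fromℕ (suc m) * t ≡ fromℤ z → root (z %ℕ suc m) m ≈ just t
  torsion⇒root m t z e = just (~-sym (q , ≡.trans (cong (λ u → u - r * i) t≡) (solve 2 (λ a b → a :+ b :- a := b) refl (r * i) (fromℤ q))))
    where
    open +-*-Solver
    M = fromℕ (suc m)
    i = 1/ fromℕ (suc m)
    r = fromℕ (z %ℕ suc m)
    q = z /ℕ suc m
    z≡ : fromℤ z ≡ r + fromℤ q * M
    z≡ = ≡.trans (cong fromℤ (a≡a%ℕn+[a/ℕn]*n z (suc m))) (≡.trans (fromℤ-+ (ℤ.+ (z %ℕ suc m)) (q ℤ.* ℤ.+ suc m)) (cong (r +_) (fromℤ-* q (ℤ.+ suc m))))
    cancel : ∀ {M i} r q t → M * i ≡ 1ℚ → M * t ≡ r + q * M → t ≡ r * i + q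
    cancel {M} {i} r q t Mi Mt = begin
      t                    ≡⟨ *-identityˡ t ⟨
      1ℚ * t               ≡⟨ cong (_* t) Mi ⟨
      M * i * t            ≡⟨ solve 3 (λ M i t → M :* i :* t := i :* (M :* t)) refl M i t ⟩
      i * (M * t)          ≡⟨ cong (i *_) Mt ⟩
      i * (r + q * M)      ≡⟨ solve 4 (λ i r q M → i :* (r :+ q :* M) := r :* i :+ q :* (M :* i)) refl i r q M ⟩
      r * i + q * (M * i)  ≡⟨ cong (λ u → r * i + q * u) Mi ⟩
      r * i + q * 1ℚ       ≡⟨ cong (r * i +_) (*-identityʳ q) ⟩
      r * i + q            ∎
      where open ≡.≡-Reasoning
    t≡ : t ≡ r * i + fromℤ q
    t≡ = cancel {M} {i} r (fromℤ q) t (fromℕ-inverse m) (≡.trans e z≡)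

  module _ {n : ℕ} .{{_ : ℕ.NonZero n}} (χ : DirichletCharacter n) where

    power : ∀ a t → fun χ a ≈ just t → ∀ k → fun χ (a ℤ.^ suc k) ≈ just (fromℕ (suc k) * t)
    power a t e zero    = ≈-trans (DecSetoid.reflexive μ₀ (cong (fun χ) (ℤₚ.^-identityʳ a))) (≈-trans e (DecSetoid.reflexive μ₀ (cong just (≡.sym (*-identityˡ t)))))
    power a t e (suc k) = ≈-trans (multiplicative χ a (a ℤ.^ suc k)) (≈-trans (⊗-cong e (power a t e k))
      (DecSetoid.reflexive μ₀ (cong just (≡.trans (distrib (fromℕ (suc k)) t) (cong (_* t) (≡.sym (fromℕ-suc (suc k))))))))
      where
      distrib : ∀ k t → t + k * t ≡ (1ℚ + k) * t
      distrib = solve 2 (λ k t → t :+ k :* t := (con 1ℚ :+ k) :* t) refl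
        where open +-*-Solver

    value-torsion : ∀ a t → fun χ a ≈ just t → ∃[ m ] m ℕ.< n × ∃[ z ] fromℕ (suc m) * t ≡ fromℤ z
    value-torsion a t e with Finₚ.pigeonhole (ℕₚ.n<1+n n) (λ i → residue n (a ℤ.^ suc (toℕ i)))
    ... | i , j , i<j , same = torsion (toℕ j ℕ.∸ suc (toℕ i)) (ℕₚ.m+[n∸m]≡n i<j) (ℕₚ.≤-pred (Finₚ.toℕ<n j)) powers
      where
      aⁱ≡aʲ : ℤ.+ n ∣ a ℤ.^ suc (toℕ j) ℤ.- a ℤ.^ suc (toℕ i)
      aⁱ≡aʲ = congruent-trans n {a ℤ.^ suc (toℕ j)} {rep n (residue n (a ℤ.^ suc (toℕ j)))} (rep-residue n (a ℤ.^ suc (toℕ j)))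
        (subst (λ r → ℤ.+ n ∣ rep n r ℤ.- a ℤ.^ suc (toℕ i)) same (congruent-sym n {a ℤ.^ suc (toℕ i)} (rep-residue n (a ℤ.^ suc (toℕ i)))))
      powers : fromℕ (suc (toℕ j)) * t ~ fromℕ (suc (toℕ i)) * t
      powers = drop-just (≈-trans (≈-sym (power a t e (toℕ j))) (≈-trans (periodic χ _ _ aⁱ≡aʲ) (power a t e (toℕ i))))
      torsion : ∀ {i j} d → suc i ℕ.+ d ≡ j → j ℕ.≤ n → fromℕ (suc j) * t ~ fromℕ (suc i) * t →
                ∃[ m ] m ℕ.< n × ∃[ z ] fromℕ (suc m) * t ≡ fromℤ z
      torsion {i} d refl j≤n (z , e) = d , ℕₚ.≤-trans (ℕₚ.+-monoˡ-≤ d (ℕ.s≤s ℕ.z≤n)) (ℕₚ.≤-trans (ℕₚ.≤-reflexive refl) (ℕₚ.≤-trans (ℕ.s≤s (ℕₚ.m≤n+m d i)) j≤n)) , z ,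
        ≡.trans (difference (fromℕ (suc i)) (fromℕ (suc d)) t (≡.trans (cong fromℕ (≡.sym (ℕₚ.+-suc (suc i) d))) (fromℤ-+ (ℤ.+ suc i) (ℤ.+ suc d)))) e
        where
        difference : ∀ I D {J} t → J ≡ I + D → D * t ≡ J * t - I * t
        difference I D t refl = solve 3 (λ I D t → D :* t := (I :+ D) :* t :- I :* t) refl I D t
          where open +-*-Solver

    value∈candidates : ∀ a → Any (_≈ fun χ a) (candidates n)
    value∈candidates a with fun χ a in e
    ... | nothing = here nothing
    ... | just t with value-torsion a t (DecSetoid.reflexive μ₀ e)
    ... | m , m<n , z , Mt≡z = ∈candidates (ℕₚ.<-≤-trans (n%ℕd<d z (suc m)) m<n) m<n (torsion⇒root m t z Mt≡z)

  module _ (n : ℕ) .{{_ : ℕ.NonZero n}} where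

    extend : Vec Value n → ℤ → Value
    extend v a = Vec.lookup v (residue n a)

    extend-periodic : ∀ v a b → ℤ.+ n ∣ a ℤ.- b → extend v a ≈ extend v b
    extend-periodic v a b h = DecSetoid.reflexive μ₀ (cong (Vec.lookup v) (residue-cong n a b h))

    fromDec : ∀ {f} → Dec (IsDirichletCharacter n f) → Maybe (DirichletCharacter n)
    fromDec (yes c) = just (record { fun = _ ; isDirichletCharacter = c })
    fromDec (no  _) = nothing

    fromDec-complete : ∀ χ {f} → (∀ a b → ℤ.+ n ∣ a ℤ.- b → f a ≈ f b) → (∀ a → fun χ a ≈ f a) →
                       (d : Dec (IsDirichletCharacter n f)) → MAny.Any (DecSetoid._≈_ (𝓧 n) χ) (fromDec d)
    fromDec-complete χ f-periodic χ≈ (yes c) = MAny.just χ≈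
    fromDec-complete χ f-periodic χ≈ (no ¬c) = contradiction (record
        { periodic       = f-periodic
        ; multiplicative = λ a b → ≈-trans (≈-sym (χ≈ (a ℤ.* b))) (≈-trans (multiplicative χ a b) (⊗-cong (χ≈ a) (χ≈ b)))
        ; support        = λ a → mk⇔ (λ z → Equivalence.to (support χ a) (≈-trans (χ≈ a) z))
                                     (λ nc → ≈-trans (≈-sym (χ≈ a)) (Equivalence.from (support χ a) nc))
        }) ¬c

    toCharacter : Vec Value n → Maybe (DirichletCharacter n)
    toCharacter v = fromDec (isDirichletCharacter? n (extend-periodic v))

    toCharacter-complete : ∀ χ {v} → (∀ i → Vec.lookup v i ≈ fun χ (rep n i)) →
                           MAny.Any (DecSetoid._≈_ (𝓧 n) χ) (toCharacter v)
    toCharacter-complete χ {v} h = fromDec-complete χ (extend-periodic v)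
      (λ a → ≈-trans (periodic χ _ _ (rep-residue n a)) (≈-sym (h (residue n a))))
      (isDirichletCharacter? n (extend-periodic v))

    characters : List (DirichletCharacter n)
    characters = mapMaybe toCharacter (vectors (candidates n) n)

    characters-enumerate : IsEnumeration (DecSetoid.setoid (𝓧 n)) characters
    characters-enumerate χ = mapMaybe-complete toCharacter (λ {v} → toCharacter-complete χ {v})
      (vectors-complete n (λ i u → u ≈ fun χ (rep n i)) (λ i → value∈candidates χ (rep n i)))

    isPrimitive-resp : ∀ {χ ψ : DirichletCharacter n} → DecSetoid._≈_ (𝓧 n) χ ψ → IsPrimitive χ → IsPrimitive ψ
    isPrimitive-resp {χ} {ψ} e (i , m) = induced {χ} {ψ} e i , λ d j → m d (induced {ψ} {χ} (λ a → ≈-sym (e a)) j)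
      where
      induced : ∀ {χ ψ : DirichletCharacter n} {d} → DecSetoid._≈_ (𝓧 n) χ ψ → IsInducedModulus χ d → IsInducedModulus ψ d
      induced e (d∣n , h) = d∣n , λ a c k → ≈-trans (≈-sym (e a)) (h a c k)

    keepPrimitive : ∀ χ → Dec (IsPrimitive χ) → Maybe (DecSetoid.Carrier (𝓧′ n))
    keepPrimitive χ (yes p) = just (χ , p)
    keepPrimitive χ (no  _) = nothing

    keepPrimitive-complete : ∀ χ → IsPrimitive χ → ∀ {ψ} → DecSetoid._≈_ (𝓧 n) χ ψ → (d : Dec (IsPrimitive ψ)) →
                             MAny.Any (λ ψ → DecSetoid._≈_ (𝓧 n) χ (proj₁ ψ)) (keepPrimitive ψ d)
    keepPrimitive-complete χ p {ψ} e (yes _) = MAny.just e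
    keepPrimitive-complete χ p {ψ} e (no ¬p) = contradiction (isPrimitive-resp {χ} {ψ} e p) ¬p

    primitiveCharacters : List (DecSetoid.Carrier (𝓧′ n))
    primitiveCharacters = mapMaybe (λ χ → keepPrimitive χ (isPrimitive? n χ)) characters

    primitiveCharacters-enumerate : IsEnumeration (DecSetoid.setoid (𝓧′ n)) primitiveCharacters
    primitiveCharacters-enumerate (χ , p) = mapMaybe-complete (λ ψ → keepPrimitive ψ (isPrimitive? n ψ))
      (λ {ψ} e → keepPrimitive-complete χ p {ψ} e (isPrimitive? n ψ)) (characters-enumerate χ)

    𝓧-finite : Finite (𝓧 n)
    𝓧-finite = enumerated⇒finite (𝓧 n) characters-enumerate

    𝓧′-finite : Finite (𝓧′ n)
    𝓧′-finite = enumerated⇒finite (𝓧′ n) primitiveCharacters-enumerate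

  coprime-*⁻ : ∀ a b c → Coprime (a ℤ.* b) c → Coprime a c × Coprime b c
  coprime-*⁻ a b c h =
    (λ {i} (i∣a , i∣c) → h {i} (subst (i ℕ∣.∣_) (≡.sym (ℤₚ.abs-* a b)) (ℕ∣.∣-trans i∣a (ℕ∣.m∣m*n ∣ b ∣)) , i∣c)) ,
    (λ {i} (i∣b , i∣c) → h {i} (subst (i ℕ∣.∣_) (≡.sym (ℤₚ.abs-* a b)) (ℕ∣.∣-trans i∣b (ℕ∣.n∣m*n ∣ a ∣)) , i∣c))

  coprime-*⁺ : ∀ a b c → Coprime a c → Coprime b c → Coprime (a ℤ.* b) c
  coprime-*⁺ a b c h k {i} (i∣ab , i∣c) = k {i} (ℕC.coprime-divisor {i} {∣ a ∣} {∣ b ∣}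
    (λ {j} (j∣i , j∣a) → h {j} (j∣a , ℕ∣.∣-trans j∣i i∣c)) (subst (i ℕ∣.∣_) (ℤₚ.abs-* a b) i∣ab) , i∣c)

  indicator : ∀ {P : Set} → Dec P → Value
  indicator (yes _) = 𝟙
  indicator (no  _) = 𝟘

  indicator-cong : ∀ {P Q : Set} → (P → Q) → (Q → P) → (d : Dec P) (e : Dec Q) → indicator d ≈ indicator e
  indicator-cong f g (yes p) (yes q) = ≈-refl
  indicator-cong f g (yes p) (no ¬q) = contradiction (f p) ¬q
  indicator-cong f g (no ¬p) (yes q) = contradiction (g q) ¬p
  indicator-cong f g (no ¬p) (no ¬q) = ≈-refl

  indicator-× : ∀ {P Q : Set} (d : Dec P) (e : Dec Q) → indicator (d ×-dec e) ≈ indicator d ⊗ indicator e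
  indicator-× (yes p) (yes q) = ≈-refl
  indicator-× (yes p) (no ¬q) = ≈-refl
  indicator-× (no ¬p) e       = ≈-refl

  indicator-𝟘 : ∀ {P : Set} (d : Dec P) → indicator d ≈ 𝟘 ⇔ (¬ P)
  indicator-𝟘 (yes p) = mk⇔ (λ ()) (λ ¬p → contradiction p ¬p)
  indicator-𝟘 (no ¬p) = mk⇔ (λ _ → ¬p) (λ _ → ≈-refl)

  principal : ∀ n .{{_ : ℕ.NonZero n}} → DirichletCharacter n
  principal n = record
    { fun = λ a → indicator (cop? a)
    ; isDirichletCharacter = record
      { periodic       = λ a b h → indicator-cong {Coprime a N} {Coprime b N} (coprime-shift n a b h)
                           (coprime-shift n b a (congruent-sym n {a} h)) (cop? a) (cop? b)
      ; multiplicative = λ a b → ≈-trans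
          (indicator-cong {Coprime (a ℤ.* b) N} {Coprime a N × Coprime b N} (coprime-*⁻ a b N) (λ (c , d) → coprime-*⁺ a b N c d) (cop? (a ℤ.* b)) (cop? a ×-dec cop? b))
          (indicator-× (cop? a) (cop? b))
      ; support        = λ a → indicator-𝟘 (cop? a)
      }
    }
    where
    N = ℤ.+ n
    cop? : ∀ a → Dec (Coprime a N)
    cop? a = coprime? a N

  finite-nonZero : ∀ S (f : Finite S) → DecSetoid.Carrier S → ℕ.NonZero (proj₁ f)
  finite-nonZero S (zero  , b) x with Bijection.strictlySurjective b x
  ... | () , _
  finite-nonZero S (suc m , b) x = _

  ∣𝓧∣ ∣𝓧′∣ : (n : ℕ) .{{_ : ℕ.NonZero n}} → ℕ
  ∣𝓧∣  n = proj₁ (𝓧-finite n)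
  ∣𝓧′∣ n = proj₁ (𝓧′-finite n)

  ρ : (n : ℕ) .{{_ : ℕ.NonZero n}} → ℚ
  ρ n = _/_ (ℤ.+ ∣𝓧′∣ n) (∣𝓧∣ n) {{finite-nonZero (𝓧 n) (𝓧-finite n) (principal n)}}

open Primes public using (ω; nthPrime; primorial; 2*primorial>1; 2*primorial≢0)
open Reals public using (ℝ; _≤ᴿ_; _·_; log; loglog)
open Characters public using (DirichletCharacter; IsPrimitive; 𝓧; 𝓧′; ρ)

{-# OPTIONS --safe #-}
module Submission where

-- Both factors of ρ(n) log log n are bounded below by their values at 2nₖ. By duality for finite abelian groups,
-- |𝓧ₙ| = |(ℤ/n)ˣ|. An imprimitive character modulo pᵃ comes from one modulo pᵃ⁻¹, so ρ(pᵃ) is 1 - 1/(p - 1) for a = 1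
-- and 1 - 1/p for a > 1, and ρ is multiplicative by the Chinese remainder theorem. Unless n ≡ 2 (mod 4), a prime
-- divisor p of n therefore contributes at least 1 - 1/max(2, p - 1) to ρ(n), with equality throughout for n = 2nₖ.
-- This bound increases with p, and the i-th smallest prime divisor of n is at least the i-th prime.

-- The modulus is 2nₖ and not nₖ because no character modulo nₖ is primitive: nₖ ≡ 2 (mod 4), and a
-- character modulo 2m with m odd comes from one modulo m. The bound on the second factor amounts to
-- n ≥ 2nₖ, which fails for k = 1, where n = 3 < 4. Multiplying the two bounds also needs log log
-- 2nₖ > 0, and 2nₖ ≥ 12 settles that. Size and proportion come out of one induction over the prime
-- divisors of n in increasing order, with the proportions cross-multiplied in ℕ. It is stated for
-- any run of consecutive primes: removing the least prime divisor shifts the run, and the size of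
-- an odd n is compared with the run from 3 on. The congruence condition enters as `2 ∣ n → 4 ∣ n`,
-- which survives the removal. Duality is proved without splitting the group into cyclic factors. A
-- subgroup grows by one element at a time, and each step multiplies the number of elements and the
-- number of characters by the same m, because m t = c has exactly m solutions t in ℚ/ℤ.

open import Defs

-- Finite cardinalities of setoids

module Counting where

  open import Data.Nat.Base using (ℕ; _+_; _*_)
  open import Data.Fin.Base using (Fin; combine; remQuot; splitAt; join)
  open import Data.Fin.Properties using (remQuot-combine; combine-remQuot; splitAt-join; join-splitAt; cantor-schröder-bernstein)
  open import Data.Product.Base using (_×_; _,_; ∃-syntax; ∃₂; proj₁; proj₂)
  open import Data.Sum.Base using (_⊎_; inj₁; inj₂; [_,_]′)
  open import Data.Empty using (⊥-elim)
  open import Function.Base using (_∘_)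
  open import Function.Bundles using (Bijection)
  open import Relation.Nullary using (¬_)
  open import Relation.Binary.Bundles using (Setoid)
  open import Relation.Binary.PropositionalEquality as ≡ using (_≡_; refl; cong)
  open import Level using (0ℓ)

  Card : Setoid 0ℓ 0ℓ → ℕ → Set
  Card S n = Bijection (≡.setoid (Fin n)) S

  module _ {S : Setoid 0ℓ 0ℓ} where
    open Setoid S using (_≈_; reflexive; trans) renaming (Carrier to A; sym to ≈-sym)

    mkCard : ∀ {n} (f : Fin n → A) → (∀ {i j} → f i ≈ f j → i ≡ j) → (∀ a → ∃[ i ] f i ≈ a) → Card S n
    mkCard f inj surj = record
      { to        = f
      ; cong      = reflexive ∘ cong f
      ; bijective = inj , λ a → proj₁ (surj a) , λ e → trans (reflexive (cong f e)) (proj₂ (surj a))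
      }

    -- The two enumerations inject their index sets into each other.
    card-unique : ∀ {m n} → Card S m → Card S n → m ≡ n
    card-unique α β = cantor-schröder-bernstein (injects α β) (injects β α)
      where
      injects : ∀ {m n} (α : Card S m) (β : Card S n) {i j} →
                proj₁ (Bijection.strictlySurjective β (Bijection.to α i)) ≡ proj₁ (Bijection.strictlySurjective β (Bijection.to α j)) → i ≡ j
      injects α β {i} {j} e = Bijection.injective α
        (trans (≈-sym (proj₂ (Bijection.strictlySurjective β (Bijection.to α i))))
               (trans (reflexive (cong (Bijection.to β) e)) (proj₂ (Bijection.strictlySurjective β (Bijection.to α j)))))

  module _ {S U : Setoid 0ℓ 0ℓ} where
    open Setoid S using (_≈_) renaming (Carrier to A)
    open Setoid U using () renaming (Carrier to C; _≈_ to _≋_; reflexive to ≋-reflexive; trans to ≋-trans)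

    -- f need not respect the equality of S: only the chosen representatives of the elements of S matter.
    card-fibred : ∀ {m n} →
                  Card S n → (f : Fin m → A → C) →
                  (∀ {i j a b} → f i a ≋ f j b → a ≈ b) →
                  (∀ {i j a} → f i a ≋ f j a → i ≡ j) →
                  (∀ c → ∃[ a ] ∀ b → b ≈ a → ∃[ i ] f i b ≋ c) →
                  Card U (m * n)
    card-fibred {m} {n} α f base fibre cover = mkCard {U} g inj surj
      where
      open Bijection α using (to; injective; strictlySurjective)
      h : Fin m × Fin n → C
      h (i , k) = f i (to k)
      g : Fin (m * n) → C
      g = h ∘ remQuot n
      h-injective : ∀ {x y} → h x ≋ h y → x ≡ y
      h-injective {i , k} {j , l} e with injective {k} {l} (base e)
      ... | refl with fibre e
      ... | refl = refl
      inj : ∀ {x y} → g x ≋ g y → x ≡ y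
      inj {x} {y} e = ≡.trans (≡.sym (combine-remQuot {m} n x))
        (≡.trans (cong (λ (i , k) → combine i k) (h-injective {remQuot n x} {remQuot n y} e)) (combine-remQuot {m} n y))
      surj : ∀ c → ∃[ x ] g x ≋ c
      surj c with cover c
      ... | a , fa with strictlySurjective a
      ... | k , e with fa (to k) e
      ... | i , e′ = combine i k , ≋-trans (≋-reflexive (cong h (remQuot-combine i k))) e′

  module _ {S T U : Setoid 0ℓ 0ℓ} where
    open Setoid S using () renaming (Carrier to A; _≈_ to _≈₁_)
    open Setoid T using () renaming (Carrier to B; _≈_ to _≈₂_)
    open Setoid U using (_≈_; reflexive; sym; trans) renaming (Carrier to C)

    card-product : ∀ {m n} → Card S m → Card T n → (f : A → B → C) →
                   (∀ {a a′ b b′} → a ≈₁ a′ → b ≈₂ b′ → f a b ≈ f a′ b′) →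
                   (∀ {a a′ b b′} → f a b ≈ f a′ b′ → a ≈₁ a′ × b ≈₂ b′) →
                   (∀ c → ∃₂ λ a b → f a b ≈ c) →
                   Card U (m * n)
    card-product α β f f-cong inj surj = card-fibred β (f ∘ to) (proj₂ ∘ inj) (injective ∘ proj₁ ∘ inj) λ c →
      let a , b , e = surj c
          i , e′    = strictlySurjective a
      in b , λ b′ e″ → i , trans (f-cong e′ e″) e
      where open Bijection α

    card-sum : ∀ {m n} → Card S m → Card T n → (f : A → C) (g : B → C) →
               (∀ {a a′} → a ≈₁ a′ → f a ≈ f a′) → (∀ {b b′} → b ≈₂ b′ → g b ≈ g b′) →
               (∀ {a a′} → f a ≈ f a′ → a ≈₁ a′) → (∀ {b b′} → g b ≈ g b′ → b ≈₂ b′) →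
               (∀ {a b} → ¬ (f a ≈ g b)) →
               (∀ c → (∃[ a ] f a ≈ c) ⊎ (∃[ b ] g b ≈ c)) →
               Card U (m + n)
    card-sum {m} {n} α β f g f-cong g-cong f-inj g-inj disjoint cover = mkCard {U} (h ∘ splitAt m) inj surj
      where
      module α = Bijection α
      module β = Bijection β
      h : Fin m ⊎ Fin n → C
      h = [ f ∘ α.to , g ∘ β.to ]′
      h-injective : ∀ {x y} → h x ≈ h y → x ≡ y
      h-injective {inj₁ i} {inj₁ j} e = cong inj₁ (α.injective (f-inj e))
      h-injective {inj₁ i} {inj₂ j} e = ⊥-elim (disjoint e)
      h-injective {inj₂ i} {inj₁ j} e = ⊥-elim (disjoint (sym e))
      h-injective {inj₂ i} {inj₂ j} e = cong inj₂ (β.injective (g-inj e))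
      inj : ∀ {x y} → h (splitAt m x) ≈ h (splitAt m y) → x ≡ y
      inj {x} {y} e = ≡.trans (≡.sym (join-splitAt m n x)) (≡.trans (cong (join m n) (h-injective {splitAt m x} {splitAt m y} e)) (join-splitAt m n y))
      hits : ∀ x {c} → h x ≈ c → ∃[ y ] h (splitAt m y) ≈ c
      hits x e = join m n x , trans (reflexive (cong h (splitAt-join m n x))) e
      surj : ∀ c → ∃[ x ] h (splitAt m x) ≈ c
      surj c with cover c
      ... | inj₁ (a , e) = let i , e′ = α.strictlySurjective a in hits (inj₁ i) (trans (f-cong e′) e)
      ... | inj₂ (b , e) = let i , e′ = β.strictlySurjective b in hits (inj₂ i) (trans (g-cong e′) e)

  module _ {S U : Setoid 0ℓ 0ℓ} where
    open Setoid S using () renaming (Carrier to A; _≈_ to _≈₁_)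
    open Setoid U using (_≈_; trans) renaming (Carrier to C)

    card-map : ∀ {n} → Card S n → (f : A → C) → (∀ {a a′} → a ≈₁ a′ → f a ≈ f a′) →
               (∀ {a a′} → f a ≈ f a′ → a ≈₁ a′) → (∀ c → ∃[ a ] f a ≈ c) → Card U n
    card-map α f f-cong inj surj = mkCard {U} (f ∘ to) (injective ∘ inj) λ c →
      let a , e  = surj c
          i , e′ = strictlySurjective a
      in i , trans (f-cong e′) e
      where open Bijection α

-- Duality for finite abelian groups

module Duality where

  open import Algebra.Bundles using (AbelianGroup)
  open import Data.Nat.Base as ℕ using (ℕ; zero; suc)
  import Data.Nat.Properties as ℕₚ
  open import Data.Nat.DivMod using (_%_; _/_; m%n<n; m≡m%n+[m/n]*n)
  open import Data.Fin.Base as Fin using (Fin; toℕ; fromℕ<)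
  import Data.Fin.Properties as Finₚ
  open import Data.List.Base using ([]; _∷_; map; allFin)
  open import Data.List.Relation.Unary.Any using (here; there)
  open import Data.List.Membership.Propositional using (_∈_)
  open import Data.List.Membership.Propositional.Properties using (∈-map⁺; ∈-allFin)
  open import Data.Product.Base using (_,_; ∃; ∃-syntax; proj₁; proj₂) renaming (_×_ to _×′_)
  open import Data.Sum.Base using (inj₁; inj₂)
  open import Data.Unit.Base using (⊤)
  open import Function.Bundles using (Bijection)
  open import Relation.Nullary using (Dec; yes; contradiction)
  open import Relation.Nullary.Decidable using (map′)
  open import Relation.Unary using (Decidable)
  open import Relation.Binary.Bundles using (Setoid)
  open import Relation.Binary.PropositionalEquality as ≡ using (_≡_; refl; cong; subst)
  open import Level using (0ℓ)
  open Counting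

  module _ (A : AbelianGroup 0ℓ 0ℓ) where
    open AbelianGroup A using (Carrier; _≈_; monoid)
    open import Algebra.Properties.Monoid.Mult monoid using (_×_)

    -- What duality asks of the group of values: multiplication by a positive integer m is
    -- surjective with every fibre of size m. The circle group has this property, and so does its
    -- torsion subgroup ℚ/ℤ.
    record RootCount : Set where
      field
        division           : ∀ k → Carrier → Fin (suc k) → Carrier
        division-solves    : ∀ k c j → suc k × division k c j ≈ c
        division-injective : ∀ k c j l → division k c j ≈ division k c l → j ≡ l
        division-complete  : ∀ k c t → suc k × t ≈ c → ∃[ j ] division k c j ≈ t

  module DivisionLaws (A : AbelianGroup 0ℓ 0ℓ) where

    open AbelianGroup A public using ()
      renaming (Carrier to Value; _≈_ to infix 4 _~_; _∙_ to infixl 6 _+_; _-_ to infixl 6 _-_; ε to 0#; refl to ~-refl; sym to ~-sym; trans to ~-trans; ∙-congˡ to +-congˡ; identityˡ to +-identityˡ)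
    open AbelianGroup A using (∙-cong; ∙-congʳ; assoc; inverseʳ; identityʳ; inverseˡ; ⁻¹-cong; commutativeMonoid; commutativeSemigroup; group)
    open import Algebra.Properties.CommutativeMonoid.Mult commutativeMonoid public using (_×_; ×-homo-+; ×-assocˡ; ×-congˡ; ×-congʳ)
    open import Algebra.Properties.CommutativeSemigroup commutativeSemigroup using (interchange)
    open import Algebra.Properties.Group group public using (identityˡ-unique)
    open import Algebra.Properties.Group group using (ε⁻¹≈ε)

    -‿cong₂ : ∀ {a b c d} → a ~ b → c ~ d → a - c ~ b - d
    -‿cong₂ a~b c~d = ∙-cong a~b (⁻¹-cong c~d)

    add-subtract : ∀ a b → (a + b) - b ~ a
    add-subtract a b = ~-trans (assoc a b _) (~-trans (+-congˡ (inverseʳ b)) (identityʳ a))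

    subtract-add : ∀ a b → (a - b) + b ~ a
    subtract-add a b = ~-trans (assoc a _ b) (~-trans (+-congˡ (inverseˡ b)) (identityʳ a))

    subtract-0 : ∀ a → a - 0# ~ a
    subtract-0 a = ~-trans (+-congˡ ε⁻¹≈ε) (identityʳ a)

    difference : ∀ {a b c} → a ~ c + b → a - b ~ c
    difference {a} {b} {c} e = ~-trans (∙-congʳ e) (add-subtract c b)

    cancel-common : ∀ a u v → (a + v) - (u + v) ~ a - u
    cancel-common a u v = difference (~-trans (∙-congʳ (~-sym (subtract-add a u))) (assoc _ u v))

    split-difference : ∀ a b u v → (a + b) - (u + v) ~ (a - u) + (b - v)
    split-difference a b u v = difference (~-trans (∙-cong (~-sym (subtract-add a u)) (~-sym (subtract-add b v))) (interchange _ u _ v))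

  module CharacterGroups (A : AbelianGroup 0ℓ 0ℓ) (rootCount : RootCount A) (G : AbelianGroup 0ℓ 0ℓ) where

    open RootCount rootCount
    open DivisionLaws A
    open AbelianGroup G using (Carrier; _≈_; _∙_; _⁻¹; ε; assoc; comm; identityˡ; identityʳ; inverseʳ; ∙-cong; ∙-congˡ; ∙-congʳ; setoid; commutativeMonoid; commutativeSemigroup)
      renaming (refl to ≈-refl; sym to ≈-sym; trans to ≈-trans; reflexive to ≈-reflexive)
    open import Algebra.Properties.CommutativeMonoid.Mult commutativeMonoid using () renaming (_×_ to _×ₘ_; ×-homo-+ to ×ₘ-homo-+; ×-assocˡ to ×ₘ-assocˡ; ×-congˡ to ×ₘ-congˡ)
    open import Algebra.Properties.CommutativeSemigroup commutativeSemigroup using (interchange; x∙yz≈y∙xz)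
    open import Algebra.Properties.Group (AbelianGroup.group G) using (∙-cancelʳ)

    infixr 8 _^_
    _^_ : Carrier → ℕ → Carrier
    x ^ i = i ×ₘ x

    -- Closure under division, `/∈`, stands in for closure under inverses: below, a product and one
    -- of its factors are known to be members and the other factor is wanted. Decidable membership
    -- makes the order of an element modulo the subgroup computable.
    record Subgroup : Set₁ where
      field
        Member : Carrier → Set
        member? : Decidable Member
        resp    : ∀ {g h} → g ≈ h → Member g → Member h
        ε∈      : Member ε
        ∙∈      : ∀ {g h} → Member g → Member h → Member (g ∙ h)
        /∈      : ∀ {g h} → Member g → Member (g ∙ h) → Member h

      ^∈ : ∀ {g} i → Member g → Member (g ^ i)
      ^∈ zero    g∈ = ε∈
      ^∈ (suc i) g∈ = ∙∈ g∈ (^∈ i g∈)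

      elements : Setoid 0ℓ 0ℓ
      elements = record
        { Carrier       = ∃ Member
        ; _≈_           = λ g h → proj₁ g ≈ proj₁ h
        ; isEquivalence = record { refl = ≈-refl ; sym = ≈-sym ; trans = ≈-trans }
        }

    open Subgroup

    record Character (H : Subgroup) : Set where
      field
        fun    : ∀ g → Member H g → Value
        fun-≈  : ∀ {g h} → g ≈ h → ∀ p q → fun g p ~ fun h q
        fun-∙  : ∀ g h p q r → fun (g ∙ h) r ~ fun g p + fun h q

      fun-^ : ∀ g i p r → fun (g ^ i) r ~ i × fun g p
      -- As ε ∙ ε ≈ ε, the value at ε equals its own double, so it is zero.
      fun-^ g zero    p r = identityˡ-unique (fun ε r) (fun ε r) (~-trans (~-sym (fun-∙ ε ε r r (∙∈ H r r))) (fun-≈ (identityˡ ε) (∙∈ H r r) r))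
      fun-^ g (suc i) p r = ~-trans (fun-∙ g (g ^ i) p (^∈ H i p) r) (+-congˡ (fun-^ g i p (^∈ H i p)))

    open Character

    characters : Subgroup → Setoid 0ℓ 0ℓ
    characters H = record
      { Carrier       = Character H
      ; _≈_           = λ χ ψ → ∀ g p → fun χ g p ~ fun ψ g p
      ; isEquivalence = record { refl = λ _ _ → ~-refl ; sym = λ e g p → ~-sym (e g p) ; trans = λ d e g p → ~-trans (d g p) (e g p) }
      }

    SelfDual : Subgroup → Set
    SelfDual H = ∃[ n ] Card (elements H) n ×′ Card (characters H) n

    -- With m = k + 1 the order of x modulo H, passing from H to ⟨H, x⟩ multiplies both the number of elements and
    -- the number of characters by m: a character χ of H extends by any t with m t = χ (x ^ m).
    module Adjoin (H : Subgroup) (x : Carrier) (k : ℕ) (xᵏ⁺¹∈ : Member H (x ^ suc k))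
                  (minimal : ∀ i → Member H (x ^ suc i) → k ℕ.≤ i) where

      m : ℕ
      m = suc k

      ^-suc-* : ∀ i q → x ^ (i ℕ.+ q ℕ.* m) ≈ (x ^ m) ^ q ∙ x ^ i
      ^-suc-* i q = ≈-trans (×ₘ-homo-+ x i (q ℕ.* m)) (≈-trans (comm _ _) (∙-congʳ (≈-sym (×ₘ-assocˡ x q m))))

      reduce : ∀ i → Member H (x ^ i) → Member H (x ^ (i % m))
      reduce i xⁱ∈ = /∈ H (^∈ H (i / m) xᵏ⁺¹∈) (resp H (≈-trans (×ₘ-congˡ (m≡m%n+[m/n]*n i m)) (^-suc-* (i % m) (i / m))) xⁱ∈)

      -- A nonzero remainder of `i` modulo `m` would be a positive exponent below `m` that brings
      -- `x` into `H`, against minimality.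
      multiple : ∀ i → Member H (x ^ i) → i ≡ i / m ℕ.* m
      multiple i xⁱ∈ = ≡.trans (m≡m%n+[m/n]*n i m) (cong (ℕ._+ i / m ℕ.* m) (vanish (i % m) (m%n<n i m) (reduce i xⁱ∈)))
        where
        vanish : ∀ r → r ℕ.< m → Member H (x ^ r) → r ≡ 0
        vanish zero    _   _   = refl
        vanish (suc r) r<k xʳ∈ = contradiction (minimal r xʳ∈) (ℕₚ.<⇒≱ (ℕₚ.≤-pred r<k))

      -- i records the coset x⁻ⁱ H; using positive exponents here avoids subtractions below.
      Member′ : Carrier → Set
      Member′ g = ∃[ i ] Member H (g ∙ x ^ i)

      shift-≈ : ∀ g i l → g ∙ x ^ (i ℕ.+ l) ≈ (g ∙ x ^ i) ∙ x ^ l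
      shift-≈ g i l = ≈-trans (∙-congˡ (×ₘ-homo-+ x i l)) (≈-sym (assoc g _ _))

      -- As `x ^ m` lies in `H`, the exponent matters only modulo `m`. This turns membership in ⟨H,
      -- x⟩ into a finite search.
      bounded : ∀ {g} → Member′ g → ∃[ i ] Member H (g ∙ x ^ toℕ {m} i)
      bounded {g} (i , gxⁱ∈) = fromℕ< (m%n<n i m) , resp H (∙-congˡ (×ₘ-congˡ (≡.sym (Finₚ.toℕ-fromℕ< (m%n<n i m)))))
        (/∈ H (^∈ H (i / m) xᵏ⁺¹∈) (resp H eq gxⁱ∈))
        where
        eq : g ∙ x ^ i ≈ (x ^ m) ^ (i / m) ∙ (g ∙ x ^ (i % m))
        eq = ≈-trans (∙-congˡ (≈-trans (×ₘ-congˡ (m≡m%n+[m/n]*n i m)) (^-suc-* (i % m) (i / m)))) (x∙yz≈y∙xz g _ _)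

      combine-≈ : ∀ g h i j → (g ∙ h) ∙ x ^ (i ℕ.+ j) ≈ (g ∙ x ^ i) ∙ (h ∙ x ^ j)
      combine-≈ g h i j = ≈-trans (∙-congˡ (×ₘ-homo-+ x i j)) (interchange g h _ _)

      ∙∈′ : ∀ {g h} → Member′ g → Member′ h → Member′ (g ∙ h)
      ∙∈′ {g} {h} (i , p) (j , q) = i ℕ.+ j , resp H (≈-sym (combine-≈ g h i j)) (∙∈ H p q)

      adjoin : Subgroup
      adjoin = record
        { Member  = Member′
        ; member? = λ g → map′ (λ (i , p) → toℕ i , p) bounded (Finₚ.any? (λ (i : Fin m) → member? H (g ∙ x ^ toℕ i)))
        ; resp    = λ e (i , p) → i , resp H (∙-congʳ e) p
        ; ε∈      = 0 , resp H (≈-sym (identityʳ ε)) (ε∈ H)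
        ; ∙∈      = ∙∈′
        -- Modulo `m = k + 1` the exponent - j is j k, which keeps the exponent of the quotient
        -- nonnegative.
        ; /∈      = λ {g} {h} (j , p) (i , r) → i ℕ.+ j ℕ.* k , /∈ H p (resp H (eq g h i j) (∙∈ H r (^∈ H j xᵏ⁺¹∈)))
        }
        where
        exponent : ∀ i j → i ℕ.+ j ℕ.* m ≡ j ℕ.+ (i ℕ.+ j ℕ.* k)
        exponent i j = ≡.trans (cong (i ℕ.+_) (ℕₚ.*-suc j k)) (≡.trans (≡.sym (ℕₚ.+-assoc i j _)) (≡.trans (cong (ℕ._+ j ℕ.* k) (ℕₚ.+-comm i j)) (ℕₚ.+-assoc j i _)))
        eq : ∀ g h i j → (g ∙ h) ∙ x ^ i ∙ (x ^ m) ^ j ≈ (g ∙ x ^ j) ∙ (h ∙ x ^ (i ℕ.+ j ℕ.* k))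
        eq g h i j = ≈-trans (∙-congˡ (×ₘ-assocˡ x j m)) (≈-trans (≈-sym (shift-≈ (g ∙ h) i (j ℕ.* m)))
          (≈-trans (∙-congˡ (×ₘ-congˡ (exponent i j))) (combine-≈ g h j _)))

      ⊆adjoin : ∀ g → Member H g → Member′ g
      ⊆adjoin g p = 0 , resp H (≈-sym (identityʳ _)) p

      -- The exponent is `k` because `x ∙ x ^ k` is `x ^ suc k` by definition.
      x∈adjoin : Member′ x
      x∈adjoin = k , xᵏ⁺¹∈

      -- If the exponents differed, their difference would be a positive exponent below `m` that
      -- brings `x` into `H`.
      exponents-agree : ∀ {g i j} → i ℕ.≤ j → j ℕ.< m → Member H (g ∙ x ^ i) → Member H (g ∙ x ^ j) → i ≡ j
      exponents-agree {g} {i} {j} i≤j j<m p q with j ℕ.∸ i in e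
      ... | zero  = ℕₚ.≤-antisym i≤j (ℕₚ.m∸n≡0⇒m≤n e)
      ... | suc l = contradiction (minimal l (/∈ H p (resp H (≈-trans (∙-congˡ (×ₘ-congˡ (≡.trans (≡.sym (ℕₚ.m+[n∸m]≡n i≤j)) (cong (i ℕ.+_) e)))) (shift-≈ g i (suc l))) q)))
                      (ℕₚ.<⇒≱ (ℕₚ.≤-pred (ℕₚ.≤-<-trans (subst (ℕ._≤ j) e (ℕₚ.m∸n≤m j i)) j<m)))

      exponent-unique : ∀ {g} (i j : Fin m) → Member H (g ∙ x ^ toℕ i) → Member H (g ∙ x ^ toℕ j) → i ≡ j
      exponent-unique i j p q with ℕₚ.≤-total (toℕ i) (toℕ j)
      ... | inj₁ i≤j = Finₚ.toℕ-injective (exponents-agree i≤j (Finₚ.toℕ<n j) p q)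
      ... | inj₂ j≤i = ≡.sym (Finₚ.toℕ-injective (exponents-agree j≤i (Finₚ.toℕ<n i) q p))

      cancel-^ : ∀ h i → h ∙ (x ^ i) ⁻¹ ∙ x ^ i ≈ h
      cancel-^ h i = ≈-trans (assoc h _ _) (≈-trans (∙-congˡ (≈-trans (comm _ _) (inverseʳ _))) (identityʳ h))

      -- The cosets x⁻ⁱ H with i < m are disjoint by `exponent-unique` and exhaust ⟨H, x⟩ by
      -- `bounded`.
      card-elements : ∀ {n} → Card (elements H) n → Card (elements adjoin) (m ℕ.* n)
      card-elements α = card-fibred {elements H} {elements adjoin} α coset (λ {i} {j} {a} {b} → base i j a b) (λ {i} {j} {a} e → index i j a a e) cover
        where
        coset : Fin m → ∃ (Member H) → ∃ Member′
        coset i (h , h∈) = h ∙ (x ^ toℕ i) ⁻¹ , toℕ i , resp H (≈-sym (cancel-^ h (toℕ i))) h∈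
        index : ∀ i j (a b : ∃ (Member H)) → proj₁ (coset i a) ≈ proj₁ (coset j b) → i ≡ j
        index i j a b e = exponent-unique i j (proj₂ (proj₂ (coset i a))) (resp H (∙-congʳ (≈-sym e)) (proj₂ (proj₂ (coset j b))))
        base : ∀ i j (a b : ∃ (Member H)) → proj₁ (coset i a) ≈ proj₁ (coset j b) → proj₁ a ≈ proj₁ b
        base i j a b e with index i j a b e
        ... | refl = ∙-cancelʳ ((x ^ toℕ i) ⁻¹) (proj₁ a) (proj₁ b) e
        cover : ∀ (g : ∃ Member′) → ∃[ a ] ∀ b → proj₁ b ≈ proj₁ a → ∃[ i ] proj₁ (coset i b) ≈ proj₁ g
        cover (g , g∈) with bounded g∈
        ... | i , p = (g ∙ x ^ toℕ i , p) , λ b e → i , ≈-trans (∙-congʳ e) (≈-trans (assoc g _ _) (≈-trans (∙-congˡ (inverseʳ _)) (identityʳ g)))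

      module Extension (χ : Character H) (t : Value) (mt≡ : m × t ~ fun χ (x ^ m) xᵏ⁺¹∈) where

        -- Only multiples of `m` occur as `l`, and there the value is dictated by m t = χ (x ^ m).
        power : ∀ l p → fun χ (x ^ l) p ~ l × t
        power l p = ~-trans (fun-≈ χ (≈-trans (×ₘ-congˡ (multiple l p)) (≈-sym (×ₘ-assocˡ x (l / m) m))) p (^∈ H (l / m) xᵏ⁺¹∈))
          (~-trans (fun-^ χ (x ^ m) (l / m) xᵏ⁺¹∈ (^∈ H (l / m) xᵏ⁺¹∈)) (~-trans (×-congʳ (l / m) (~-sym mt≡))
          (~-trans (×-assocˡ t (l / m) m) (×-congˡ (≡.sym (multiple l p))))))

        -- The formula is forced: g is (g xⁱ) x⁻ⁱ, the first factor lies in `H`, and x is to have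
        -- the value `t`.
        extend : ∀ g → Member′ g → Value
        extend g (i , p) = fun χ (g ∙ x ^ i) p - i × t

        -- Independence of the exponent. The extra factor `x ^ l` lies in `H`, where `power` gives
        -- it the value l t, and the subtraction cancels it. The exponents `i` and `i + l` are any
        -- two exponents up to order.
        later : ∀ {g h} → g ≈ h → ∀ i l p q → fun χ (g ∙ x ^ i) p - i × t ~ fun χ (h ∙ x ^ (i ℕ.+ l)) q - (i ℕ.+ l) × t
        later {g} {h} g≈h i l p q = ~-sym (~-trans
          (-‿cong₂ (~-trans (fun-≈ χ eq q (resp H eq q)) (~-trans (fun-∙ χ (g ∙ x ^ i) (x ^ l) p l∈ (resp H eq q)) (+-congˡ (power l l∈)))) (×-homo-+ t i l))
          (cancel-common (fun χ (g ∙ x ^ i) p) (i × t) (l × t)))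
          where
          eq : h ∙ x ^ (i ℕ.+ l) ≈ (g ∙ x ^ i) ∙ x ^ l
          eq = ≈-trans (∙-congʳ (≈-sym g≈h)) (shift-≈ g i l)
          l∈ : Member H (x ^ l)
          l∈ = /∈ H p (resp H eq q)

        extend-≈ : ∀ {g h} → g ≈ h → ∀ p q → extend g p ~ extend h q
        extend-≈ g≈h (i , p) (j , q) with ℕₚ.≤-total i j
        ... | inj₁ i≤j with ℕₚ.m≤n⇒∃[o]m+o≡n i≤j
        ... | l , refl = later g≈h i l p q
        extend-≈ g≈h (i , p) (j , q) | inj₂ j≤i with ℕₚ.m≤n⇒∃[o]m+o≡n j≤i
        ... | l , refl = ~-sym (later (≈-sym g≈h) j l q p)

        extend-∙ : ∀ g h p q r → extend (g ∙ h) r ~ extend g p + extend h q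
        extend-∙ g h (i , p) (j , q) r = ~-trans (extend-≈ (≈-refl {g ∙ h}) r (∙∈′ {g} {h} (i , p) (j , q)))
          (~-trans (-‿cong₂ (~-trans (fun-≈ χ (combine-≈ g h i j) _ (∙∈ H p q)) (fun-∙ χ (g ∙ x ^ i) (h ∙ x ^ j) p q (∙∈ H p q))) (×-homo-+ t i j))
          (split-difference (fun χ (g ∙ x ^ i) p) (fun χ (h ∙ x ^ j) q) (i × t) (j × t)))

        extension : Character adjoin
        extension = record { fun = extend ; fun-≈ = extend-≈ ; fun-∙ = extend-∙ }

        extension-restricts : ∀ g (p : Member H g) q → fun extension g q ~ fun χ g p
        extension-restricts g p q = ~-trans (extend-≈ (≈-refl {g}) q (⊆adjoin g p)) (~-trans (-‿cong₂ (fun-≈ χ (identityʳ g) _ p) ~-refl) (subtract-0 (fun χ g p)))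

        extension-at-x : ∀ q → fun extension x q ~ t
        extension-at-x q = ~-trans (extend-≈ (≈-refl {x}) q x∈adjoin) (~-trans (-‿cong₂ (~-sym mt≡) ~-refl) (add-subtract t (k × t)))

      restrict : Character adjoin → Character H
      restrict χ = record
        { fun   = λ g p → fun χ g (⊆adjoin g p)
        ; fun-≈ = λ e p q → fun-≈ χ e _ _
        ; fun-∙ = λ g h p q r → fun-∙ χ g h _ _ _
        }

      -- The value at `g` can be recovered as χ (g xⁱ) - i χ (x), with g xⁱ in `H`.
      determined : ∀ (χ ψ : Character adjoin) → (∀ g p → fun χ g (⊆adjoin g p) ~ fun ψ g (⊆adjoin g p)) → fun χ x x∈adjoin ~ fun ψ x x∈adjoin → ∀ g p → fun χ g p ~ fun ψ g p
      determined χ ψ onH atx g (i , p) = ~-trans (~-sym (recover χ)) (~-trans (-‿cong₂ (onH (g ∙ x ^ i) p) (×-congʳ i atx)) (recover ψ))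
        where
        recover : ∀ (χ : Character adjoin) → fun χ (g ∙ x ^ i) (⊆adjoin (g ∙ x ^ i) p) - i × fun χ x x∈adjoin ~ fun χ g (i , p)
        recover χ = ~-trans (-‿cong₂ (~-trans (fun-∙ χ g (x ^ i) (i , p) (^∈ adjoin {x} i x∈adjoin) (⊆adjoin (g ∙ x ^ i) p)) (+-congˡ (fun-^ χ x i x∈adjoin (^∈ adjoin {x} i x∈adjoin)))) ~-refl)
          (add-subtract (fun χ g (i , p)) (i × fun χ x x∈adjoin))

      card-characters : ∀ {n} → Card (characters H) n → Card (characters adjoin) (m ℕ.* n)
      card-characters α = card-fibred {characters H} {characters adjoin} α extendBy (λ {i} {j} {χ} {ψ} → base i j χ ψ) (λ {i} {j} {χ} → fibre i j χ) cover
        where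
        module Ext (j : Fin m) (χ : Character H) = Extension χ (division k (fun χ (x ^ m) xᵏ⁺¹∈) j) (division-solves k (fun χ (x ^ m) xᵏ⁺¹∈) j)
        extendBy : Fin m → Character H → Character adjoin
        extendBy = Ext.extension
        base : ∀ i j χ ψ → (∀ g p → fun (extendBy i χ) g p ~ fun (extendBy j ψ) g p) → ∀ g p → fun χ g p ~ fun ψ g p
        base i j χ ψ e g p = ~-trans (~-sym (Ext.extension-restricts i χ g p (⊆adjoin g p))) (~-trans (e g (⊆adjoin g p)) (Ext.extension-restricts j ψ g p (⊆adjoin g p)))
        fibre : ∀ i j χ → (∀ g p → fun (extendBy i χ) g p ~ fun (extendBy j χ) g p) → i ≡ j
        fibre i j χ e = division-injective k (fun χ (x ^ m) xᵏ⁺¹∈) i j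
          (~-trans (~-sym (Ext.extension-at-x i χ x∈adjoin)) (~-trans (e x x∈adjoin) (Ext.extension-at-x j χ x∈adjoin)))
        cover : ∀ (ψ : Character adjoin) → ∃[ χ ] ∀ χ′ → (∀ g p → fun χ′ g p ~ fun χ g p) → ∃[ j ] ∀ g p → fun (extendBy j χ′) g p ~ fun ψ g p
        -- The root is sought for χ′ itself and not for `restrict ψ`: `division` may list the roots
        -- of two equal values in different orders.
        cover ψ = restrict ψ , λ χ′ e →
          let j , t~ = division-complete k (fun χ′ (x ^ m) xᵏ⁺¹∈) (fun ψ x x∈adjoin)
                         (~-trans (~-sym (fun-^ ψ x m x∈adjoin (⊆adjoin (x ^ m) xᵏ⁺¹∈))) (~-sym (e (x ^ m) xᵏ⁺¹∈)))
          in j , determined (extendBy j χ′) ψ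
                   (λ g p → ~-trans (Ext.extension-restricts j χ′ g p (⊆adjoin g p)) (e g p))
                   (~-trans (Ext.extension-at-x j χ′ x∈adjoin) t~)

      selfDual : SelfDual H → SelfDual adjoin
      selfDual (n , α , β) = m ℕ.* n , card-elements α , card-characters β

    whole : Subgroup
    whole = record { Member = λ _ → ⊤ ; member? = λ _ → yes _ ; resp = λ _ _ → _ ; ε∈ = _ ; ∙∈ = λ _ _ → _ ; /∈ = λ _ _ → _ }

    module _ {n} (α : Card setoid n) where
      open Bijection α using (to; injective; strictlySurjective)

      infix 4 _≟_
      _≟_ : ∀ g h → Dec (g ≈ h)
      g ≟ h = map′ (λ e → ≈-trans (≈-sym (proj₂ (strictlySurjective g))) (≈-trans (≈-reflexive (cong to e)) (proj₂ (strictlySurjective h))))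
                   (λ e → injective (≈-trans (proj₂ (strictlySurjective g)) (≈-trans e (≈-sym (proj₂ (strictlySurjective h))))))
                   (proj₁ (strictlySurjective g) Finₚ.≟ proj₁ (strictlySurjective h))

      trivial : Subgroup
      trivial = record
        { Member  = _≈ ε
        ; member? = _≟ ε
        ; resp    = λ e p → ≈-trans (≈-sym e) p
        ; ε∈      = ≈-refl
        ; ∙∈      = λ p q → ≈-trans (∙-cong p q) (identityˡ ε)
        ; /∈      = λ {g} {h} p q → ≈-trans (≈-sym (≈-trans (∙-congʳ p) (identityˡ h))) q
        }

      trivial-selfDual : SelfDual trivial
      trivial-selfDual = 1 ,
        mkCard {elements trivial} (λ _ → ε , ≈-refl) single (λ (g , g≈ε) → Fin.zero , ≈-sym g≈ε) ,
        mkCard {characters trivial} (λ _ → record { fun = λ _ _ → 0# ; fun-≈ = λ _ _ _ → ~-refl ; fun-∙ = λ _ _ _ _ _ → ~-sym (+-identityˡ 0#) }) single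
          (λ χ → Fin.zero , λ g g≈ε → ~-sym (~-trans (fun-≈ χ g≈ε g≈ε ≈-refl) (fun-^ χ ε 0 ≈-refl ≈-refl)))
        where
        single : ∀ {A : Set} {i j : Fin 1} → A → i ≡ j
        single {i = Fin.zero} {Fin.zero} _ = refl

      -- Two of the n + 1 powers x⁰, ..., xⁿ coincide, and the common part cancels.
      torsion : ∀ x → ∃[ k ] x ^ suc k ≈ ε
      torsion x with Finₚ.pigeonhole (ℕₚ.n<1+n n) (λ i → proj₁ (strictlySurjective (x ^ toℕ i)))
      ... | i , j , i<j , e = order (ℕₚ.m≤n⇒∃[o]m+o≡n i<j)
        where
        same : x ^ toℕ i ≈ x ^ toℕ j
        same = ≈-trans (≈-sym (proj₂ (strictlySurjective (x ^ toℕ i)))) (≈-trans (≈-reflexive (cong to e)) (proj₂ (strictlySurjective (x ^ toℕ j))))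
        order : ∃[ l ] suc (toℕ i) ℕ.+ l ≡ toℕ j → ∃[ k ] x ^ suc k ≈ ε
        order (l , e) = l , ∙-cancelʳ (x ^ toℕ i) (x ^ suc l) ε (≈-trans (≈-sym (×ₘ-homo-+ x (suc l) (toℕ i)))
          (≈-trans (×ₘ-congˡ (≡.trans (cong suc (ℕₚ.+-comm l (toℕ i))) e)) (≈-trans (≈-sym same) (≈-sym (identityˡ _)))))

      _⊆_ : Subgroup → Subgroup → Set
      H ⊆ K = ∀ {g} → Member H g → Member K g

      -- The order of `x` modulo `H` exists because `x` is torsion, and `least` finds it because
      -- membership in `H` is decidable.
      enlarge : ∀ H → SelfDual H → ∀ x → ∃[ K ] SelfDual K ×′ H ⊆ K ×′ Member K x
      enlarge H d x = byOrder (torsion x)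
        where
        adjoinLeast : (∃[ k ] Member H (x ^ suc k) ×′ (∀ i → Member H (x ^ suc i) → k ℕ.≤ i)) → ∃[ K ] SelfDual K ×′ H ⊆ K ×′ Member K x
        adjoinLeast (k , xᵏ⁺¹∈ , minimal) = adjoin , selfDual d , (λ {g} → ⊆adjoin g) , x∈adjoin
          where open Adjoin H x k xᵏ⁺¹∈ minimal
        byOrder : (∃[ l ] x ^ suc l ≈ ε) → ∃[ K ] SelfDual K ×′ H ⊆ K ×′ Member K x
        byOrder (l , xˡ⁺¹≈ε) = adjoinLeast (Primes.least (λ i → member? H (x ^ suc i)) l (resp H (≈-sym xˡ⁺¹≈ε) (ε∈ H)))

      generate : ∀ xs → ∃[ K ] SelfDual K ×′ (∀ {x} → x ∈ xs → Member K x)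
      generate []       = trivial , trivial-selfDual , λ ()
      generate (x ∷ xs) = extend (generate xs)
        where
        extend : (∃[ K ] SelfDual K ×′ (∀ {x} → x ∈ xs → Member K x)) → ∃[ K ] SelfDual K ×′ (∀ {y} → y ∈ x ∷ xs → Member K y)
        extend (H , d , xs⊆H) = let K , d′ , H⊆K , x∈K = enlarge H d x in K , d′ , λ { (here refl) → x∈K ; (there p) → H⊆K (xs⊆H p) }

      -- Adjoining every element of the group leads from the trivial subgroup to the whole group,
      -- and self-duality is preserved on the way. The common count so obtained must be `n`, by
      -- uniqueness of cardinalities.
      card-dual : Card (characters whole) n
      card-dual with generate (map to (allFin n))
      ... | K , (N , γ , β) , all∈ = subst (Card (characters whole)) (card-unique {setoid} whole-elements α) whole-characters
        where
        full : ∀ g → Member K g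
        full g = resp K (proj₂ (strictlySurjective g)) (all∈ (∈-map⁺ to (∈-allFin (proj₁ (strictlySurjective g)))))
        whole-elements : Card setoid N
        whole-elements = card-map {elements K} {setoid} γ proj₁ (λ e → e) (λ e → e) (λ g → (g , full g) , ≈-refl)
        whole-characters : Card (characters whole) N
        whole-characters = card-map {characters K} {characters whole} β
          (λ χ → record { fun = λ g _ → fun χ g (full g) ; fun-≈ = λ e _ _ → fun-≈ χ e _ _ ; fun-∙ = λ g h _ _ _ → fun-∙ χ g h _ _ _ })
          (λ e g _ → e g (full g))
          (λ {χ} {ψ} e g p → ~-trans (fun-≈ χ ≈-refl p (full g)) (~-trans (e g _) (fun-≈ ψ ≈-refl (full g) p)))
          (λ χ → record { fun = λ g _ → fun χ g _ ; fun-≈ = λ e _ _ → fun-≈ χ e _ _ ; fun-∙ = λ g h _ _ _ → fun-∙ χ g h _ _ _ } , λ _ _ → ~-refl)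

-- Roots in ℚ/ℤ

module RationalsModℤ where

  open import Algebra.Bundles using (AbelianGroup)
  open import Data.Nat.Base as ℕ using (ℕ; zero; suc)
  import Data.Nat.Properties as ℕₚ
  open import Data.Integer.Base as ℤ using (ℤ)
  import Data.Integer.Properties as ℤₚ
  open import Data.Integer.DivMod using (_%ℕ_; n%ℕd<d)
  import Data.Integer.Solver as ℤSolver
  open import Data.Rational.Base using (ℚ; 0ℚ; 1ℚ; _+_; _*_; -_; _-_; 1/_)
  open import Data.Rational.Properties using (*-identityʳ; +-identityʳ; +-identityˡ; +-inverseʳ; +-inverseˡ; +-assoc; +-comm; *-zeroˡ)
  open import Data.Rational.Literals using (fromℤ)
  open import Data.Rational.Solver using (module +-*-Solver)
  open import Data.Fin.Base as Fin using (Fin; toℕ; fromℕ<)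
  import Data.Fin.Properties as Finₚ
  open import Data.Maybe.Relation.Binary.Pointwise using (drop-just)
  open import Data.Product.Base using (∃-syntax; _,_)
  open import Relation.Nullary using (contradiction)
  open import Relation.Binary.PropositionalEquality as ≡ using (_≡_; refl; cong; cong₂; subst)
  open import Level using (0ℓ)
  open Defs.Reals using (fromℕ; fromℕ-suc; fromℤ-+; fromℤ-*; fromℕ-inverse)
  open Defs.Characters using (_~_; _,_; ~-refl; ~-sym; ~-trans; ~-+; fromℤ-neg; torsion⇒root)
  open Duality using (RootCount)

  ~-reflexive : ∀ {s t} → s ≡ t → s ~ t
  ~-reflexive refl = ~-refl

  ~-neg : ∀ {s t} → s ~ t → - s ~ - t
  ~-neg {s} {t} (z , e) = ℤ.- z , ≡.trans (solve 2 (λ s t → (:- s) :- (:- t) := :- (s :- t)) refl s t)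
    (≡.trans (cong -_ e) (≡.sym (fromℤ-neg z)))
    where open +-*-Solver

  -- Replacing the representative c by c + 1 permutes these roots cyclically, so the index of a root
  -- depends on the rational number c and not only on its class modulo ℤ.
  division : ∀ k → ℚ → Fin (suc k) → ℚ
  division k c j = (c + fromℕ (toℕ j)) * 1/ fromℕ (suc k)

  private
    suc*1/suc : ∀ k x → fromℕ (suc k) * (x * 1/ fromℕ (suc k)) ≡ x
    suc*1/suc k x = ≡.trans (rearrange (fromℕ (suc k)) x (1/ fromℕ (suc k))) (≡.trans (cong (x *_) (fromℕ-inverse k)) (*-identityʳ x))
      where
      rearrange : ∀ m x i → m * (x * i) ≡ x * (m * i)
      rearrange = solve 3 (λ m x i → m :* (x :* i) := x :* (m :* i)) refl
        where open +-*-Solver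

  division-solves : ∀ k c j → fromℕ (suc k) * division k c j ~ c
  division-solves k c j = ~-trans (~-reflexive (suc*1/suc k (c + fromℕ (toℕ j))))
    (ℤ.+ toℕ j , solve 2 (λ c j → (c :+ j) :- c := j) refl c (fromℕ (toℕ j)))
    where open +-*-Solver

  -- The difference t - c/(k+1) becomes an integer z on multiplication by k + 1, so it is r/(k+1)
  -- modulo ℤ, where r is the remainder of z. This remainder is the index.
  division-complete : ∀ k c t → fromℕ (suc k) * t ~ c → ∃[ j ] division k c j ~ t
  division-complete k c t (z , e) = fromℕ< r<k , shift (drop-just (torsion⇒root k (t - c * i) z mul))
    where
    open +-*-Solver
    i = 1/ fromℕ (suc k)
    r<k = n%ℕd<d z (suc k)
    mul : fromℕ (suc k) * (t - c * i) ≡ fromℤ z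
    mul = ≡.trans (distrib (fromℕ (suc k)) t (c * i)) (≡.trans (cong (λ x → fromℕ (suc k) * t - x) (suc*1/suc k c)) e)
      where
      distrib : ∀ m t x → m * (t - x) ≡ m * t - m * x
      distrib = solve 3 (λ m t x → m :* (t :- x) := m :* t :- m :* x) refl
    shift : fromℕ (z %ℕ suc k) * i ~ t - c * i → division k c (fromℕ< r<k) ~ t
    shift (y , f) = y , ≡.trans (≡.trans (cong (λ r → (c + fromℕ r) * i - t) (Finₚ.toℕ-fromℕ< r<k)) (regroup c (fromℕ (z %ℕ suc k)) i t)) f
      where
      regroup : ∀ c r i t → (c + r) * i - t ≡ r * i - (t - c * i)
      regroup = solve 4 (λ c r i t → (c :+ r) :* i :- t := r :* i :- (t :- c :* i)) refl

  fromℤ-injective : ∀ {y z} → fromℤ y ≡ fromℤ z → y ≡ z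
  fromℤ-injective refl = refl

  -- Equality of two roots modulo ℤ makes j - l a multiple of k + 1, while both indices lie below k
  -- + 1.
  division-injective : ∀ k c j l → division k c j ~ division k c l → j ≡ l
  division-injective k c j l (z , e) = Finₚ.toℕ-injective (small z integral (Finₚ.toℕ<n j) (Finₚ.toℕ<n l))
    where
    i = 1/ fromℕ (suc k)
    M = fromℕ (suc k)
    split : ∀ M c j l i → M * ((c + j) * i) - M * ((c + l) * i) ≡ M * ((c + j) * i - (c + l) * i)
    split = solve 5 (λ M c j l i → M :* ((c :+ j) :* i) :- M :* ((c :+ l) :* i) := M :* ((c :+ j) :* i :- (c :+ l) :* i)) refl
      where open +-*-Solver
    expand : ∀ c j l → j ≡ l + ((c + j) - (c + l))
    expand = solve 3 (λ c j l → j := l :+ ((c :+ j) :- (c :+ l))) refl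
      where open +-*-Solver
    scaled : (c + fromℕ (toℕ j)) - (c + fromℕ (toℕ l)) ≡ M * fromℤ z
    scaled = ≡.trans (≡.sym (cong₂ _-_ (suc*1/suc k (c + fromℕ (toℕ j))) (suc*1/suc k (c + fromℕ (toℕ l)))))
      (≡.trans (split M c (fromℕ (toℕ j)) (fromℕ (toℕ l)) i) (cong (M *_) e))
    rational : fromℕ (toℕ j) ≡ fromℤ (ℤ.+ toℕ l ℤ.+ ℤ.+ suc k ℤ.* z)
    rational = ≡.trans (expand c (fromℕ (toℕ j)) (fromℕ (toℕ l)))
      (≡.trans (cong (fromℕ (toℕ l) +_) (≡.trans scaled (≡.sym (fromℤ-* (ℤ.+ suc k) z)))) (≡.sym (fromℤ-+ (ℤ.+ toℕ l) (ℤ.+ suc k ℤ.* z))))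
    integral : ℤ.+ toℕ j ≡ ℤ.+ toℕ l ℤ.+ ℤ.+ suc k ℤ.* z
    integral = fromℤ-injective rational
    small : ∀ z {j l} → ℤ.+ j ≡ ℤ.+ l ℤ.+ ℤ.+ suc k ℤ.* z → j ℕ.< suc k → l ℕ.< suc k → j ≡ l
    small (ℤ.+ zero) {j} {l} e j< l< = ℤₚ.+-injective (≡.trans e (≡.trans (cong (ℤ._+_ (ℤ.+ l)) (ℤₚ.*-zeroʳ (ℤ.+ suc k))) (ℤₚ.+-identityʳ (ℤ.+ l))))
    small (ℤ.+ suc y) {j} {l} e j< l< = contradiction j< (ℕₚ.≤⇒≯ (subst (suc k ℕ.≤_) (≡.sym j≡)
        (ℕₚ.≤-trans (ℕₚ.m≤m*n (suc k) (suc y)) (ℕₚ.m≤n+m (suc k ℕ.* suc y) l))))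
      where
      j≡ : j ≡ l ℕ.+ suc k ℕ.* suc y
      j≡ = ℤₚ.+-injective (≡.trans e (≡.trans (cong (ℤ._+_ (ℤ.+ l)) (≡.sym (ℤₚ.pos-* (suc k) (suc y)))) (≡.sym (ℤₚ.pos-+ l (suc k ℕ.* suc y)))))
    small ℤ.-[1+ y ] {j} {l} e j< l< = contradiction l< (ℕₚ.≤⇒≯ (subst (suc k ℕ.≤_) (≡.sym l≡)
        (ℕₚ.≤-trans (ℕₚ.m≤m*n (suc k) (suc y)) (ℕₚ.m≤n+m (suc k ℕ.* suc y) j))))
      where
      l≡ : l ≡ j ℕ.+ suc k ℕ.* suc y
      l≡ = ℤₚ.+-injective (≡.sym (≡.trans (ℤₚ.pos-+ j (suc k ℕ.* suc y)) (≡.trans (cong₂ ℤ._+_ e (ℤₚ.pos-* (suc k) (suc y)))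
        (solve 3 (λ l m y → (l :+ m :* (:- y)) :+ m :* y := l) refl (ℤ.+ l) (ℤ.+ suc k) (ℤ.+ suc y)))))
        where open ℤSolver.+-*-Solver

  ℚ/ℤ : AbelianGroup 0ℓ 0ℓ
  ℚ/ℤ = record
    { Carrier = ℚ
    ; _≈_     = _~_
    ; _∙_     = _+_
    ; ε       = 0ℚ
    ; _⁻¹     = -_
    ; isAbelianGroup = record
      { isGroup = record
        { isMonoid = record
          { isSemigroup = record
            { isMagma = record
              { isEquivalence = record { refl = ~-refl ; sym = ~-sym ; trans = ~-trans }
              ; ∙-cong        = ~-+
              }
            ; assoc = λ s t u → ~-reflexive (+-assoc s t u)
            }
          ; identity = (λ t → ~-reflexive (+-identityˡ t)) , (λ t → ~-reflexive (+-identityʳ t))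
          }
        ; inverse = (λ t → ~-reflexive (+-inverseˡ t)) , (λ t → ~-reflexive (+-inverseʳ t))
        ; ⁻¹-cong = ~-neg
        }
      ; comm = λ s t → ~-reflexive (+-comm s t)
      }
    }

  open import Algebra.Properties.Monoid.Mult (AbelianGroup.monoid ℚ/ℤ) using (_×_)

  ×≡* : ∀ k t → k × t ≡ fromℕ k * t
  ×≡* zero    t = ≡.sym (*-zeroˡ t)
  ×≡* (suc k) t = ≡.trans (cong (t +_) (×≡* k t)) (≡.trans (distrib (fromℕ k) t) (cong (_* t) (≡.sym (fromℕ-suc k))))
    where
    distrib : ∀ k t → t + k * t ≡ (1ℚ + k) * t
    distrib = solve 2 (λ k t → t :+ k :* t := (con 1ℚ :+ k) :* t) refl
      where open +-*-Solver

  rootCount : RootCount ℚ/ℤ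
  rootCount = record
    { division           = division
    ; division-solves    = λ k c j → subst (_~ c) (≡.sym (×≡* (suc k) (division k c j))) (division-solves k c j)
    ; division-injective = division-injective
    ; division-complete  = λ k c t e → division-complete k c t (subst (_~ c) (×≡* (suc k) t) e)
    }

-- The unit group modulo n and its characters

module Units where

  open import Algebra.Bundles using (AbelianGroup)
  open import Data.Nat.Base as ℕ using (ℕ)
  import Data.Nat.Coprimality as ℕC
  import Data.Nat.Divisibility as ℕ∣
  import Data.Nat.GCD as GCD
  open import Data.Integer.Base as ℤ using (ℤ; 1ℤ; 0ℤ; _+_; _*_; -_; _-_; ∣_∣; -[1+_])
  import Data.Integer.Properties as ℤₚ
  open import Data.Integer.Coprimality using (Coprime; coprime?)
  open import Data.Integer.Divisibility.Signed
  import Data.Integer.Solver as ℤSolver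
  open import Data.Rational.Base using (ℚ; 0ℚ) renaming (_+_ to _+ℚ_)
  open import Data.Maybe.Base using (just; nothing)
  open import Data.Maybe.Relation.Binary.Pointwise using (just; nothing)
  open import Data.Product.Base using (∃-syntax; ∃₂; _,_; proj₁; proj₂)
  open import Data.Unit.Base using (tt)
  open import Data.Empty using (⊥-elim)
  open import Function.Bundles using (mk⇔; module Equivalence)
  open import Relation.Nullary using (¬_; Dec; yes; no; contradiction)
  open import Relation.Binary.Bundles using (Setoid; DecSetoid)
  open import Relation.Binary.PropositionalEquality as ≡ using (_≡_; refl; cong; cong₂; subst)
  open import Level using (0ℓ)
  open Defs.Characters hiding (ℚ/ℤ; characters)
  open Defs.Characters.Residues
  open DirichletCharacter using (periodic; multiplicative; support) renaming (fun to apply)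
  open Counting
  open Duality
  open RationalsModℤ

  bézout : ∀ a b → Coprime a b → ∃₂ λ u v → a * u + b * v ≡ 1ℤ
  bézout a b c = signed (sign a) (sign b) (ℕC.coprime-Bézout {∣ a ∣} {∣ b ∣} c)
    where
    sign : ∀ a → ∃[ s ] ℤ.+ ∣ a ∣ ≡ a * s
    sign (ℤ.+ n)  = 1ℤ , ≡.sym (ℤₚ.*-identityʳ (ℤ.+ n))
    sign -[1+ n ] = ℤ.-1ℤ , ≡.sym (≡.trans (ℤₚ.*-comm -[1+ n ] ℤ.-1ℤ) (ℤₚ.-1*i≡-i -[1+ n ]))
    cast : ∀ {x y z w} → 1 ℕ.+ y ℕ.* z ≡ x ℕ.* w → 1ℤ + ℤ.+ y * ℤ.+ z ≡ ℤ.+ x * ℤ.+ w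
    cast {x} {y} {z} {w} e = ≡.trans (≡.sym (≡.trans (ℤₚ.pos-+ 1 (y ℕ.* z)) (cong (1ℤ +_) (ℤₚ.pos-* y z)))) (≡.trans (cong ℤ.+_ e) (ℤₚ.pos-* x w))
    open ℤSolver.+-*-Solver
    rearrange : ∀ x y z w → 1ℤ + y * z ≡ x * w → w * x + z * (- y) ≡ 1ℤ
    rearrange x y z w e = ≡.trans (solve 4 (λ x y z w → w :* x :+ z :* (:- y) := x :* w :- y :* z) refl x y z w)
      (≡.trans (cong (λ w → w - y * z) (≡.sym e)) (solve 2 (λ y z → con 1ℤ :+ y :* z :- y :* z := con 1ℤ) refl y z))
    signs : ∀ {A B} s t x y → A ≡ a * s → B ≡ b * t → A * x + B * y ≡ 1ℤ → a * (s * x) + b * (t * y) ≡ 1ℤ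
    signs s t x y refl refl e = ≡.trans (cong₂ _+_ (≡.sym (ℤₚ.*-assoc a s x)) (≡.sym (ℤₚ.*-assoc b t y))) e
    signed : (∃[ s ] ℤ.+ ∣ a ∣ ≡ a * s) → (∃[ t ] ℤ.+ ∣ b ∣ ≡ b * t) → GCD.Bézout.Identity 1 ∣ a ∣ ∣ b ∣ → ∃₂ λ u v → a * u + b * v ≡ 1ℤ
    signed (s , A≡) (t , B≡) (GCD.Bézout.+- x y e) = s * ℤ.+ x , t * - ℤ.+ y , signs s t (ℤ.+ x) (- ℤ.+ y) A≡ B≡ (rearrange (ℤ.+ x) (ℤ.+ y) (ℤ.+ ∣ b ∣) (ℤ.+ ∣ a ∣) (cast {x} {y} e))
    signed (s , A≡) (t , B≡) (GCD.Bézout.-+ x y e) = s * - ℤ.+ x , t * ℤ.+ y , signs s t (- ℤ.+ x) (ℤ.+ y) A≡ B≡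
      (≡.trans (ℤₚ.+-comm (ℤ.+ ∣ a ∣ * - ℤ.+ x) (ℤ.+ ∣ b ∣ * ℤ.+ y)) (rearrange (ℤ.+ y) (ℤ.+ x) (ℤ.+ ∣ a ∣) (ℤ.+ ∣ b ∣) (cast {y} {x} e)))

  ∣-combination : ∀ {n x y z} p q → n ∣ x → n ∣ y → z ≡ p * x + q * y → n ∣ z
  ∣-combination {n} p q n∣x n∣y e = subst (n ∣_) (≡.sym e) (∣m∣n⇒∣m+n (∣n⇒∣m*n p n∣x) (∣n⇒∣m*n q n∣y))

  abstract
    invertible : ∀ n a → Coprime a (ℤ.+ n) → ∃[ b ] ℤ.+ n ∣ a * b - 1ℤ
    invertible n a c = let u , v , e = bézout a (ℤ.+ n) c in u , divides (- v) (inverse u v e)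
      where
      open ℤSolver.+-*-Solver
      inverse : ∀ u v → a * u + ℤ.+ n * v ≡ 1ℤ → a * u - 1ℤ ≡ - v * ℤ.+ n
      inverse u v e = ≡.trans (cong (λ y → a * u - y) (≡.sym e)) (solve 3 (λ x n v → x :- (x :+ n :* v) := (:- v) :* n) refl (a * u) (ℤ.+ n) v)

  invertible⇒coprime : ∀ n a b → ℤ.+ n ∣ a * b - 1ℤ → Coprime a (ℤ.+ n)
  invertible⇒coprime n a b h {d} (d∣a , d∣n) = ℕ∣.∣1⇒≡1 (∣⇒∣ᵤ {ℤ.+ d} {1ℤ}
    (∣-combination b (- 1ℤ) (∣ᵤ⇒∣ {ℤ.+ d} {a} d∣a) (∣-trans (∣ᵤ⇒∣ {ℤ.+ d} {ℤ.+ n} d∣n) h)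
      (solve 2 (λ a b → con 1ℤ := b :* a :+ (:- con 1ℤ) :* (a :* b :- con 1ℤ)) refl a b)))
    where open ℤSolver.+-*-Solver

  1-coprime : ∀ n → Coprime 1ℤ (ℤ.+ n)
  1-coprime n = ℕC.1-coprimeTo n

  ≡⇒congruent : ∀ n {a b} → a ≡ b → n ∣ a - b
  ≡⇒congruent n {a} refl = divides 0ℤ (ℤₚ.+-inverseʳ a)

  units : ℕ → AbelianGroup 0ℓ 0ℓ
  units n = record
    { Carrier = ∃[ a ] Coprime a (ℤ.+ n)
    ; _≈_     = λ (a , _) (b , _) → ℤ.+ n ∣ a - b
    ; _∙_     = λ (a , c) (b , d) → a * b , coprime-*⁺ a b (ℤ.+ n) c d
    ; ε       = 1ℤ , (1-coprime n)
    ; _⁻¹     = λ (a , c) → let b , h = invertible n a c in b , (λ {d} → coprime-inverse a b h {d})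
    ; isAbelianGroup = record
      { isGroup = record
        { isMonoid = record
          { isSemigroup = record
            { isMagma = record
              { isEquivalence = record
                { refl  = λ {(a , _)} → ≡⇒congruent (ℤ.+ n) {a} refl
                ; sym   = λ {(a , _)} {(b , _)} h → subst (ℤ.+ n ∣_) (solve 2 (λ a b → :- (a :- b) := b :- a) refl a b) (∣m⇒∣-m h)
                ; trans = λ {(a , _)} {(b , _)} {(c , _)} h k → subst (ℤ.+ n ∣_) (solve 3 (λ a b c → (a :- b) :+ (b :- c) := a :- c) refl a b c) (∣m∣n⇒∣m+n h k)
                }
              ; ∙-cong = λ {(a , _)} {(b , _)} {(c , _)} {(d , _)} h k → ∣-combination c b h k
                  (solve 4 (λ a b c d → a :* c :- b :* d := c :* (a :- b) :+ b :* (c :- d)) refl a b c d)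
              }
            ; assoc = λ (a , _) (b , _) (c , _) → ≡⇒congruent (ℤ.+ n) (ℤₚ.*-assoc a b c)
            }
          ; identity = (λ (a , _) → ≡⇒congruent (ℤ.+ n) (ℤₚ.*-identityˡ a)) , (λ (a , _) → ≡⇒congruent (ℤ.+ n) (ℤₚ.*-identityʳ a))
          }
        ; inverse = (λ (a , c) → subst (λ x → ℤ.+ n ∣ x - 1ℤ) (ℤₚ.*-comm a _) (proj₂ (invertible n a c))) , (λ (a , c) → proj₂ (invertible n a c))
        ; ⁻¹-cong = λ {(a , c)} {(b , d)} a≡b → inverse-cong a b (invertible n a c) (invertible n b d) a≡b
        }
      ; comm = λ (a , _) (b , _) → ≡⇒congruent (ℤ.+ n) (ℤₚ.*-comm a b)
      }
    }
    where
    open ℤSolver.+-*-Solver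
    coprime-inverse : ∀ a b → ℤ.+ n ∣ a * b - 1ℤ → Coprime b (ℤ.+ n)
    coprime-inverse a b h = invertible⇒coprime n b a (subst (λ x → ℤ.+ n ∣ x - 1ℤ) (ℤₚ.*-comm a b) h)
    inverse-cong : ∀ a b (x : ∃[ x ] ℤ.+ n ∣ a * x - 1ℤ) (y : ∃[ y ] ℤ.+ n ∣ b * y - 1ℤ) → ℤ.+ n ∣ a - b → ℤ.+ n ∣ proj₁ x - proj₁ y
    -- Modulo n, x ≡ x (b y) ≡ (a x) y ≡ y; the coefficients record this chain as one linear
    -- combination.
    inverse-cong a b (x , ax) (y , by) h = ∣-combination 1ℤ (- (x * y)) (∣-combination y (- x) ax by refl) h
      (solve 4 (λ a b x y → x :- y := con 1ℤ :* (y :* (a :* x :- con 1ℤ) :+ (:- x) :* (b :* y :- con 1ℤ)) :+ (:- (x :* y)) :* (a :- b)) refl a b x y)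

  unitSetoid : ℕ → Setoid 0ℓ 0ℓ
  unitSetoid n = AbelianGroup.setoid (units n)

  ⊗-idem⇒𝟙 : ∀ {v} → v ≈ v ⊗ v → ¬ (v ≈ 𝟘) → v ≈ 𝟙
  ⊗-idem⇒𝟙 {nothing} _        v≉𝟘 = contradiction nothing v≉𝟘
  ⊗-idem⇒𝟙 {just t} (just h)  _   = just (~-sym (0~t h))
    where
    open import Algebra.Properties.Group (AbelianGroup.group ℚ/ℤ) using (identityˡ-unique)
    0~t : t ~ t +ℚ t → 0ℚ ~ t
    0~t h = ~-sym (identityˡ-unique t t (~-sym h))

  χ-1 : ∀ {n} (χ : DirichletCharacter n) → apply χ 1ℤ ≈ 𝟙
  χ-1 {n} χ = ⊗-idem⇒𝟙 (multiplicative χ 1ℤ 1ℤ) (λ z → Equivalence.to (support χ 1ℤ) z (1-coprime n))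

  module _ (n : ℕ) .{{_ : ℕ.NonZero n}} where

    open CharacterGroups ℚ/ℤ rootCount (units n) using (Character; characters; whole; card-dual)
    open Character

    -- The decision is an argument so that each law of the extended function can be proved by cases
    -- on it.
    extendByZero : {P : Set} → (P → ℚ) → Dec P → Value
    extendByZero f (yes c) = just (f c)
    extendByZero f (no  _) = nothing

    value : (v : Value) → ¬ (v ≈ 𝟘) → ℚ
    value (just t) _   = t
    value nothing  v≉𝟘 = contradiction nothing v≉𝟘

    just-value : ∀ v v≉𝟘 → just (value v v≉𝟘) ≈ v
    just-value (just t) _   = ≈-refl
    just-value nothing  v≉𝟘 = contradiction nothing v≉𝟘

    value-unique : ∀ {v t} v≉𝟘 → v ≈ just t → value v v≉𝟘 ~ t
    value-unique {just s} _ (just e) = e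

    fromGroup : (χ : ∀ a → Coprime a (ℤ.+ n) → ℚ) →
                (∀ {a b} → ℤ.+ n ∣ a - b → (c : Coprime a (ℤ.+ n)) (d : Coprime b (ℤ.+ n)) → χ a c ~ χ b d) →
                (∀ a b (c : Coprime a (ℤ.+ n)) (d : Coprime b (ℤ.+ n)) (e : Coprime (a * b) (ℤ.+ n)) → χ (a * b) e ~ χ a c +ℚ χ b d) → DirichletCharacter n
    fromGroup χ χ-cong χ-* = record
      { fun = λ a → at a (cop? a)
      ; isDirichletCharacter = record
        { periodic       = λ a b h → periodic′ a b h (cop? a) (cop? b)
        ; multiplicative = λ a b → multiplicative′ a b (cop? a) (cop? b) (cop? (a * b))
        ; support        = λ a → mk⇔ (support⁺ a (cop? a)) (support⁻ a (cop? a))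
        }
      }
      where
      cop? : ∀ a → Dec (Coprime a (ℤ.+ n))
      cop? a = coprime? a (ℤ.+ n)
      at : ∀ a → Dec (Coprime a (ℤ.+ n)) → Value
      at a = extendByZero {P = Coprime a (ℤ.+ n)} (χ a)
      periodic′ : ∀ a b → ℤ.+ n ∣ a - b → ∀ c? d? → at a c? ≈ at b d?
      periodic′ a b h (yes c) (yes d) = just (χ-cong h c d)
      periodic′ a b h (yes c) (no ¬d) = ⊥-elim (¬d (coprime-shift n a b h c))
      periodic′ a b h (no ¬c) (yes d) = ⊥-elim (¬c (coprime-shift n b a (congruent-sym n {a} h) d))
      periodic′ a b h (no ¬c) (no ¬d) = nothing
      multiplicative′ : ∀ a b c? d? e? → at (a * b) e? ≈ at a c? ⊗ at b d?
      multiplicative′ a b (yes c) (yes d) (yes e) = just (χ-* a b c d e)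
      multiplicative′ a b (yes c) (yes d) (no ¬e) = ⊥-elim (¬e (coprime-*⁺ a b (ℤ.+ n) c d))
      multiplicative′ a b (yes c) (no ¬d) (yes e) = ⊥-elim (¬d (proj₂ (coprime-*⁻ a b (ℤ.+ n) e)))
      multiplicative′ a b (no ¬c) d?      (yes e) = ⊥-elim (¬c (proj₁ (coprime-*⁻ a b (ℤ.+ n) e)))
      multiplicative′ a b (yes c) (no ¬d) (no ¬e) = nothing
      multiplicative′ a b (no ¬c) d?      (no ¬e) = nothing
      support⁺ : ∀ a c? → at a c? ≈ 𝟘 → ¬ Coprime a (ℤ.+ n)
      support⁺ a (no ¬c) _ c = ¬c c
      support⁻ : ∀ a c? → ¬ Coprime a (ℤ.+ n) → at a c? ≈ 𝟘
      support⁻ a (yes c) ¬c = ⊥-elim (¬c c)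
      support⁻ a (no _)  _  = nothing

    -- Restriction to integers coprime to n and extension by zero are inverse to each other, so
    -- Dirichlet characters modulo n are the characters of (ℤ/n)ˣ, and duality counts them.
    card-𝓧 : ∀ {N} → Card (unitSetoid n) N → Card (DecSetoid.setoid (𝓧 n)) N
    card-𝓧 γ = card-map {characters whole} {DecSetoid.setoid (𝓧 n)} (card-dual γ) lift (λ {χ} {ψ} → lift-cong χ ψ) (λ {χ} {ψ} → lift-injective χ ψ) (λ χ → descend χ , lift-descend χ)
      where
      cop? : ∀ a → Dec (Coprime a (ℤ.+ n))
      cop? a = coprime? a (ℤ.+ n)
      lift : Character whole → DirichletCharacter n
      lift χ = fromGroup (λ a c → fun χ (a , c) tt) (λ {a} {b} h c d → fun-≈ χ {a , c} {b , d} h tt tt)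
        (λ a b c d e → ~-trans (fun-≈ χ {a * b , e} {a * b , coprime-*⁺ a b (ℤ.+ n) c d} (≡⇒congruent (ℤ.+ n) {a * b} refl) tt tt) (fun-∙ χ (a , c) (b , d) tt tt tt))
      lift-cong : ∀ χ ψ → (∀ g p → fun χ g p ~ fun ψ g p) → ∀ a → apply (lift χ) a ≈ apply (lift ψ) a
      lift-cong χ ψ h a = onDec (cop? a)
        where
        onDec : ∀ d → extendByZero {P = Coprime a (ℤ.+ n)} (λ c → fun χ (a , c) tt) d ≈ extendByZero {P = Coprime a (ℤ.+ n)} (λ c → fun ψ (a , c) tt) d
        onDec (yes c) = just (h (a , c) tt)
        onDec (no ¬c) = nothing
      lift-injective : ∀ χ ψ → (∀ a → apply (lift χ) a ≈ apply (lift ψ) a) → ∀ g p → fun χ g p ~ fun ψ g p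
      lift-injective χ ψ h (a , c) p = onDec (cop? a) (h a)
        where
        self : ∀ {c d : Coprime a (ℤ.+ n)} (χ : Character whole) → fun χ (a , c) tt ~ fun χ (a , d) tt
        self {c} {d} χ = fun-≈ χ {a , c} {a , d} (≡⇒congruent (ℤ.+ n) {a} refl) tt tt
        onDec : ∀ d → extendByZero {P = Coprime a (ℤ.+ n)} (λ c → fun χ (a , c) tt) d ≈ extendByZero {P = Coprime a (ℤ.+ n)} (λ c → fun ψ (a , c) tt) d → fun χ (a , c) p ~ fun ψ (a , c) p
        onDec (yes d) (just e) = ~-trans (self χ) (~-trans e (self ψ))
        onDec (no ¬d) _        = ⊥-elim (¬d c)
      nonzero : ∀ (χ : DirichletCharacter n) a → Coprime a (ℤ.+ n) → ¬ (apply χ a ≈ 𝟘)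
      nonzero χ a c z = Equivalence.to (support χ a) z c
      descend : DirichletCharacter n → Character whole
      descend χ = record
        { fun   = λ (a , c) _ → value (apply χ a) (nonzero χ a c)
        ; fun-≈ = λ {(a , c)} {(b , d)} h _ _ → value-unique (nonzero χ a c) (≈-trans (periodic χ a b h) (≈-sym (just-value _ (nonzero χ b d))))
        ; fun-∙ = λ (a , c) (b , d) _ _ _ → value-unique (nonzero χ (a * b) (coprime-*⁺ a b (ℤ.+ n) c d)) (≈-trans (multiplicative χ a b)
            (≈-sym (⊗-cong (just-value _ (nonzero χ a c)) (just-value _ (nonzero χ b d)))))
        }
      lift-descend : ∀ χ a → apply (lift (descend χ)) a ≈ apply χ a
      lift-descend χ a = onDec (cop? a)
        where
        onDec : ∀ d → extendByZero {P = Coprime a (ℤ.+ n)} (λ c → value (apply χ a) (nonzero χ a c)) d ≈ apply χ a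
        onDec (yes c) = just-value (apply χ a) (nonzero χ a c)
        onDec (no ¬c) = ≈-sym (Equivalence.from (support χ a) ¬c)

-- Induced moduli and imprimitive characters

module CharacterCounting where

  open import Data.Nat.Base as ℕ using (ℕ; NonZero)
  import Data.Nat.Properties as ℕₚ
  import Data.Nat.Divisibility as ℕ∣
  open import Data.Integer.Base as ℤ using (ℤ; 1ℤ; _+_; _*_; -_; _-_; ∣_∣)
  import Data.Integer.Properties as ℤₚ
  open import Data.Integer.Coprimality using (Coprime; coprime?)
  open import Data.Integer.Divisibility.Signed
  import Data.Integer.Solver as ℤSolver
  open import Data.Rational.Base using () renaming (_+_ to _+ℚ_)
  open import Data.Rational.Properties using (+-identityˡ; +-identityʳ)
  open import Data.Maybe.Base using (just; nothing)
  open import Data.Maybe.Relation.Binary.Pointwise using (just; nothing)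
  open import Data.Product.Base using (Σ; ∃-syntax; _,_; proj₁; proj₂)
  open import Data.Sum.Base using (_⊎_; inj₁; inj₂)
  open import Data.Empty using (⊥-elim)
  open import Function.Bundles using (mk⇔; module Equivalence)
  open import Relation.Nullary using (¬_; Dec; yes; no)
  open import Relation.Binary.Bundles using (DecSetoid)
  open import Relation.Binary.PropositionalEquality as ≡ using (_≡_; refl; subst)
  open Defs.Characters hiding (ℚ/ℤ; characters)
  open Defs.Characters.Residues
  open DirichletCharacter using (periodic; multiplicative; support) renaming (fun to apply)
  open Counting
  open RationalsModℤ using (~-reflexive)
  open Units

  -- Sealed, as normalising these counts would enumerate the characters.
  abstract
    #𝓧 #𝓧′ : ∀ n .{{_ : NonZero n}} → ℕ
    #𝓧 n  = ∣𝓧∣ n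
    #𝓧′ n = ∣𝓧′∣ n

    #𝓧≡∣𝓧∣ : ∀ n .{{_ : NonZero n}} → #𝓧 n ≡ ∣𝓧∣ n
    #𝓧≡∣𝓧∣ n = refl

    #𝓧′≡∣𝓧′∣ : ∀ n .{{_ : NonZero n}} → #𝓧′ n ≡ ∣𝓧′∣ n
    #𝓧′≡∣𝓧′∣ n = refl

    card-#𝓧 : ∀ n .{{_ : NonZero n}} → Card (DecSetoid.setoid (𝓧 n)) (#𝓧 n)
    card-#𝓧 n = proj₂ (𝓧-finite n)

    card-#𝓧′ : ∀ n .{{_ : NonZero n}} → Card (DecSetoid.setoid (𝓧′ n)) (#𝓧′ n)
    card-#𝓧′ n = proj₂ (𝓧′-finite n)

  #𝓧-unique : ∀ n {N} .{{_ : NonZero n}} → Card (DecSetoid.setoid (𝓧 n)) N → #𝓧 n ≡ N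
  #𝓧-unique n α = card-unique {DecSetoid.setoid (𝓧 n)} (card-#𝓧 n) α

  #𝓧′-unique : ∀ n {N} .{{_ : NonZero n}} → Card (DecSetoid.setoid (𝓧′ n)) N → #𝓧′ n ≡ N
  #𝓧′-unique n α = card-unique {DecSetoid.setoid (𝓧′ n)} (card-#𝓧′ n) α

  coprime-∣ : ∀ {d n} a → d ℕ∣.∣ n → Coprime a (ℤ.+ n) → Coprime a (ℤ.+ d)
  coprime-∣ a d∣n c {i} (i∣a , i∣d) = c {i} (i∣a , ℕ∣.∣-trans i∣d d∣n)

  lift-∣ : ∀ {m n} → m ℕ∣.∣ n → ℤ.+ m ∣ ℤ.+ n
  lift-∣ {m} {n} m∣n = ∣ᵤ⇒∣ {ℤ.+ m} {ℤ.+ n} m∣n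

  ∣-sym : ∀ n a b → n ∣ a - b → n ∣ b - a
  ∣-sym n a b h = subst (n ∣_) (solve 2 (λ a b → :- (a :- b) := b :- a) refl a b) (∣m⇒∣-m h)
    where open ℤSolver.+-*-Solver

  ⊗-identityʳ : ∀ v → v ⊗ 𝟙 ≈ v
  ⊗-identityʳ (just t) = just (~-reflexive (+-identityʳ t))
  ⊗-identityʳ nothing  = nothing

  ⊗-identityˡ : ∀ v → 𝟙 ⊗ v ≈ v
  ⊗-identityˡ (just t) = just (~-reflexive (+-identityˡ t))
  ⊗-identityˡ nothing  = nothing

  ⊗-interchange : ∀ u v w x → (u ⊗ v) ⊗ (w ⊗ x) ≈ (u ⊗ w) ⊗ (v ⊗ x)
  ⊗-interchange (just s) (just t) (just u) (just v) = just (~-reflexive (interchange s t u v))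
    where
    open import Data.Rational.Solver
    open +-*-Solver
    interchange : ∀ s t u v → (s +ℚ t) +ℚ (u +ℚ v) ≡ (s +ℚ u) +ℚ (t +ℚ v)
    interchange = solve 4 (λ s t u v → (s :+ t) :+ (u :+ v) := (s :+ u) :+ (t :+ v)) refl
  ⊗-interchange nothing  v        w        x        = nothing
  ⊗-interchange (just _) nothing  nothing  x        = nothing
  ⊗-interchange (just _) nothing  (just _) x        = nothing
  ⊗-interchange (just _) (just _) nothing  x        = nothing
  ⊗-interchange (just _) (just _) (just _) nothing  = nothing

  ⊗-𝟘 : ∀ u v → u ⊗ v ≈ 𝟘 → u ≈ 𝟘 ⊎ v ≈ 𝟘
  ⊗-𝟘 nothing  v       _ = inj₁ nothing
  ⊗-𝟘 (just _) nothing _ = inj₂ nothing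

  𝟘-⊗ˡ : ∀ {u} v → u ≈ 𝟘 → u ⊗ v ≈ 𝟘
  𝟘-⊗ˡ v nothing = nothing

  𝟘-⊗ʳ : ∀ u {v} → v ≈ 𝟘 → u ⊗ v ≈ 𝟘
  𝟘-⊗ʳ (just _) nothing = nothing
  𝟘-⊗ʳ nothing  nothing = nothing

  module _ {n : ℕ} .{{_ : NonZero n}} (χ : DirichletCharacter n) where

    trivial-at : ∀ a → ℤ.+ n ∣ a - 1ℤ → apply χ a ≈ 𝟙
    trivial-at a h = ≈-trans (periodic χ a 1ℤ h) (χ-1 χ)

    induced-self : IsInducedModulus χ n
    induced-self = ℕ∣.∣-refl , λ a _ h → trivial-at a h

    off-support : ∀ a → ¬ Coprime a (ℤ.+ n) → apply χ a ≈ 𝟘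
    off-support a ¬c = Equivalence.from (support χ a) ¬c

    -- If both are coprime to n and z inverts y modulo n, then x z ≡ 1 (mod d), so χ (x z) = 1 and χ
    -- (x) = χ (x z) χ (y) = χ (y). If neither is, both values are 0.
    induced-cong : ∀ {d} → IsInducedModulus χ d → ∀ x y → ℤ.+ d ∣ x - y →
                   (Coprime x (ℤ.+ n) → Coprime y (ℤ.+ n)) → (Coprime y (ℤ.+ n) → Coprime x (ℤ.+ n)) → apply χ x ≈ apply χ y
    induced-cong {d} (d∣n , kernel) x y h to from = byCoprimality (coprime? x (ℤ.+ n))
      where
      open ℤSolver.+-*-Solver
      byInverse : Coprime x (ℤ.+ n) → (∃[ z ] ℤ.+ n ∣ y * z - 1ℤ) → apply χ x ≈ apply χ y
      byInverse c (z , yz≡1) = ≈-trans (periodic χ x (x * z * y) x≡xzy)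
        (≈-trans (multiplicative χ (x * z) y) (≈-trans (⊗-cong (kernel (x * z) xz-coprime xz≡1) ≈-refl) (⊗-identityˡ (apply χ y))))
        where
        x≡xzy : ℤ.+ n ∣ x - x * z * y
        x≡xzy = subst (ℤ.+ n ∣_) (solve 3 (λ x y z → (:- x) :* (y :* z :- con 1ℤ) := x :- x :* z :* y) refl x y z) (∣n⇒∣m*n (- x) yz≡1)
        xz-coprime : Coprime (x * z) (ℤ.+ n)
        xz-coprime = coprime-*⁺ x z (ℤ.+ n) c (invertible⇒coprime n z y (subst (λ w → ℤ.+ n ∣ w - 1ℤ) (ℤₚ.*-comm y z) yz≡1))
        xz≡1 : ℤ.+ d ∣ x * z - 1ℤ
        xz≡1 = subst (ℤ.+ d ∣_) (solve 3 (λ x y z → z :* (x :- y) :+ (y :* z :- con 1ℤ) := x :* z :- con 1ℤ) refl x y z) (∣m∣n⇒∣m+n (∣n⇒∣m*n z h) (∣-trans (lift-∣ d∣n) yz≡1))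
      byCoprimality : Dec (Coprime x (ℤ.+ n)) → apply χ x ≈ apply χ y
      byCoprimality (no ¬c) = ≈-trans (off-support x ¬c) (≈-sym (off-support y λ c → ¬c (from c)))
      byCoprimality (yes c) = byInverse c (invertible n y (to c))

    -- Periodicity and multiplicativity of `s` are required only as seen by χ. This covers an
    -- arbitrary section modulo an induced modulus as well as the projections of the Chinese
    -- remainder theorem.
    pullback : ∀ d (s : ℤ → ℤ) →
               (∀ a b → ℤ.+ d ∣ a - b → apply χ (s a) ≈ apply χ (s b)) →
               (∀ a b → apply χ (s (a * b)) ≈ apply χ (s a * s b)) →
               (∀ a → Coprime a (ℤ.+ d) → Coprime (s a) (ℤ.+ n)) →
               (∀ a → Coprime (s a) (ℤ.+ n) → Coprime a (ℤ.+ d)) →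
               DirichletCharacter d
    pullback d s s-cong s-* to from = record
      { fun = λ a → apply χ (s a)
      ; isDirichletCharacter = record
        { periodic       = s-cong
        ; multiplicative = λ a b → ≈-trans (s-* a b) (multiplicative χ (s a) (s b))
        ; support        = λ a → mk⇔ (support⁺ a) (support⁻ a)
        }
      }
      where
      support⁺ : ∀ a → apply χ (s a) ≈ 𝟘 → ¬ Coprime a (ℤ.+ d)
      support⁺ a z c = Equivalence.to (support χ (s a)) z (to a c)
      support⁻ : ∀ a → ¬ Coprime a (ℤ.+ d) → apply χ (s a) ≈ 𝟘
      support⁻ a ¬c = off-support (s a) (λ c → ¬c (from a c))

  -- `coprime-both` says that N has no prime factor beyond those of m and n. Besides N = m n this
  -- admits N = n with m a divisor of n, which gives the lift of a character to a larger modulus.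
  module Product {m n N : ℕ} (m∣N : m ℕ∣.∣ N) (n∣N : n ℕ∣.∣ N)
                 (coprime-both : ∀ a → Coprime a (ℤ.+ m) → Coprime a (ℤ.+ n) → Coprime a (ℤ.+ N)) where

    infixl 7 _⊠_
    _⊠_ : DirichletCharacter m → DirichletCharacter n → DirichletCharacter N
    χ ⊠ ψ = record
      { fun = λ a → apply χ a ⊗ apply ψ a
      ; isDirichletCharacter = record
        { periodic       = λ a b h → ⊗-cong (periodic χ a b (∣-trans (lift-∣ m∣N) h)) (periodic ψ a b (∣-trans (lift-∣ n∣N) h))
        ; multiplicative = λ a b → ≈-trans (⊗-cong (multiplicative χ a b) (multiplicative ψ a b))
                                           (⊗-interchange (apply χ a) (apply χ b) (apply ψ a) (apply ψ b))
        ; support        = λ a → mk⇔ (λ z → to a (⊗-𝟘 (apply χ a) (apply ψ a) z)) (from a (coprime? a (ℤ.+ m)))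
        }
      }
      where
      to : ∀ a → apply χ a ≈ 𝟘 ⊎ apply ψ a ≈ 𝟘 → ¬ Coprime a (ℤ.+ N)
      to a (inj₁ z) c = Equivalence.to (support χ a) z (coprime-∣ a m∣N c)
      to a (inj₂ z) c = Equivalence.to (support ψ a) z (coprime-∣ a n∣N c)
      from : ∀ a → Dec (Coprime a (ℤ.+ m)) → ¬ Coprime a (ℤ.+ N) → apply χ a ⊗ apply ψ a ≈ 𝟘
      from a (yes d) ¬c = 𝟘-⊗ʳ (apply χ a) (Equivalence.from (support ψ a) λ e → ¬c (coprime-both a d e))
      from a (no ¬d) ¬c = 𝟘-⊗ˡ (apply ψ a) (Equivalence.from (support χ a) ¬d)

  -- Modelled on n = pᵏ⁺¹ and d = pᵏ: all proper divisors of n divide the single proper divisor d,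
  -- so the imprimitive characters are exactly those that come from d. The section `s` picks
  -- representatives coprime to n for the units modulo d.
  module Imprimitive {n d : ℕ} .{{_ : NonZero n}} .{{_ : NonZero d}} (d∣n : d ℕ∣.∣ n) (d<n : d ℕ.< n)
                     (largest : ∀ e → e ℕ∣.∣ n → e ℕ.< n → e ℕ∣.∣ d)
                     (s : ℤ → ℤ) (s-section : ∀ a → ℤ.+ d ∣ s a - a) (s-coprime : ∀ a → Coprime a (ℤ.+ d) → Coprime (s a) (ℤ.+ n)) where

    open Product d∣n ℕ∣.∣-refl (λ a _ c → c)

    -- The principal character supplies the value 0 at integers that are coprime to d but not to n.
    lift : DirichletCharacter d → DirichletCharacter n
    lift ψ = ψ ⊠ principal n

    lift-at : ∀ ψ a → Coprime a (ℤ.+ n) → apply (lift ψ) a ≈ apply ψ a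
    lift-at ψ a c = ≈-trans (⊗-cong (≈-refl {apply ψ a}) (one (coprime? a (ℤ.+ n)))) (⊗-identityʳ (apply ψ a))
      where
      one : ∀ c? → indicator {Coprime a (ℤ.+ n)} c? ≈ 𝟙
      one (yes _) = ≈-refl
      one (no ¬c) = ⊥-elim (¬c c)

    s-coprime⁻¹ : ∀ a → Coprime (s a) (ℤ.+ n) → Coprime a (ℤ.+ d)
    s-coprime⁻¹ a c = coprime-shift d (s a) a (s-section a) (coprime-∣ (s a) d∣n c)

    -- The section is in general not multiplicative modulo n, but the discrepancy is a congruence
    -- modulo d, and `induced-cong` makes χ blind to it.
    descend : ∀ χ → IsInducedModulus χ d → DirichletCharacter d
    descend χ ind = pullback χ d s
      (λ a b h → induced-cong χ ind (s a) (s b) (s-cong a b h)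
        (λ c → s-coprime b (coprime-shift d a b h (s-coprime⁻¹ a c)))
        (λ c → s-coprime a (coprime-shift d b a (∣-sym (ℤ.+ d) a b h) (s-coprime⁻¹ b c))))
      (λ a b → induced-cong χ ind (s (a * b)) (s a * s b) (s-* a b)
        (λ c → let ca , cb = coprime-*⁻ a b (ℤ.+ d) (s-coprime⁻¹ (a * b) c) in coprime-*⁺ (s a) (s b) (ℤ.+ n) (s-coprime a ca) (s-coprime b cb))
        (λ c → let ca , cb = coprime-*⁻ (s a) (s b) (ℤ.+ n) c in s-coprime (a * b) (coprime-*⁺ a b (ℤ.+ d) (s-coprime⁻¹ a ca) (s-coprime⁻¹ b cb))))
      s-coprime s-coprime⁻¹
      where
      open ℤSolver.+-*-Solver
      s-cong : ∀ a b → ℤ.+ d ∣ a - b → ℤ.+ d ∣ s a - s b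
      s-cong a b h = subst (ℤ.+ d ∣_) (solve 4 (λ a b x y → (a :- b) :+ ((x :- a) :- (y :- b)) := x :- y) refl a b (s a) (s b))
        (∣m∣n⇒∣m+n h (∣m∣n⇒∣m-n (s-section a) (s-section b)))
      s-* : ∀ a b → ℤ.+ d ∣ s (a * b) - s a * s b
      s-* a b = subst (ℤ.+ d ∣_) (solve 5 (λ a b x y z → (z :- a :* b) :- (y :* (x :- a) :+ a :* (y :- b)) := z :- x :* y) refl a b (s a) (s b) (s (a * b)))
        (∣m∣n⇒∣m-n (s-section (a * b)) (∣m∣n⇒∣m+n (∣n⇒∣m*n (s b) (s-section a)) (∣n⇒∣m*n a (s-section b))))

    lift-descend : ∀ χ ind a → apply (lift (descend χ ind)) a ≈ apply χ a
    lift-descend χ ind a = byCoprimality (coprime? a (ℤ.+ n))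
      where
      byCoprimality : Dec (Coprime a (ℤ.+ n)) → apply (lift (descend χ ind)) a ≈ apply χ a
      byCoprimality (yes c) = ≈-trans (lift-at (descend χ ind) a c)
        (induced-cong χ ind (s a) a (s-section a) (λ _ → c) (λ _ → s-coprime a (coprime-∣ a d∣n c)))
      byCoprimality (no ¬c) = ≈-trans (off-support (lift (descend χ ind)) a ¬c) (≈-sym (off-support χ a ¬c))

    -- Every unit class modulo d contains `s a`, which is coprime to n; there the lift has the value
    -- of the original character.
    lift-injective : ∀ ψ ψ′ → (∀ a → apply (lift ψ) a ≈ apply (lift ψ′) a) → ∀ a → apply ψ a ≈ apply ψ′ a
    lift-injective ψ ψ′ h a = byCoprimality (coprime? a (ℤ.+ d))
      where
      byCoprimality : Dec (Coprime a (ℤ.+ d)) → apply ψ a ≈ apply ψ′ a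
      byCoprimality (yes c) = ≈-trans (≈-sym (at-section ψ)) (≈-trans (h (s a)) (at-section ψ′))
        where
        at-section : ∀ ψ → apply (lift ψ) (s a) ≈ apply ψ a
        at-section ψ = ≈-trans (lift-at ψ (s a) (s-coprime a c)) (periodic ψ (s a) a (s-section a))
      byCoprimality (no ¬c) = ≈-trans (off-support ψ a ¬c) (≈-sym (off-support ψ′ a ¬c))

    lift-imprimitive : ∀ ψ → IsInducedModulus (lift ψ) d
    lift-imprimitive ψ = d∣n , λ a c h → ≈-trans (lift-at ψ a c) (trivial-at ψ a h)

    -- An induced modulus e < n would divide d, and then a ≡ 1 (mod d) implies a ≡ 1 (mod e), so d
    -- would be induced too.
    ¬induced⇒primitive : ∀ χ → ¬ IsInducedModulus χ d → IsPrimitive χ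
    ¬induced⇒primitive χ ¬ind = induced-self χ , minimal
      where
      minimal : ∀ e → IsInducedModulus χ e → n ℕ.≤ e
      minimal e (e∣n , kernel) = ℕₚ.≮⇒≥ λ e<n → ¬ind (d∣n , λ a c h → kernel a c (∣-trans (lift-∣ (largest e e∣n e<n)) h))

    card-split : ∀ {M D} → Card (DecSetoid.setoid (𝓧′ n)) M → Card (DecSetoid.setoid (𝓧 d)) D → Card (DecSetoid.setoid (𝓧 n)) (M ℕ.+ D)
    card-split α β = card-sum {DecSetoid.setoid (𝓧′ n)} {DecSetoid.setoid (𝓧 d)} {DecSetoid.setoid (𝓧 n)} α β proj₁ lift
      (λ {χ} {χ′} → proj₁-cong {χ} {χ′}) (λ {ψ} {ψ′} → lift-cong ψ ψ′)
      (λ {χ} {χ′} → proj₁-cong {χ} {χ′}) (λ {ψ} {ψ′} → lift-injective ψ ψ′) (λ {χ} {ψ} → disjoint χ ψ) cover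
      where
      open DecSetoid (𝓧 n) using () renaming (_≈_ to _≋_)
      open DecSetoid (𝓧 d) using () renaming (_≈_ to _≋ᵈ_)
      open DecSetoid (𝓧′ n) using () renaming (Carrier to Primitive)
      proj₁-cong : ∀ {χ χ′ : Primitive} → proj₁ χ ≋ proj₁ χ′ → proj₁ χ ≋ proj₁ χ′
      proj₁-cong e = e
      lift-cong : ∀ ψ ψ′ → ψ ≋ᵈ ψ′ → lift ψ ≋ lift ψ′
      lift-cong ψ ψ′ e a = ⊗-cong (e a) (≈-refl {apply (principal n) a})
      disjoint : ∀ (χ : Primitive) ψ → ¬ (proj₁ χ ≋ lift ψ)
      disjoint (χ , _ , minimal) ψ e = ℕₚ.<⇒≱ d<n (minimal d (d∣n , λ a c h → ≈-trans (e a) (proj₂ (lift-imprimitive ψ) a c h)))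
      sort : ∀ χ → Dec (IsInducedModulus χ d) → (Σ Primitive λ χ′ → proj₁ χ′ ≋ χ) ⊎ (∃[ ψ ] lift ψ ≋ χ)
      sort χ (yes ind) = inj₂ (descend χ ind , lift-descend χ ind)
      sort χ (no ¬ind) = inj₁ ((χ , ¬induced⇒primitive χ ¬ind) , λ _ → ≈-refl)
      cover : ∀ χ → (Σ Primitive λ χ′ → proj₁ χ′ ≋ χ) ⊎ (∃[ ψ ] lift ψ ≋ χ)
      cover χ = sort χ (isInducedModulus? n χ d)

    #𝓧′+#𝓧 : #𝓧′ n ℕ.+ #𝓧 d ≡ #𝓧 n
    #𝓧′+#𝓧 = ≡.sym (#𝓧-unique n (card-split (card-#𝓧′ n) (card-#𝓧 d)))

-- Multiplicativity in coprime moduli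

module ChineseRemainder where

  open import Data.Nat.Base as ℕ using (ℕ; NonZero)
  import Data.Nat.Properties as ℕₚ
  import Data.Nat.Coprimality as ℕC
  import Data.Nat.Divisibility as ℕ∣
  open import Data.Nat.GCD using (gcd; gcd[m,n]∣m; gcd[m,n]∣n; c*gcd[m,n]≡gcd[cm,cn]; gcd-greatest)
  open import Data.Integer.Base as ℤ using (ℤ; 1ℤ; _+_; _*_; -_; _-_)
  import Data.Integer.Properties as ℤₚ
  open import Data.Integer.Coprimality using (Coprime)
  open import Data.Integer.Divisibility.Signed
  import Data.Integer.Solver as ℤSolver
  open import Data.Product.Base using (∃-syntax; ∃₂; _×_; _,_; proj₁; proj₂)
  open import Relation.Binary.Bundles using (DecSetoid)
  open import Relation.Binary.PropositionalEquality as ≡ using (_≡_; refl; cong; subst)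
  open Defs.Characters hiding (ℚ/ℤ; characters)
  open Defs.Characters.Residues
  open DirichletCharacter using (periodic; multiplicative) renaming (fun to apply)
  open Counting
  open Units
  open CharacterCounting

  coprime⇒*∣ : ∀ {m n k} → ℕC.Coprime m n → m ℕ∣.∣ k → n ℕ∣.∣ k → m ℕ.* n ℕ∣.∣ k
  coprime⇒*∣ {m} {n} c (ℕ∣.divides q refl) n∣k =
    subst (m ℕ.* n ℕ∣.∣_) (ℕₚ.*-comm m q) (ℕ∣.*-monoʳ-∣ m (ℕC.coprime-divisor (ℕC.sym c) (subst (n ℕ∣.∣_) (ℕₚ.*-comm q m) n∣k)))

  coprime⇒*∣ℤ : ∀ {m n} x → ℕC.Coprime m n → ℤ.+ m ∣ x → ℤ.+ n ∣ x → ℤ.+ (m ℕ.* n) ∣ x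
  coprime⇒*∣ℤ {m} {n} x c m∣x n∣x = ∣ᵤ⇒∣ {ℤ.+ (m ℕ.* n)} {x} (coprime⇒*∣ c (∣⇒∣ᵤ m∣x) (∣⇒∣ᵤ n∣x))

  coprime-*ʳ : ∀ a m n → Coprime a (ℤ.+ m) → Coprime a (ℤ.+ n) → Coprime a (ℤ.+ (m ℕ.* n))
  coprime-*ʳ a m n c d {i} (i∣a , i∣mn) = d {i} (i∣a , ℕC.coprime-divisor {i} {m} {n} (λ {j} (j∣i , j∣m) → c {j} (ℕ∣.∣-trans j∣i i∣a , j∣m)) i∣mn)

  module Projection (m n : ℕ) .{{_ : NonZero m}} .{{_ : NonZero n}} (c : ℕC.Coprime m n) where

    abstract
      -- From m u + n v = 1 the witness is n v.
      idempotent : ∃[ e ] (ℤ.+ m ∣ e - 1ℤ) × (ℤ.+ n ∣ e)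
      idempotent = fromBézout (bézout (ℤ.+ m) (ℤ.+ n) c)
        where
        open ℤSolver.+-*-Solver
        fromBézout : (∃₂ λ u v → ℤ.+ m * u + ℤ.+ n * v ≡ 1ℤ) → ∃[ e ] (ℤ.+ m ∣ e - 1ℤ) × (ℤ.+ n ∣ e)
        fromBézout (u , v , e) = ℤ.+ n * v , subst (ℤ.+ m ∣_) eq (∣n⇒∣m*n (- u) ∣-refl) , divides v (ℤₚ.*-comm (ℤ.+ n) v)
          where
          eq : - u * ℤ.+ m ≡ ℤ.+ n * v - 1ℤ
          eq = ≡.trans (solve 4 (λ u v m n → (:- u) :* m := n :* v :- (m :* u :+ n :* v)) refl u v (ℤ.+ m) (ℤ.+ n)) (cong (λ w → ℤ.+ n * v - w) e)

    e : ℤ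
    e = proj₁ idempotent

    m∣e-1 : ℤ.+ m ∣ e - 1ℤ
    m∣e-1 = proj₁ (proj₂ idempotent)

    n∣e : ℤ.+ n ∣ e
    n∣e = proj₂ (proj₂ idempotent)

    -- The formula gives a residue that is a modulo m and 1 modulo n; on units it embeds (ℤ/m)ˣ as a
    -- direct factor of (ℤ/mn)ˣ.
    π : ℤ → ℤ
    π a = a * e + (1ℤ - e)

    open ℤSolver.+-*-Solver

    π≡a : ∀ a → ℤ.+ m ∣ π a - a
    π≡a a = subst (ℤ.+ m ∣_) (identity a e) (∣n⇒∣m*n (a - 1ℤ) m∣e-1)
      where
      identity : ∀ a e → (a - 1ℤ) * (e - 1ℤ) ≡ (a * e + (1ℤ - e)) - a
      identity = solve 2 (λ a e → (a :- con 1ℤ) :* (e :- con 1ℤ) := (a :* e :+ (con 1ℤ :- e)) :- a) refl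

    π≡1 : ∀ a → ℤ.+ n ∣ π a - 1ℤ
    π≡1 a = subst (ℤ.+ n ∣_) (identity a e) (∣n⇒∣m*n (a - 1ℤ) n∣e)
      where
      identity : ∀ a e → (a - 1ℤ) * e ≡ (a * e + (1ℤ - e)) - 1ℤ
      identity = solve 2 (λ a e → (a :- con 1ℤ) :* e := (a :* e :+ (con 1ℤ :- e)) :- con 1ℤ) refl

    π-cong : ∀ a b → ℤ.+ m ∣ a - b → ℤ.+ (m ℕ.* n) ∣ π a - π b
    π-cong a b h = subst (ℤ.+ (m ℕ.* n) ∣_) (identity a b e) (coprime⇒*∣ℤ ((a - b) * e) c (∣m⇒∣m*n e h) (∣n⇒∣m*n (a - b) n∣e))
      where
      identity : ∀ a b e → (a - b) * e ≡ (a * e + (1ℤ - e)) - (b * e + (1ℤ - e))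
      identity = solve 3 (λ a b e → (a :- b) :* e := (a :* e :+ (con 1ℤ :- e)) :- (b :* e :+ (con 1ℤ :- e))) refl

    -- The difference is - (a - 1) (b - 1) e (e - 1), where n divides e and m divides e - 1.
    π-* : ∀ a b → ℤ.+ (m ℕ.* n) ∣ π (a * b) - π a * π b
    π-* a b = subst (ℤ.+ (m ℕ.* n) ∣_) (identity a b e)
      (coprime⇒*∣ℤ (- ((a - 1ℤ) * (b - 1ℤ)) * e * (e - 1ℤ)) c (∣n⇒∣m*n (- ((a - 1ℤ) * (b - 1ℤ)) * e) m∣e-1) (∣m⇒∣m*n (e - 1ℤ) (∣n⇒∣m*n (- ((a - 1ℤ) * (b - 1ℤ))) n∣e)))
      where
      identity : ∀ a b e → (- ((a - 1ℤ) * (b - 1ℤ)) * e) * (e - 1ℤ) ≡ (a * b * e + (1ℤ - e)) - (a * e + (1ℤ - e)) * (b * e + (1ℤ - e))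
      identity = solve 3 (λ a b e → ((:- ((a :- con 1ℤ) :* (b :- con 1ℤ))) :* e) :* (e :- con 1ℤ)
        := (a :* b :* e :+ (con 1ℤ :- e)) :- (a :* e :+ (con 1ℤ :- e)) :* (b :* e :+ (con 1ℤ :- e))) refl

    π-coprime : ∀ a → Coprime a (ℤ.+ m) → Coprime (π a) (ℤ.+ (m ℕ.* n))
    π-coprime a d = coprime-*ʳ (π a) m n (coprime-shift m a (π a) (∣-sym (ℤ.+ m) (π a) a (π≡a a)) d)
                                         (coprime-shift n 1ℤ (π a) (∣-sym (ℤ.+ n) (π a) 1ℤ (π≡1 a)) (1-coprime n))

    π-coprime⁻¹ : ∀ a → Coprime (π a) (ℤ.+ (m ℕ.* n)) → Coprime a (ℤ.+ m)
    π-coprime⁻¹ a d = coprime-shift m (π a) a (π≡a a) (coprime-∣ (π a) (ℕ∣.m∣m*n n) d)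

    -- As d divides both n d and n m, it divides n gcd (d, m), whose two factors are coprime. This
    -- passes from the modulus gcd (d, m) of a component to the modulus d of the product.
    gcd-divides : ∀ d x → d ℕ∣.∣ m ℕ.* n → ℤ.+ (gcd d m) ∣ x → ℤ.+ n ∣ x → ℤ.+ d ∣ x
    gcd-divides d x d∣mn g∣x n∣x = ∣-trans (lift-∣ d∣gn) (coprime⇒*∣ℤ x gcd-coprime g∣x n∣x)
      where
      gcd-coprime : ℕC.Coprime (gcd d m) n
      gcd-coprime (i∣g , i∣n) = c (ℕ∣.∣-trans i∣g (gcd[m,n]∣n d m) , i∣n)
      d∣gn : d ℕ∣.∣ gcd d m ℕ.* n
      d∣gn = subst (d ℕ∣.∣_) (≡.trans (≡.sym (c*gcd[m,n]≡gcd[cm,cn] n d m)) (ℕₚ.*-comm n (gcd d m)))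
        (gcd-greatest (ℕ∣.n∣m*n n) (subst (d ℕ∣.∣_) (ℕₚ.*-comm m n) d∣mn))

  module _ (m n : ℕ) .{{_ : NonZero m}} .{{_ : NonZero n}} (c : ℕC.Coprime m n) where

    open Projection m n c using (π≡a; π≡1; π-coprime; gcd-divides) renaming (π to π₁)
    private
      module π₁ = Projection m n c
      module π₂ = Projection n m (ℕC.sym c)
      N = m ℕ.* n
      instance
        N≢0 : NonZero (m ℕ.* n)
        N≢0 = ℕₚ.m*n≢0 m n
      N≡ : n ℕ.* m ≡ N
      N≡ = ℕₚ.*-comm n m
    open π₂ using () renaming (π to π₂)
    open Product {m} {n} {N} (ℕ∣.m∣m*n n) (ℕ∣.n∣m*n m) (λ a → coprime-*ʳ a m n)

    first : DirichletCharacter N → DirichletCharacter m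
    first χ = pullback χ m π₁
      (λ a b h → periodic χ (π₁ a) (π₁ b) (π₁.π-cong a b h)) (λ a b → periodic χ (π₁ (a * b)) (π₁ a * π₁ b) (π₁.π-* a b))
      π₁.π-coprime π₁.π-coprime⁻¹

    second : DirichletCharacter N → DirichletCharacter n
    second χ = pullback χ n π₂
      (λ a b h → periodic χ (π₂ a) (π₂ b) (subst (λ N → ℤ.+ N ∣ π₂ a - π₂ b) N≡ (π₂.π-cong a b h)))
      (λ a b → periodic χ (π₂ (a * b)) (π₂ a * π₂ b) (subst (λ N → ℤ.+ N ∣ π₂ (a * b) - π₂ a * π₂ b) N≡ (π₂.π-* a b)))
      (λ a d → subst (λ N → Coprime (π₂ a) (ℤ.+ N)) N≡ (π₂.π-coprime a d))
      (λ a d → π₂.π-coprime⁻¹ a (subst (λ N → Coprime (π₂ a) (ℤ.+ N)) (≡.sym N≡) d))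

    -- The product π₁ a · π₂ a is a · 1 modulo m and 1 · a modulo n, hence a modulo m n.
    recombine : ∀ χ a → apply (first χ ⊠ second χ) a ≈ apply χ a
    recombine χ a = ≈-trans (≈-sym (multiplicative χ (π₁ a) (π₂ a))) (periodic χ (π₁ a * π₂ a) a
      (coprime⇒*∣ℤ (π₁ a * π₂ a - a) c (near (π₁ a) (π₂ a) a (π₁.π≡a a) (π₂.π≡1 a))
        (subst (λ w → ℤ.+ n ∣ w - a) (ℤₚ.*-comm (π₂ a) (π₁ a)) (near (π₂ a) (π₁ a) a (π₂.π≡a a) (π₁.π≡1 a)))))
      where
      open ℤSolver.+-*-Solver
      near : ∀ {k} x y a → k ∣ x - a → k ∣ y - 1ℤ → k ∣ x * y - a
      near {k} x y a h h′ = subst (k ∣_) (solve 3 (λ x y a → x :* (y :- con 1ℤ) :+ (x :- a) := x :* y :- a) refl x y a) (∣m∣n⇒∣m+n (∣n⇒∣m*n x h′) h)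

    ⊠-π₁ : ∀ χ ψ a → apply (χ ⊠ ψ) (π₁ a) ≈ apply χ a
    ⊠-π₁ χ ψ a = ≈-trans (⊗-cong (periodic χ (π₁ a) a (π₁.π≡a a)) (trivial-at ψ (π₁ a) (π₁.π≡1 a))) (⊗-identityʳ (apply χ a))

    ⊠-π₂ : ∀ χ ψ a → apply (χ ⊠ ψ) (π₂ a) ≈ apply ψ a
    ⊠-π₂ χ ψ a = ≈-trans (⊗-cong (trivial-at χ (π₂ a) (π₂.π≡1 a)) (periodic ψ (π₂ a) a (π₂.π≡a a))) (⊗-identityˡ (apply ψ a))

    open DecSetoid (𝓧 m) using () renaming (_≈_ to _≋₁_)
    open DecSetoid (𝓧 n) using () renaming (_≈_ to _≋₂_)
    open DecSetoid (𝓧 N) using () renaming (_≈_ to _≋_)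

    ⊠-cong : ∀ χ χ′ ψ ψ′ → χ ≋₁ χ′ → ψ ≋₂ ψ′ → χ ⊠ ψ ≋ χ′ ⊠ ψ′
    ⊠-cong χ χ′ ψ ψ′ e f a = ⊗-cong (e a) (f a)

    ⊠-injective : ∀ χ χ′ ψ ψ′ → χ ⊠ ψ ≋ χ′ ⊠ ψ′ → χ ≋₁ χ′ × ψ ≋₂ ψ′
    ⊠-injective χ χ′ ψ ψ′ e =
      (λ a → ≈-trans (≈-sym (⊠-π₁ χ ψ a)) (≈-trans (e (π₁ a)) (⊠-π₁ χ′ ψ′ a))) ,
      (λ a → ≈-trans (≈-sym (⊠-π₂ χ ψ a)) (≈-trans (e (π₂ a)) (⊠-π₂ χ′ ψ′ a)))

    -- If d is an induced modulus of the product, then gcd (d, m) and gcd (d, n) are induced moduli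
    -- of the factors. Primitivity makes them m and n, so both divide d, and so does m n.
    ⊠-primitive : ∀ χ ψ → IsPrimitive χ → IsPrimitive ψ → IsPrimitive (χ ⊠ ψ)
    ⊠-primitive χ ψ (_ , χ-minimal) (_ , ψ-minimal) = induced-self (χ ⊠ ψ) , minimal
      where
      minimal : ∀ d → IsInducedModulus (χ ⊠ ψ) d → N ℕ.≤ d
      minimal d (d∣N , kernel) = ℕ∣.∣⇒≤ {{d≢0}} (coprime⇒*∣ c (divides-d m (χ-minimal _ χ-induced)) (divides-d n (ψ-minimal _ ψ-induced)))
        where
        d≢0 : NonZero d
        d≢0 = ℕ.≢-nonZero λ { refl → ℕ.≢-nonZero⁻¹ N (ℕ∣.0∣⇒≡0 d∣N) }
        divides-d : ∀ k .{{_ : NonZero k}} → k ℕ.≤ gcd d k → k ℕ∣.∣ d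
        divides-d k k≤g = subst (ℕ∣._∣ d) (ℕₚ.≤-antisym (ℕ∣.∣⇒≤ (gcd[m,n]∣n d k)) k≤g) (gcd[m,n]∣m d k)
        step : ∀ {k} x a → k ∣ x - a → k ∣ a - 1ℤ → k ∣ x - 1ℤ
        step {k} x a h h′ = subst (k ∣_) (solve 2 (λ x a → (x :- a) :+ (a :- con 1ℤ) := x :- con 1ℤ) refl x a) (∣m∣n⇒∣m+n h h′)
          where open ℤSolver.+-*-Solver
        χ-induced : IsInducedModulus χ (gcd d m)
        χ-induced = gcd[m,n]∣n d m , λ a a⊥m g∣a-1 → ≈-trans (≈-sym (⊠-π₁ χ ψ a)) (kernel (π₁ a) (π₁.π-coprime a a⊥m)
          (π₁.gcd-divides d (π₁ a - 1ℤ) d∣N (step (π₁ a) a (∣-trans (lift-∣ (gcd[m,n]∣n d m)) (π₁.π≡a a)) g∣a-1) (π₁.π≡1 a)))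
        ψ-induced : IsInducedModulus ψ (gcd d n)
        ψ-induced = gcd[m,n]∣n d n , λ a a⊥n g∣a-1 → ≈-trans (≈-sym (⊠-π₂ χ ψ a)) (kernel (π₂ a) (subst (λ N → Coprime (π₂ a) (ℤ.+ N)) N≡ (π₂.π-coprime a a⊥n))
          (π₂.gcd-divides d (π₂ a - 1ℤ) (subst (d ℕ∣.∣_) (≡.sym N≡) d∣N) (step (π₂ a) a (∣-trans (lift-∣ (gcd[m,n]∣n d n)) (π₂.π≡a a)) g∣a-1) (π₂.π≡1 a)))

    -- An induced modulus d of the first component makes d n an induced modulus of χ, because the
    -- second component is trivial on integers that are 1 modulo n. Hence m n ≤ d n.
    first-primitive : ∀ χ → IsPrimitive χ → IsPrimitive (first χ)
    first-primitive χ (_ , χ-minimal) = induced-self (first χ) , λ d (d∣m , kernel) → ℕₚ.*-cancelʳ-≤ m d n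
      (χ-minimal (d ℕ.* n) (ℕ∣.*-monoˡ-∣ n d∣m , λ a a⊥N h → ≈-trans (≈-sym (recombine χ a))
        (⊗-cong (kernel a (coprime-∣ a (ℕ∣.m∣m*n n) a⊥N) (∣-trans (lift-∣ (ℕ∣.m∣m*n n)) h))
                (trivial-at (second χ) a (∣-trans (lift-∣ (ℕ∣.n∣m*n d)) h)))))

    second-primitive : ∀ χ → IsPrimitive χ → IsPrimitive (second χ)
    second-primitive χ (_ , χ-minimal) = induced-self (second χ) , λ d (d∣n , kernel) → ℕₚ.*-cancelˡ-≤ m
      (χ-minimal (m ℕ.* d) (ℕ∣.*-monoʳ-∣ m d∣n , λ a a⊥N h → ≈-trans (≈-sym (recombine χ a))
        (⊗-cong (trivial-at (first χ) a (∣-trans (lift-∣ (ℕ∣.m∣m*n d)) h))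
                (kernel a (coprime-∣ a (ℕ∣.n∣m*n m) a⊥N) (∣-trans (lift-∣ (ℕ∣.n∣m*n m)) h)))))

    card-𝓧-* : ∀ {A B} → Card (DecSetoid.setoid (𝓧 m)) A → Card (DecSetoid.setoid (𝓧 n)) B → Card (DecSetoid.setoid (𝓧 N)) (A ℕ.* B)
    card-𝓧-* α β = card-product {DecSetoid.setoid (𝓧 m)} {DecSetoid.setoid (𝓧 n)} {DecSetoid.setoid (𝓧 N)} α β _⊠_
      (λ {χ} {χ′} {ψ} {ψ′} → ⊠-cong χ χ′ ψ ψ′) (λ {χ} {χ′} {ψ} {ψ′} → ⊠-injective χ χ′ ψ ψ′)
      (λ χ → first χ , second χ , recombine χ)

    card-𝓧′-* : ∀ {A B} → Card (DecSetoid.setoid (𝓧′ m)) A → Card (DecSetoid.setoid (𝓧′ n)) B → Card (DecSetoid.setoid (𝓧′ N)) (A ℕ.* B)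
    card-𝓧′-* α β = card-product {DecSetoid.setoid (𝓧′ m)} {DecSetoid.setoid (𝓧′ n)} {DecSetoid.setoid (𝓧′ N)} α β
      (λ (χ , χ-primitive) (ψ , ψ-primitive) → χ ⊠ ψ , ⊠-primitive χ ψ χ-primitive ψ-primitive)
      (λ {χ} {χ′} {ψ} {ψ′} → ⊠-cong (proj₁ χ) (proj₁ χ′) (proj₁ ψ) (proj₁ ψ′)) (λ {χ} {χ′} {ψ} {ψ′} → ⊠-injective (proj₁ χ) (proj₁ χ′) (proj₁ ψ) (proj₁ ψ′))
      (λ (χ , χ-primitive) → (first χ , first-primitive χ χ-primitive) , (second χ , second-primitive χ χ-primitive) , recombine χ)

    #𝓧-* : #𝓧 N ≡ #𝓧 m ℕ.* #𝓧 n
    #𝓧-* = #𝓧-unique N (card-𝓧-* (card-#𝓧 m) (card-#𝓧 n))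

    #𝓧′-* : #𝓧′ N ≡ #𝓧′ m ℕ.* #𝓧′ n
    #𝓧′-* = #𝓧′-unique N (card-𝓧′-* (card-#𝓧′ m) (card-#𝓧′ n))

-- Counting characters modulo prime powers

module PrimePowers where

  open import Data.Nat.Base as ℕ using (ℕ; zero; suc; _∸_; _^_; NonZero)
  import Data.Nat.Properties as ℕₚ
  import Data.Nat.Coprimality as ℕC
  import Data.Nat.Divisibility as ℕ∣
  open import Data.Nat.Primality using (Prime; prime⇒nonZero; prime⇒nonTrivial; prime⇒irreducible)
  open import Data.Integer.Base as ℤ using (ℤ; 1ℤ; _+_; _*_; -_; _-_)
  import Data.Integer.Properties as ℤₚ
  open import Data.Integer.Coprimality using (Coprime)
  open import Data.Integer.Divisibility.Signed
  import Data.Integer.Solver as ℤSolver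
  open import Data.Fin.Base as Fin using (Fin; zero; suc; toℕ)
  import Data.Fin.Properties as Finₚ
  open import Data.Product.Base using (∃-syntax; _,_; proj₁)
  open import Data.Sum.Base using (inj₁; inj₂)
  open import Relation.Nullary using (¬_; Dec; yes; no; contradiction)
  open import Relation.Binary.PropositionalEquality as ≡ using (_≡_; refl; cong; subst)
  open Defs.Characters.Residues
  open Counting
  open Units
  open CharacterCounting
  open ChineseRemainder

  prime∤⇒coprime : ∀ {p n} → Prime p → ¬ (p ℕ∣.∣ n) → ℕC.Coprime p n
  prime∤⇒coprime {p} p-prime p∤n {i} (i∣p , i∣n) with prime⇒irreducible p-prime i∣p
  ... | inj₁ i≡1  = i≡1
  ... | inj₂ refl = contradiction i∣n p∤n

  coprime-^ : ∀ {p n} k → ℕC.Coprime p n → ℕC.Coprime (p ^ k) n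
  coprime-^ {p} {n} zero    c = ℕC.1-coprimeTo n
  coprime-^ {p} {n} (suc k) c = ℕC.sym (coprime-*ʳ (ℤ.+ n) p (p ^ k) (ℕC.sym c) (ℕC.sym (coprime-^ k c)))

  -- If p divides the cofactor f, one factor p can be cancelled. Otherwise f is coprime to the prime
  -- power that it divides, so f = 1 and e is not a proper divisor.
  prime-power-divisor : ∀ {p} → Prime p → ∀ k e → e ℕ∣.∣ p ^ suc k → e ℕ.< p ^ suc k → e ℕ∣.∣ p ^ k
  prime-power-divisor {p} p-prime k e (ℕ∣.divides f pᵏ⁺¹≡fe) e< = byCofactor (p ℕ∣.∣? f)
    where
    byCofactor : Dec (p ℕ∣.∣ f) → e ℕ∣.∣ p ^ k
    byCofactor (yes (ℕ∣.divides g refl)) = ℕ∣.divides g (ℕₚ.*-cancelˡ-≡ (p ^ k) (g ℕ.* e) p {{prime⇒nonZero p-prime}}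
      (≡.trans pᵏ⁺¹≡fe (≡.trans (cong (ℕ._* e) (ℕₚ.*-comm g p)) (ℕₚ.*-assoc p g e))))
    byCofactor (no p∤f) = contradiction (≡.sym (≡.trans pᵏ⁺¹≡fe (≡.trans (cong (ℕ._* e) f≡1) (ℕₚ.*-identityˡ e)))) (ℕₚ.<⇒≢ e<)
      where
      f≡1 : f ≡ 1
      f≡1 = coprime-^ (suc k) (prime∤⇒coprime p-prime p∤f) (subst (f ℕ∣.∣_) (≡.sym pᵏ⁺¹≡fe) (ℕ∣.m∣m*n e) , ℕ∣.∣-refl)

  card-units-1 : Card (unitSetoid 1) 1
  card-units-1 = mkCard {unitSetoid 1} (λ _ → 1ℤ , 1-coprime 1) (λ {i} {j} _ → single i j) (λ (a , _) → zero , divides (1ℤ - a) (≡.sym (ℤₚ.*-identityʳ (1ℤ - a))))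
    where
    single : ∀ (i j : Fin 1) → i ≡ j
    single zero zero = refl

  card-units-prime : ∀ q → Prime (suc q) → Card (unitSetoid (suc q)) q
  card-units-prime q p-prime = mkCard {unitSetoid (suc q)} unit (λ {i} {j} h → Finₚ.suc-injective (rep-injective (suc q) (suc i) (suc j) h)) (λ (a , c) → cover a c (residue (suc q) a) (rep-residue (suc q) a))
    where
    unit : Fin q → ∃[ a ] Coprime a (ℤ.+ suc q)
    unit i = ℤ.+ toℕ (suc i) , ℕC.sym (ℕC.prime⇒coprime p-prime (ℕ.s≤s (Finₚ.toℕ<n i)))
    cover : ∀ a → Coprime a (ℤ.+ suc q) → ∀ r → ℤ.+ suc q ∣ a - rep (suc q) r → ∃[ i ] ℤ.+ suc q ∣ proj₁ (unit i) - a
    cover a c (suc i) h = i , ∣-sym (ℤ.+ suc q) a (rep (suc q) (suc i)) h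
    cover a c zero    h = contradiction (c (∣⇒∣ᵤ (subst (ℤ.+ suc q ∣_) (ℤₚ.+-identityʳ a) h) , ℕ∣.∣-refl)) (ℕ.nonTrivial⇒≢1 {{prime⇒nonTrivial p-prime}})

  -- A class modulo n splits into the p classes of a + n j. When p ∣ n, coprimality to n already
  -- gives coprimality to p n, so all p of them are units.
  card-units-* : ∀ p n .{{_ : NonZero p}} .{{_ : NonZero n}} → p ℕ∣.∣ n → ∀ {N} → Card (unitSetoid n) N → Card (unitSetoid (p ℕ.* n)) (p ℕ.* N)
  card-units-* p n p∣n α = card-fibred {unitSetoid n} {unitSetoid (p ℕ.* n)} α translate
    (λ {i} {j} {a} {b} → base i j a b) (λ {i} {j} {a} → fibre i j (proj₁ a)) (λ (a , c) → (a , coprime-∣ a (ℕ∣.n∣m*n p) c) , λ (b , _) → cover a b)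
    where
    open ℤSolver.+-*-Solver
    translate : Fin p → (∃[ a ] Coprime a (ℤ.+ n)) → ∃[ a ] Coprime a (ℤ.+ (p ℕ.* n))
    translate j (a , c) = a + ℤ.+ n * rep p j , coprime-*ʳ (a + ℤ.+ n * rep p j) p n (coprime-∣ (a + ℤ.+ n * rep p j) p∣n shifted) shifted
      where
      shifted : Coprime (a + ℤ.+ n * rep p j) (ℤ.+ n)
      shifted = coprime-shift n a (a + ℤ.+ n * rep p j) (subst (ℤ.+ n ∣_) (identity a (ℤ.+ n) (rep p j)) (∣m⇒∣m*n (- rep p j) ∣-refl)) c
        where
        identity : ∀ a n r → n * (- r) ≡ a - (a + n * r)
        identity = solve 3 (λ a n r → n :* (:- r) := a :- (a :+ n :* r)) refl
    base : ∀ i j (a b : ∃[ a ] Coprime a (ℤ.+ n)) → ℤ.+ (p ℕ.* n) ∣ proj₁ (translate i a) - proj₁ (translate j b) → ℤ.+ n ∣ proj₁ a - proj₁ b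
    base i j (a , _) (b , _) h = subst (ℤ.+ n ∣_) (identity a b (ℤ.+ n) (rep p i) (rep p j))
      (∣m∣n⇒∣m+n (∣-trans (lift-∣ (ℕ∣.n∣m*n p)) h) (∣m⇒∣m*n (rep p j - rep p i) ∣-refl))
      where
      identity : ∀ a b n r s → ((a + n * r) - (b + n * s)) + n * (s - r) ≡ a - b
      identity = solve 5 (λ a b n r s → ((a :+ n :* r) :- (b :+ n :* s)) :+ n :* (s :- r) := a :- b) refl
    fibre : ∀ i j a → ℤ.+ (p ℕ.* n) ∣ (a + ℤ.+ n * rep p i) - (a + ℤ.+ n * rep p j) → i ≡ j
    fibre i j a h = rep-injective p i j (*-cancelˡ-∣ (ℤ.+ n) {{ℤ-nonZero}} (subst₂′ (≡.trans (ℤₚ.pos-* p n) (ℤₚ.*-comm (ℤ.+ p) (ℤ.+ n))) (identity a (ℤ.+ n) (rep p i) (rep p j)) h))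
      where
      ℤ-nonZero : ℤ.NonZero (ℤ.+ n)
      ℤ-nonZero = ℕ.≢-nonZero (ℕ.≢-nonZero⁻¹ n)
      subst₂′ : ∀ {w x y z} → w ≡ x → y ≡ z → w ∣ y → x ∣ z
      subst₂′ refl refl h = h
      identity : ∀ a n r s → (a + n * r) - (a + n * s) ≡ n * (r - s)
      identity = solve 4 (λ a n r s → (a :+ n :* r) :- (a :+ n :* s) := n :* (r :- s)) refl
    cover : ∀ a b → ℤ.+ n ∣ b - a → ∃[ j ] ℤ.+ (p ℕ.* n) ∣ (b + ℤ.+ n * rep p j) - a
    -- From b - a = q n follows (b + n j) - a = n (q + j), so j has to be - q modulo p.
    cover a b (divides q b-a≡qn) = residue p (- q) , matches (rep-residue p (- q))
      where
      identity : ∀ q n r → - (n * (- q - r)) ≡ q * n + n * r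
      identity = solve 3 (λ q n r → :- (n :* (:- q :- r)) := q :* n :+ n :* r) refl
      regroup : ∀ a b x → (b - a) + x ≡ (b + x) - a
      regroup = solve 3 (λ a b x → (b :- a) :+ x := (b :+ x) :- a) refl
      matches : ∀ {r} → ℤ.+ p ∣ - q - r → ℤ.+ (p ℕ.* n) ∣ (b + ℤ.+ n * r) - a
      matches {r} h = subst₂ (≡.trans (ℤₚ.*-comm (ℤ.+ n) (ℤ.+ p)) (≡.sym (ℤₚ.pos-* p n)))
        (≡.trans (identity q (ℤ.+ n) r) (≡.trans (cong (_+ ℤ.+ n * r) (≡.sym b-a≡qn)) (regroup a b (ℤ.+ n * r))))
        (∣m⇒∣-m (*-monoʳ-∣ (ℤ.+ n) h))
        where
        subst₂ : ∀ {w x y z} → w ≡ x → y ≡ z → w ∣ y → x ∣ z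
        subst₂ refl refl h = h

  module _ {p} (p-prime : Prime p) where

    private
      instance
        p≢0 : NonZero p
        p≢0 = prime⇒nonZero p-prime

    card-units-prime-power : ∀ k → Card (unitSetoid (p ^ suc k)) (p ^ k ℕ.* (p ∸ 1))
    card-units-prime-power zero    = subst₂ (λ n N → Card (unitSetoid n) N) (≡.sym (ℕₚ.*-identityʳ p)) (≡.sym (ℕₚ.+-identityʳ (p ∸ 1))) (base p p-prime)
      where
      open ≡ using (subst₂)
      base : ∀ p → Prime p → Card (unitSetoid p) (p ∸ 1)
      base zero    0-prime = contradiction refl (ℕ.≢-nonZero⁻¹ 0 {{prime⇒nonZero 0-prime}})
      base (suc q) p-prime = card-units-prime q p-prime
    card-units-prime-power (suc k) = subst (Card (unitSetoid (p ^ suc (suc k)))) (≡.sym (ℕₚ.*-assoc p (p ^ k) (p ∸ 1)))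
      (card-units-* p (p ^ suc k) {{p≢0}} {{ℕₚ.m^n≢0 p (suc k)}} (ℕ∣.m∣m*n (p ^ k)) (card-units-prime-power k))

    #𝓧-prime-power : ∀ k .{{_ : NonZero (p ^ suc k)}} → #𝓧 (p ^ suc k) ≡ p ^ k ℕ.* (p ∸ 1)
    #𝓧-prime-power k = #𝓧-unique (p ^ suc k) (card-𝓧 (p ^ suc k) (card-units-prime-power k))

    #𝓧′+#𝓧-prime-power : ∀ k .{{_ : NonZero (p ^ k)}} .{{_ : NonZero (p ^ suc k)}} → #𝓧′ (p ^ suc k) ℕ.+ #𝓧 (p ^ k) ≡ #𝓧 (p ^ suc k)
    #𝓧′+#𝓧-prime-power k = Imprimitive.#𝓧′+#𝓧 {p ^ suc k} {p ^ k} (ℕ∣.n∣m*n p)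
      (ℕₚ.^-monoʳ-< p (ℕ.nonTrivial⇒n>1 p {{prime⇒nonTrivial p-prime}}) (ℕₚ.n<1+n k)) (prime-power-divisor p-prime k)
      (section k) (section-≡ k) (section-coprime k)
      where
      section : ℕ → ℤ → ℤ
      -- The identity would not do here: 0 is coprime to p⁰ = 1 but not to p. Modulo 1 the constant
      -- 1 is a section.
      section zero    a = 1ℤ
      section (suc k) a = a
      section-≡ : ∀ k a → ℤ.+ (p ^ k) ∣ section k a - a
      section-≡ zero    a = divides (1ℤ - a) (≡.sym (ℤₚ.*-identityʳ (1ℤ - a)))
      section-≡ (suc k) a = ≡⇒congruent (ℤ.+ (p ^ suc k)) {a} refl
      section-coprime : ∀ k a → Coprime a (ℤ.+ (p ^ k)) → Coprime (section k a) (ℤ.+ (p ^ suc k))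
      section-coprime zero    a c = 1-coprime (p ^ 1)
      section-coprime (suc k) a c = coprime-*ʳ a p (p ^ suc k) (coprime-∣ a (ℕ∣.m∣m*n (p ^ k)) c) c

  #𝓧-1 : #𝓧 1 ≡ 1
  #𝓧-1 = #𝓧-unique 1 (card-𝓧 1 card-units-1)

-- Distinct prime divisors

module PrimeDivisors where

  open import Data.Nat.Base
  open import Data.Nat.Properties
  open import Data.Nat.Divisibility
  open import Data.Nat.Induction using (<-rec)
  open import Data.Nat.Primality
  open import Data.Nat.Primality.Factorisation using (factorise)
  open import Data.Nat.ListAction using (product)
  open import Data.Fin.Base using (Fin; zero; suc)
  open import Data.List.Base using ([]; _∷_; lookup; filter; upTo)
  open import Data.List.Membership.Propositional.Properties using (∈-filter⁺; ∈-filter⁻; ∈-lookup; ∈-upTo⁺)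
  open import Data.List.Relation.Unary.All using (All; _∷_)
  import Data.List.Relation.Unary.Any as Any
  import Data.List.Relation.Unary.Any.Properties as Anyₚ
  open import Data.List.Relation.Unary.Unique.Propositional.Properties using (filter⁺; upTo⁺)
  open import Data.Product.Base using (∃; ∃-syntax; ∃₂; _×_; _,_; proj₁; proj₂)
  open import Data.Sum.Base using (inj₁; inj₂; [_,_]′)
  open import Function.Bundles using (module Bijection)
  open import Relation.Nullary using (¬_; Dec; yes; no; contradiction)
  open import Relation.Nullary.Decidable using (_×-dec_)
  open import Relation.Binary.Bundles using (Setoid)
  open import Relation.Binary.PropositionalEquality
  open import Level using (0ℓ)
  open Counting

  PrimeDivisor : ℕ → ℕ → Set
  PrimeDivisor n p = Prime p × p ∣ n

  primeDivisors : ℕ → Setoid 0ℓ 0ℓ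
  primeDivisors n = record
    { Carrier       = ∃ (PrimeDivisor n)
    ; _≈_           = λ p q → proj₁ p ≡ proj₁ q
    ; isEquivalence = record { refl = refl ; sym = sym ; trans = trans }
    }

  ω-card : ∀ n .{{_ : NonZero n}} → Card (primeDivisors n) (ω n)
  ω-card n = mkCard {primeDivisors n}
    (λ i → lookup ps i , proj₂ (∈-filter⁻ P? {xs = upTo (suc n)} (∈-lookup {xs = ps} i)))
    (λ {i} {j} → Characters.lookup-injective ≡-decSetoid (filter⁺ P? (upTo⁺ (suc n))) i j)
    (λ (p , p-prime , p∣n) → let p∈ = ∈-filter⁺ P? (∈-upTo⁺ (s≤s (∣⇒≤ p∣n))) (p-prime , p∣n) in Any.index p∈ , sym (Anyₚ.lookup-index p∈))
    where
    P? : ∀ p → Dec (PrimeDivisor n p)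
    P? p = prime? p ×-dec p ∣? n
    ps = filter P? (upTo (suc n))

  prime-∣-prime : ∀ {p q} → Prime p → Prime q → p ∣ q → p ≡ q
  prime-∣-prime p-prime q-prime p∣q with prime⇒irreducible q-prime p∣q
  ... | inj₁ refl = contradiction p-prime ¬prime[1]
  ... | inj₂ p≡q  = p≡q

  prime-∣-^ : ∀ {p} q k → Prime p → p ∣ q ^ k → p ∣ q
  prime-∣-^ q zero    p-prime p∣1 = contradiction (subst Prime (∣1⇒≡1 p∣1) p-prime) ¬prime[1]
  prime-∣-^ q (suc k) p-prime p∣  = [ (λ h → h) , prime-∣-^ q k p-prime ]′ (euclidsLemma q (q ^ k) p-prime p∣)

  ω-* : ∀ {p m k} a → Prime p → ¬ (p ∣ m) → Card (primeDivisors m) k → Card (primeDivisors (p ^ suc a * m)) (suc k)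
  ω-* {p} {m} {k} a p-prime p∤m α = mkCard {primeDivisors (p ^ suc a * m)} f inj (λ (q , q-prime , q∣) → cover q q-prime q∣ (q ∣? m))
    where
    open Bijection α using (to; injective; strictlySurjective)
    f : Fin (suc k) → ∃ (PrimeDivisor (p ^ suc a * m))
    f zero    = p , p-prime , ∣-trans (m∣m*n (p ^ a)) (m∣m*n m)
    f (suc i) = let q , q-prime , q∣m = to i in q , q-prime , ∣n⇒∣m*n (p ^ suc a) q∣m
    inj : ∀ {i j} → proj₁ (f i) ≡ proj₁ (f j) → i ≡ j
    inj {zero}  {zero}  _ = refl
    inj {zero}  {suc j} e = contradiction (subst (_∣ m) (sym e) (proj₂ (proj₂ (to j)))) p∤m
    inj {suc i} {zero}  e = contradiction (subst (_∣ m) e (proj₂ (proj₂ (to i)))) p∤m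
    inj {suc i} {suc j} e = cong suc (injective e)
    cover : ∀ q → Prime q → q ∣ p ^ suc a * m → Dec (q ∣ m) → ∃[ i ] proj₁ (f i) ≡ q
    cover q q-prime q∣ (yes q∣m) = let i , e = strictlySurjective (q , q-prime , q∣m) in suc i , e
    cover q q-prime q∣ (no q∤m)  = zero , sym (prime-∣-prime q-prime p-prime (prime-∣-^ p (suc a) q-prime
      ([ (λ h → h) , (λ q∣m → contradiction q∣m q∤m) ]′ (euclidsLemma (p ^ suc a) m q-prime q∣))))

  no-primeDivisors⇒≡1 : ∀ n .{{_ : NonZero n}} → (∀ p → Prime p → ¬ (p ∣ n)) → n ≡ 1
  no-primeDivisors⇒≡1 n none with factorise n
  ... | record { factors = [] ; isFactorisation = e } = e
  ... | record { factors = p ∷ ps ; isFactorisation = refl ; factorsPrime = p-prime ∷ _ } = contradiction (m∣m*n (product ps)) (none p p-prime)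

  split-prime-power : ∀ {p} → Prime p → ∀ n .{{_ : NonZero n}} → p ∣ n → ∃₂ λ a m → n ≡ p ^ suc a * m × ¬ (p ∣ m)
  split-prime-power {p} p-prime n p∣n = <-rec (λ n → NonZero n → p ∣ n → ∃₂ λ a m → n ≡ p ^ suc a * m × ¬ (p ∣ m)) step n (≢-nonZero (≢-nonZero⁻¹ n)) p∣n
    where
    step : ∀ n → (∀ {m} → m < n → NonZero m → p ∣ m → ∃₂ λ a l → m ≡ p ^ suc a * l × ¬ (p ∣ l)) →
           NonZero n → p ∣ n → ∃₂ λ a m → n ≡ p ^ suc a * m × ¬ (p ∣ m)
    step _ rec n≢0 (divides q refl) = byDivisor (p ∣? q)
      where
      q≢0 : NonZero q
      q≢0 = m*n≢0⇒m≢0 q {p} {{n≢0}}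
      byDivisor : Dec (p ∣ q) → ∃₂ λ a m → q * p ≡ p ^ suc a * m × ¬ (p ∣ m)
      byDivisor (no p∤q)  = 0 , q , trans (*-comm q p) (cong (_* q) (sym (*-identityʳ p))) , p∤q
      byDivisor (yes p∣q) =
        let a , m , q≡ , p∤m = rec (m<m*n q p {{q≢0}} (nonTrivial⇒n>1 p {{prime⇒nonTrivial p-prime}})) q≢0 p∣q
        in suc a , m , trans (*-comm q p) (trans (cong (p *_) q≡) (sym (*-assoc p (p ^ suc a) m))) , p∤m

-- The lower bound for the proportion, and its value at 2nₖ

module PrimitiveProportion where

  open import Data.Nat.Base
  open import Data.Nat.Properties
  open import Data.Nat.Coprimality using (Coprime; coprime-divisor) renaming (sym to coprime-sym)
  open import Data.Nat.Divisibility
  open import Data.Nat.Primality hiding (prime)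
  open import Data.Nat.ListAction using (product)
  open import Data.List.Base using (applyUpTo)
  open import Data.Fin.Base using (Fin; zero)
  open import Data.Product.Base using (∃-syntax; _×_; _,_; proj₁; proj₂)
  open import Data.Sum.Base using (inj₁; inj₂; [_,_]′)
  open import Function.Base using (_∘_)
  open import Function.Bundles using (module Bijection)
  import Data.Integer.Base as ℤ
  open import Data.Integer.Divisibility.Signed using () renaming (divides to dividesℤ)
  import Data.Integer.Properties as ℤₚ
  open import Relation.Nullary using (¬_; contradiction)
  open import Relation.Nullary.Decidable using (_×-dec_)
  open import Relation.Binary.Bundles using (DecSetoid)
  open import Relation.Binary.PropositionalEquality
  open Defs.Characters using (principal; ≈-trans; ≈-sym)
  open Counting
  open CharacterCounting using (#𝓧; #𝓧′; #𝓧′-unique; trivial-at; induced-self)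
  open ChineseRemainder using (#𝓧-*; #𝓧′-*)
  open PrimePowers
  open PrimeDivisors

  -- 1 - 1/den p is the proportion of primitive characters modulo p, and modulo 4 for p = 2.
  den : ℕ → ℕ
  den p = 2 ⊔ (p ∸ 1)

  ∏ : (ℕ → ℕ) → ℕ → ℕ
  ∏ f k = product (applyUpTo f k)

  ∏≢0 : ∀ {f} k → (∀ i → NonZero (f i)) → NonZero (∏ f k)
  ∏≢0     zero    _   = _
  ∏≢0 {f} (suc k) f≢0 = m*n≢0 (f 0) (∏ (f ∘ suc) k) {{f≢0 0}} {{∏≢0 k (f≢0 ∘ suc)}}

  ∏-snoc : ∀ f k → ∏ f (suc k) ≡ ∏ f k * f k
  ∏-snoc f zero    = *-comm (f 0) 1
  ∏-snoc f (suc k) = trans (cong (f 0 *_) (∏-snoc (f ∘ suc) k)) (sym (*-assoc (f 0) (∏ (f ∘ suc) k) (f (suc k))))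

  #𝓧′-1 : #𝓧′ 1 ≡ 1
  #𝓧′-1 = #𝓧′-unique 1 (mkCard {DecSetoid.setoid (𝓧′ 1)} (λ _ → principal 1 , induced-self (principal 1) , λ { zero (0∣1 , _) → contradiction (0∣⇒≡0 0∣1) λ () ; (suc e) _ → s≤s z≤n })
    (λ {i} {j} _ → single i j) (λ (χ , _) → zero , λ a → ≈-trans (trivial-at (principal 1) a (unit∣ (a ℤ.- ℤ.1ℤ))) (≈-sym (trivial-at χ a (unit∣ (a ℤ.- ℤ.1ℤ))))))
    where
    unit∣ = λ a → dividesℤ {ℤ.+ 1} a (sym (ℤₚ.*-identityʳ a))
    single : ∀ (i j : Fin 1) → i ≡ j
    single zero zero = refl

  -- With X characters, of which X′ are primitive and Y are not, Y/X ≤ 1/d gives X′/X ≥ 1 - 1/d,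
  -- here cleared of denominators.
  ratio-bound : ∀ d {X X′ Y} → 1 ≤ d → X′ + Y ≡ X → d * Y ≤ X → X * (d ∸ 1) ≤ X′ * d
  ratio-bound (suc e) {X} {X′} {Y} _ refl dY≤X = begin
    (X′ + Y) * e    ≡⟨ *-distribʳ-+ e X′ Y ⟩
    X′ * e + Y * e  ≤⟨ +-monoʳ-≤ (X′ * e) (+-cancelˡ-≤ Y (Y * e) X′ (begin
      Y + Y * e  ≡⟨ *-suc Y e ⟨
      Y * suc e  ≡⟨ *-comm Y (suc e) ⟩
      suc e * Y  ≤⟨ dY≤X ⟩
      X′ + Y     ≡⟨ +-comm X′ Y ⟩
      Y + X′     ∎)) ⟩
    X′ * e + X′     ≡⟨ +-comm (X′ * e) X′ ⟩
    X′ + X′ * e     ≡⟨ *-suc X′ e ⟨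
    X′ * suc e      ∎
    where open ≤-Reasoning

  module _ {q} (q-prime : Prime q) where

    private
      instance
        q≢0 : NonZero q
        q≢0 = prime⇒nonZero q-prime
      q>1 : 1 < q
      q>1 = nonTrivial⇒n>1 q {{prime⇒nonTrivial q-prime}}

    -- The ratio of all characters modulo qᵃ⁺¹ to the imprimitive ones is q - 1 for a = 0 and q for
    -- a ≥ 1. Both are at least `den p` when p ≤ q, given that q ≥ 3 in the first case.
    prime-power-bound : ∀ {p} a .{{_ : NonZero (q ^ suc a)}} → p ≤ q → (q ≡ 2 → 1 ≤ a) → #𝓧 (q ^ suc a) * (den p ∸ 1) ≤ #𝓧′ (q ^ suc a) * den p
    prime-power-bound {p} a p≤q a≥1 = ratio-bound (den p) (≤-trans (s≤s z≤n) (m≤m⊔n 2 (p ∸ 1))) (#𝓧′+#𝓧-prime-power q-prime a {{m^n≢0 q a}}) (index-bound a a≥1)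
      where
      index-bound : ∀ a .{{_ : NonZero (q ^ suc a)}} → (q ≡ 2 → 1 ≤ a) → den p * #𝓧 (q ^ a) {{m^n≢0 q a}} ≤ #𝓧 (q ^ suc a)
      index-bound zero a≥1 = subst₂ _≤_ (sym (trans (cong (den p *_) #𝓧-1) (*-identityʳ (den p)))) (sym (trans (#𝓧-prime-power q-prime 0) (+-identityʳ (q ∸ 1))))
        (⊔-lub (∸-monoˡ-≤ 1 (≤∧≢⇒< q>1 λ 2≡q → contradiction (a≥1 (sym 2≡q)) λ ())) (∸-monoˡ-≤ 1 p≤q))
      index-bound (suc b) _ = subst₂ (λ Y X → den p * Y ≤ X) (sym (#𝓧-prime-power q-prime b {{m^n≢0 q (suc b)}})) (sym (trans (#𝓧-prime-power q-prime (suc b)) (*-assoc q (q ^ b) (q ∸ 1))))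
        (*-monoˡ-≤ (q ^ b * (q ∸ 1)) (⊔-lub q>1 (≤-trans (m∸n≤m p 1) p≤q)))

  odd-prime∤4 : ∀ {p} → Prime p → p ≢ 2 → ¬ (p ∣ 4)
  odd-prime∤4 p-prime p≢2 p∣4 = p≢2 ([ two , two ]′ (euclidsLemma 2 2 p-prime p∣4))
    where two = prime-∣-prime p-prime prime[2]

  -- The starting prime is left open so that `tail` stays within the notion and the run may begin at
  -- 3.
  record ConsecutivePrimes (P : ℕ → ℕ) : Set where
    field
      prime      : ∀ i → Prime (P i)
      increasing : ∀ i → P i < P (suc i)
      next       : ∀ i q → Prime q → P i < q → P (suc i) ≤ q

  open ConsecutivePrimes

  tail : ∀ {P} → ConsecutivePrimes P → ConsecutivePrimes (P ∘ suc)
  tail c = record { prime = prime c ∘ suc ; increasing = increasing c ∘ suc ; next = next c ∘ suc }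

  -- Induction that splits off the full power of the least prime divisor q of n: q is at least
  -- `P 0`, and every other prime divisor exceeds q and so is at least `P 1`. The doubled bound for
  -- even n uses that the prime 2 then occurs at least squared.
  proportion-bound : ∀ k {P} → ConsecutivePrimes P → ∀ n .{{_ : NonZero n}} → Card (primeDivisors n) k →
                     (∀ q → Prime q → q ∣ n → P 0 ≤ q) → (2 ∣ n → 4 ∣ n) →
                     ∏ P k ≤ n × (2 ∣ n → 2 * ∏ P k ≤ n) × #𝓧 n * ∏ (λ i → den (P i) ∸ 1) k ≤ #𝓧′ n * ∏ (λ i → den (P i)) k
  proportion-bound zero c n α _ _ = base n (no-primeDivisors⇒≡1 n λ p p-prime p∣n → noFin0 (proj₁ (Bijection.strictlySurjective α (p , p-prime , p∣n))))
    where
    noFin0 : ∀ {A : Set} → Fin 0 → A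
    noFin0 ()
    base : ∀ n .{{_ : NonZero n}} → n ≡ 1 → 1 ≤ n × (2 ∣ n → 2 ≤ n) × #𝓧 n * 1 ≤ #𝓧′ n * 1
    base _ refl = ≤-refl , ∣⇒≤ , *-monoˡ-≤ 1 (subst₂ _≤_ (sym #𝓧-1) (sym #𝓧′-1) ≤-refl)
  proportion-bound (suc k) {P} c n α P₀≤ 2∣n⇒4∣n = byLeast (Primes.least (λ p → prime? p ×-dec p ∣? n) (proj₁ (Bijection.to α zero)) (proj₂ (Bijection.to α zero)))
    where
    Goal : ∀ n .{{_ : NonZero n}} → Set
    Goal n = ∏ P (suc k) ≤ n × (2 ∣ n → 2 * ∏ P (suc k) ≤ n) × #𝓧 n * ∏ (λ i → den (P i) ∸ 1) (suc k) ≤ #𝓧′ n * ∏ (λ i → den (P i)) (suc k)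
    module _ (q : ℕ) (q-prime : Prime q) (q∣n : q ∣ n) (q-least : ∀ p → Prime p × p ∣ n → q ≤ p) where
      private
        instance
          q≢0 : NonZero q
          q≢0 = prime⇒nonZero q-prime
      peel : ∀ a m → n ≡ q ^ suc a * m → ¬ (q ∣ m) → Goal n
      peel a m refl q∤m = combine (proportion-bound k (tail c) m {{m≢0}} β P₁≤ 2∣m⇒4∣m)
        where
        q^≢0 : NonZero (q ^ suc a)
        q^≢0 = m^n≢0 q (suc a)
        m≢0 : NonZero m
        m≢0 = ≢-nonZero λ { refl → contradiction (divides 0 refl) q∤m }
        β : Card (primeDivisors m) k
        β = subst (Card (primeDivisors m)) (suc-injective (card-unique {primeDivisors n} (ω-* a q-prime q∤m (ω-card m {{m≢0}})) α)) (ω-card m {{m≢0}})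
        m∣n : m ∣ n
        m∣n = n∣m*n (q ^ suc a)
        P₁≤ : ∀ p → Prime p → p ∣ m → P 1 ≤ p
        -- Here p ≠ q since q does not divide m, so P 0 ≤ q < p.
        P₁≤ p p-prime p∣m = next c 0 p p-prime (≤-<-trans (P₀≤ q q-prime q∣n) (≤∧≢⇒< (q-least p (p-prime , ∣-trans p∣m m∣n)) λ { refl → q∤m p∣m }))
        2∣m⇒4∣m : 2 ∣ m → 4 ∣ m
        -- If m is even then q, which does not divide m, is odd; so the factor 4 of n must come from
        -- m.
        2∣m⇒4∣m 2∣m = coprime-divisor {4} {q ^ suc a} {m} (coprime-sym (coprime-^ (suc a) (prime∤⇒coprime q-prime (odd-prime∤4 q-prime λ { refl → q∤m 2∣m })))) (2∣n⇒4∣n (∣-trans 2∣m m∣n))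
        a≥1 : q ≡ 2 → 1 ≤ a
        a≥1 refl = exponent a (2∣n⇒4∣n q∣n)
          where
          exponent : ∀ a → 4 ∣ 2 ^ suc a * m → 1 ≤ a
          -- With exponent 1, 4 ∣ 2 m would make m even, but q = 2 does not divide m.
          exponent zero    4∣2m = contradiction (*-cancelˡ-∣ 2 4∣2m) q∤m
          exponent (suc a) _    = s≤s z≤n
        combine : ∏ (P ∘ suc) k ≤ m × (2 ∣ m → 2 * ∏ (P ∘ suc) k ≤ m) × #𝓧 m {{m≢0}} * ∏ (λ i → den (P (suc i)) ∸ 1) k ≤ #𝓧′ m {{m≢0}} * ∏ (λ i → den (P (suc i))) k → Goal n
        combine (size , even-size , bound) = *-mono-≤ P₀≤q^ size ,
          (λ 2∣n → [ doubled-power , doubled-rest ]′ (euclidsLemma (q ^ suc a) m prime[2] 2∣n)) ,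
          subst₂ _≤_ (regroup (#𝓧 (q ^ suc a) {{q^≢0}}) (#𝓧 m {{m≢0}}) (den (P 0) ∸ 1) (∏ (λ i → den (P (suc i)) ∸ 1) k) (#𝓧-* (q ^ suc a) m {{q^≢0}} {{m≢0}} q^⊥m)) (regroup (#𝓧′ (q ^ suc a) {{q^≢0}}) (#𝓧′ m {{m≢0}}) (den (P 0)) (∏ (λ i → den (P (suc i))) k) (#𝓧′-* (q ^ suc a) m {{q^≢0}} {{m≢0}} q^⊥m))
            (*-mono-≤ (prime-power-bound q-prime {P 0} a {{q^≢0}} (P₀≤ q q-prime q∣n) a≥1) bound)
          where
          P₀≤q^ : P 0 ≤ q ^ suc a
          P₀≤q^ = ≤-trans (P₀≤ q q-prime q∣n) (m≤m*n q (q ^ a) {{m^n≢0 q a}})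
          doubled-power : 2 ∣ q ^ suc a → 2 * (P 0 * ∏ (P ∘ suc) k) ≤ q ^ suc a * m
          doubled-power 2∣q^ = ≤-trans (≤-reflexive (sym (*-assoc 2 (P 0) (∏ (P ∘ suc) k)))) (*-mono-≤ (4≤ (sym (prime-∣-prime prime[2] q-prime (prime-∣-^ q (suc a) prime[2] 2∣q^)))) size)
            where
            4≤ : q ≡ 2 → 2 * P 0 ≤ q ^ suc a
            -- P 0 ≤ 2 ≤ 2ᵃ, because a ≥ 1.
            4≤ refl = *-monoʳ-≤ 2 (≤-trans (P₀≤ q q-prime q∣n) (^-monoʳ-≤ 2 (a≥1 refl)))
          doubled-rest : 2 ∣ m → 2 * (P 0 * ∏ (P ∘ suc) k) ≤ q ^ suc a * m
          doubled-rest 2∣m = ≤-trans (≤-reflexive (trans (sym (*-assoc 2 (P 0) (∏ (P ∘ suc) k))) (trans (cong (_* ∏ (P ∘ suc) k) (*-comm 2 (P 0))) (*-assoc (P 0) 2 (∏ (P ∘ suc) k)))))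
            (*-mono-≤ P₀≤q^ (even-size 2∣m))
          q^⊥m : Coprime (q ^ suc a) m
          q^⊥m = coprime-^ (suc a) (prime∤⇒coprime q-prime q∤m)
          regroup : ∀ {x} y z u v → x ≡ y * z → (y * u) * (z * v) ≡ x * (u * v)
          regroup y z u v refl = [m*n]*[o*p]≡[m*o]*[n*p] y u z v
    byLeast : (∃[ q ] (Prime q × q ∣ n) × (∀ p → Prime p × p ∣ n → q ≤ p)) → Goal n
    byLeast (q , (q-prime , q∣n) , q-least) =
      let a , m , n≡ , q∤m = split-prime-power q-prime n q∣n in peel q q-prime q∣n q-least a m n≡ q∤m

  module _ {p} (p-prime : Prime p) where

    private
      instance
        p≢0 : NonZero p
        p≢0 = prime⇒nonZero p-prime

    #𝓧-prime : #𝓧 p ≡ p ∸ 1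
    -- The count carries a proof that its modulus is nonzero, so `p ^ 1` is exchanged for `p` by way
    -- of a general modulus `n`.
    #𝓧-prime = first-power p (*-identityʳ p)
      where
      first-power : ∀ n .{{_ : NonZero n}} → p ^ 1 ≡ n → #𝓧 n ≡ p ∸ 1
      first-power _ refl = trans (#𝓧-prime-power p-prime 0) (+-identityʳ (p ∸ 1))

    #𝓧′-prime : #𝓧′ p ≡ p ∸ 1 ∸ 1
    #𝓧′-prime = first-power p (*-identityʳ p)
      where
      first-power : ∀ n .{{_ : NonZero n}} → p ^ 1 ≡ n → #𝓧′ n ≡ p ∸ 1 ∸ 1
      first-power n refl = subtract (#𝓧′+#𝓧-prime-power p-prime 0) #𝓧-1 (trans (#𝓧-prime-power p-prime 0) (+-identityʳ (p ∸ 1)))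
        where
        subtract : ∀ {x y z w} → x + y ≡ z → y ≡ 1 → z ≡ w → x ≡ w ∸ 1
        subtract {x} refl refl refl = sym (m+n∸n≡m x 1)

  #𝓧-4 : #𝓧 4 ≡ 2
  #𝓧-4 = #𝓧-prime-power prime[2] 1

  #𝓧′-4 : #𝓧′ 4 ≡ 1
  #𝓧′-4 = +-cancelʳ-≡ 1 (#𝓧′ 4) 1 (trans (cong (#𝓧′ 4 +_) (sym (#𝓧-prime-power prime[2] 0))) (trans (#𝓧′+#𝓧-prime-power prime[2] 1) #𝓧-4))

  ∤∏ : ∀ k {p P} → Prime p → ConsecutivePrimes P → p < P 0 → ¬ (p ∣ ∏ P k)
  ∤∏ zero    p-prime c p<P₀ p∣1 = contradiction (subst Prime (∣1⇒≡1 p∣1) p-prime) ¬prime[1]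
  ∤∏ (suc k) {p} {P} p-prime c p<P₀ p∣ with euclidsLemma (P 0) (∏ (P ∘ suc) k) p-prime p∣
  ... | inj₁ p∣P₀ = <⇒≢ p<P₀ (prime-∣-prime p-prime (prime c 0) p∣P₀)
  ... | inj₂ p∣∏  = ∤∏ k p-prime (tail c) (<-trans p<P₀ (increasing c 0)) p∣∏

  ∏-primes≢0 : ∀ {P} → ConsecutivePrimes P → ∀ k → NonZero (∏ P k)
  ∏-primes≢0 c k = ∏≢0 k (λ i → prime⇒nonZero (prime c i))

  den-odd : ∀ {p} → 2 < p → den p ≡ p ∸ 1
  den-odd 2<p = m≤n⇒m⊔n≡n (∸-monoˡ-≤ 1 2<p)

  -- For a product of distinct odd primes the bound is attained factor by factor: p contributes p -
  -- 1 characters, of which p - 2 are primitive, and `den p` is p - 1.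
  odd-proportion : ∀ k {P} (c : ConsecutivePrimes P) → 2 < P 0 → .{{_ : NonZero (∏ P k)}} →
                   #𝓧 (∏ P k) ≡ ∏ (λ i → den (P i)) k × #𝓧′ (∏ P k) ≡ ∏ (λ i → den (P i) ∸ 1) k
  odd-proportion zero        c 2<P₀ = #𝓧-1 , #𝓧′-1
  odd-proportion (suc k) {P} c 2<P₀ =
    trans (#𝓧-* (P 0) (∏ (P ∘ suc) k) P₀⊥∏) (cong₂ _*_ (trans (#𝓧-prime (prime c 0)) (sym (den-odd 2<P₀))) (proj₁ rest)) ,
    trans (#𝓧′-* (P 0) (∏ (P ∘ suc) k) P₀⊥∏) (cong₂ _*_ (trans (#𝓧′-prime (prime c 0)) (cong (_∸ 1) (sym (den-odd 2<P₀)))) (proj₂ rest))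
    where
    instance
      P₀≢0 : NonZero (P 0)
      P₀≢0 = prime⇒nonZero (prime c 0)
      ∏-tail≢0 : NonZero (∏ (P ∘ suc) k)
      ∏-tail≢0 = ∏-primes≢0 (tail c) k
    P₀⊥∏ : Coprime (P 0) (∏ (P ∘ suc) k)
    P₀⊥∏ = prime∤⇒coprime (prime c 0) (∤∏ k (prime c 0) (tail c) (increasing c 0))
    rest = odd-proportion k (tail c) (<-trans 2<P₀ (increasing c 0))

  nthPrime-consecutive : ConsecutivePrimes nthPrime
  nthPrime-consecutive = record
    { prime      = λ { zero → prime[2] ; (suc i) → proj₁ (proj₁ (proj₂ (Primes.nextPrime (nthPrime i)))) }
    ; increasing = λ i → proj₂ (proj₁ (proj₂ (Primes.nextPrime (nthPrime i))))
    ; next       = λ i q q-prime Pᵢ<q → proj₂ (proj₂ (Primes.nextPrime (nthPrime i))) q (q-prime , Pᵢ<q)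
    }

  -- The number 2nₖ is 4 times a product of odd primes. Modulo 4 there are two characters, one of
  -- them primitive, which are exactly `den 2` and `den 2 ∸ 1`.
  2*primorial-proportion : ∀ k .{{_ : NonZero (2 * primorial (suc k))}} →
                           #𝓧 (2 * primorial (suc k)) ≡ ∏ (λ i → den (nthPrime i)) (suc k) × #𝓧′ (2 * primorial (suc k)) ≡ ∏ (λ i → den (nthPrime i) ∸ 1) (suc k)
  2*primorial-proportion k = regroup (2 * primorial (suc k)) (*-assoc 2 2 R)
    where
    c = tail nthPrime-consecutive
    R = ∏ (nthPrime ∘ suc) k
    instance
      R≢0 : NonZero R
      R≢0 = ∏-primes≢0 c k
    odd : #𝓧 R ≡ ∏ (λ i → den (nthPrime (suc i))) k × #𝓧′ R ≡ ∏ (λ i → den (nthPrime (suc i)) ∸ 1) k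
    odd = odd-proportion k c (increasing nthPrime-consecutive 0)
    4⊥R : Coprime 4 R
    4⊥R = coprime-^ 2 (prime∤⇒coprime prime[2] (∤∏ k prime[2] c (increasing nthPrime-consecutive 0)))
    regroup : ∀ n .{{_ : NonZero n}} → 4 * R ≡ n → #𝓧 n ≡ 2 * ∏ (λ i → den (nthPrime (suc i))) k × #𝓧′ n ≡ 1 * ∏ (λ i → den (nthPrime (suc i)) ∸ 1) k
    regroup _ refl = trans (#𝓧-* 4 R 4⊥R) (cong₂ _*_ #𝓧-4 (proj₁ odd)) , trans (#𝓧′-* 4 R 4⊥R) (cong₂ _*_ #𝓧′-4 (proj₂ odd))

-- Comparison of n with 2nₖ

module Comparison where

  open import Data.Nat.Base
  open import Data.Nat.Properties
  open import Data.Nat.Divisibility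
  open import Data.Nat.DivMod using (m%n<n)
  open import Data.Nat.Primality hiding (prime)
  import Data.Integer.Base as ℤ
  import Data.Integer.Properties as ℤₚ
  import Data.Rational.Base as ℚ
  import Data.Rational.Properties as ℚₚ
  import Data.Rational.Unnormalised.Base as ℚᵘ
  import Data.Rational.Unnormalised.Properties as ℚᵘₚ
  open import Data.Product.Base using (proj₁; proj₂)
  open import Function.Base using (_∘_)
  open import Relation.Nullary using (Dec; yes; no; contradiction)
  open import Relation.Binary.PropositionalEquality
  open Defs.Characters using (∣𝓧∣; ∣𝓧′∣; finite-nonZero; 𝓧-finite; principal)
  open CharacterCounting using (#𝓧; #𝓧′; #𝓧≡∣𝓧∣; #𝓧′≡∣𝓧′∣)
  open Counting
  open PrimeDivisors
  open PrimitiveProportion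
  open ConsecutivePrimes

  2∣⇒4∣ : ∀ n → n % 4 ≢ 2 → 2 ∣ n → 4 ∣ n
  2∣⇒4∣ n n%4≢2 2∣n = m%n≡0⇒n∣m n 4 (even (n % 4) (m%n<n n 4) (%-presˡ-∣ 2∣n (divides 2 refl)) n%4≢2)
    where
    even : ∀ r → r < 4 → 2 ∣ r → r ≢ 2 → r ≡ 0
    even 0 _ _ _ = refl
    even 1 _ 2∣1 _ = contradiction (∣⇒≤ 2∣1) λ { (s≤s ()) }
    even 2 _ _ 2≢2 = contradiction refl 2≢2
    even 3 _ 2∣3 _ = contradiction (∣m+n∣m⇒∣n {2} {2} {1} 2∣3 ∣-refl) λ 2∣1 → contradiction (∣⇒≤ 2∣1) λ { (s≤s ()) }
    even (suc (suc (suc (suc r)))) (s≤s (s≤s (s≤s (s≤s ())))) _ _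

  -- Crude, but enough for both uses: the second prime is at least 3, and the prime after the first
  -- k is at least 4 when k > 1.
  nthPrime-≥ : ∀ i → 2 + i ≤ nthPrime i
  nthPrime-≥ zero    = ≤-refl
  nthPrime-≥ (suc i) = ≤-<-trans (nthPrime-≥ i) (increasing nthPrime-consecutive i)

  prime≥2 : ∀ q → Prime q → 2 ≤ q
  prime≥2 q q-prime = nonTrivial⇒n>1 q {{prime⇒nonTrivial q-prime}}

  12≤2*primorial : ∀ k → k > 1 → 12 ≤ 2 * primorial k
  12≤2*primorial (suc zero)    (s≤s ())
  -- 12 = 2 · 2 · 3, and the remaining primes multiply to at least 1.
  12≤2*primorial (suc (suc k)) _ = *-monoʳ-≤ 2 (*-monoʳ-≤ 2 (*-mono-≤ (nthPrime-≥ 1) (>-nonZero⁻¹ (∏ (nthPrime ∘ suc ∘ suc) k) {{∏-primes≢0 (tail (tail nthPrime-consecutive)) k}})))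

  -- If n is odd then n ≥ p₂ ⋯ p_{k+1}, and p_{k+1} ≥ 4 = 2 p₁ makes up for the missing factors.
  2*primorial≤ : ∀ k → k > 1 → ∀ n .{{_ : NonZero n}} → n % 4 ≢ 2 → ω n ≡ k → 2 * primorial k ≤ n
  2*primorial≤ k k>1 n n%4≢2 ω≡k = byParity (2 ∣? n)
    where
    α : Card (primeDivisors n) k
    α = subst (Card (primeDivisors n)) ω≡k (ω-card n)
    byParity : Dec (2 ∣ n) → 2 * primorial k ≤ n
    byParity (yes 2∣n) = proj₁ (proj₂ (proportion-bound k nthPrime-consecutive n α (λ q q-prime _ → prime≥2 q q-prime) (2∣⇒4∣ n n%4≢2))) 2∣n
    byParity (no 2∤n)  = ≤-trans (*-cancelˡ-≤ 2 doubled) (proj₁ (proportion-bound k (tail nthPrime-consecutive) n α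
      (λ q q-prime q∣n → next nthPrime-consecutive 0 q q-prime (≤∧≢⇒< (prime≥2 q q-prime) λ { refl → 2∤n q∣n })) (λ 2∣n → contradiction 2∣n 2∤n)))
      where
      doubled : 2 * (2 * primorial k) ≤ 2 * ∏ (nthPrime ∘ suc) k
      doubled = begin
        2 * (2 * primorial k)     ≡⟨ *-assoc 2 2 (primorial k) ⟨
        4 * primorial k           ≡⟨ *-comm 4 (primorial k) ⟩
        primorial k * 4           ≤⟨ *-monoʳ-≤ (primorial k) (≤-trans (+-monoʳ-≤ 2 k>1) (nthPrime-≥ k)) ⟩
        primorial k * nthPrime k  ≡⟨ ∏-snoc nthPrime k ⟨
        ∏ nthPrime (suc k)        ∎
        where open ≤-Reasoning

  -- At 2nₖ the two counts are equal to the products in `proportion-bound`, so that bound for n is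
  -- already the comparison of proportions.
  cross-multiplied : ∀ k → k > 1 → ∀ n .{{_ : NonZero n}} .{{_ : NonZero (2 * primorial k)}} → n % 4 ≢ 2 → ω n ≡ k →
                     #𝓧′ (2 * primorial k) * #𝓧 n ≤ #𝓧′ n * #𝓧 (2 * primorial k)
  cross-multiplied (suc k) _ n n%4≢2 ω≡k =
    subst₂ (λ x y → x * #𝓧 n ≤ #𝓧′ n * y) (sym (proj₂ (2*primorial-proportion k))) (sym (proj₁ (2*primorial-proportion k)))
      (subst (_≤ #𝓧′ n * ∏ (λ i → den (nthPrime i)) (suc k)) (*-comm (#𝓧 n) (∏ (λ i → den (nthPrime i) ∸ 1) (suc k)))
        (proj₂ (proj₂ (proportion-bound (suc k) nthPrime-consecutive n (subst (Card (primeDivisors n)) ω≡k (ω-card n)) (λ q q-prime _ → prime≥2 q q-prime) (2∣⇒4∣ n n%4≢2)))))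

  -- `_/_` reduces to lowest terms, so the comparison is made on unnormalised fractions, where it is
  -- cross-multiplication.
  /-≤ : ∀ a b c d .{{_ : NonZero b}} .{{_ : NonZero d}} → a * d ≤ c * b → (ℤ.+ a) ℚ./ b ℚ.≤ (ℤ.+ c) ℚ./ d
  /-≤ a (suc b) c (suc d) ad≤cb = ℚₚ.toℚᵘ-cancel-≤ (ℚᵘₚ.≤-respˡ-≃ (ℚᵘₚ.≃-sym (ℚₚ.toℚᵘ-fromℚᵘ (ℚᵘ.mkℚᵘ (ℤ.+ a) b)))
    (ℚᵘₚ.≤-respʳ-≃ (ℚᵘₚ.≃-sym (ℚₚ.toℚᵘ-fromℚᵘ (ℚᵘ.mkℚᵘ (ℤ.+ c) d)))
      (ℚᵘ.*≤* (subst₂ ℤ._≤_ (ℤₚ.pos-* a (suc d)) (ℤₚ.pos-* c (suc b)) (ℤ.+≤+ ad≤cb)))))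

  ρ-≤ : ∀ m n .{{_ : NonZero m}} .{{_ : NonZero n}} → #𝓧′ m * #𝓧 n ≤ #𝓧′ n * #𝓧 m → ρ m ℚ.≤ ρ n
  ρ-≤ m n h = /-≤ (∣𝓧′∣ m) (∣𝓧∣ m) (∣𝓧′∣ n) (∣𝓧∣ n) {{finite-nonZero (𝓧 m) (𝓧-finite m) (principal m)}} {{finite-nonZero (𝓧 n) (𝓧-finite n) (principal n)}}
    (unseal (#𝓧′≡∣𝓧′∣ m) (#𝓧≡∣𝓧∣ n) (#𝓧′≡∣𝓧′∣ n) (#𝓧≡∣𝓧∣ m) h)
    where
    unseal : ∀ {a b c d a′ b′ c′ d′} → a ≡ a′ → b ≡ b′ → c ≡ c′ → d ≡ d′ → a * b ≤ c * d → a′ * b′ ≤ c′ * d′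
    unseal refl refl refl refl h = h

  0≤ρ : ∀ n .{{_ : NonZero n}} → ℚ.0ℚ ℚ.≤ ρ n
  0≤ρ n = nonNeg (∣𝓧′∣ n) (∣𝓧∣ n) {{finite-nonZero (𝓧 n) (𝓧-finite n) (principal n)}}
    where
    nonNeg : ∀ a b .{{_ : NonZero b}} → ℚ.0ℚ ℚ.≤ (ℤ.+ a) ℚ./ b
    nonNeg a b = ℚₚ.≤-trans (ℚₚ.≤-reflexive refl) (/-≤ 0 1 a b z≤n)

-- Monotonicity and positivity of the real factors

module RealInequalities where

  open import Data.Nat.Base as ℕ using (ℕ)
  import Data.Nat.Properties as ℕₚ
  import Data.Integer.Base as ℤ
  import Data.Integer.Properties as ℤₚ
  open import Data.Rational.Base using (0ℚ; 1ℚ; _+_; _*_; _<_; _≤_; *≤*; _/_)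
  open import Data.Rational.Properties
  open import Data.Product.Base using (_,_)
  open import Data.Sum.Base using (inj₁; inj₂)
  open import Data.Unit.Base using (tt)
  open import Relation.Nullary.Decidable using (toWitness)
  open import Relation.Binary.PropositionalEquality
  open Defs.Reals

  -- A bound q < c r with 0 ≤ r < x persists as q < d r. If r ≤ 0, then q < 0 and 0 takes the place
  -- of r, which is possible because 0 < x. Any rational above y serves as the upper witness, as d ≥
  -- 0.
  ·-mono : ∀ {c d x y} → 0ℚ ≤ c → c ≤ d → Positiveᴿ x → x ≤ᴿ y → c · x ≤ᴿ d · y
  ·-mono {c} {d} {x} {y} 0≤c c≤d 0<x x≤y {q} (r , _ , (r<x , _) , q<cr , _) = bySign (≤-total 0ℚ r)
    where
    positive : ∀ {u} → ℝ.lower x u → q < d * u → ℝ.lower (d · y) q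
    positive {u} u<x q<du = let s , y<s = ℝ.upper-inhab y in
      u , s , (x≤y u<x , y<s) , q<du , <-≤-trans q<du (*-monoˡ-≤ (≤-trans 0≤c c≤d) (<⇒≤ (ℝ.lower<upper y (x≤y u<x) y<s)))
    bySign : _ → ℝ.lower (d · y) q
    bySign (inj₁ 0≤r) = positive r<x (<-≤-trans q<cr (*-monoʳ-≤ 0≤r c≤d))
    bySign (inj₂ r≤0) = positive 0<x (<-≤-trans q<cr (≤-trans (*-monoˡ-≤ 0≤c r≤0) (≤-reflexive (trans (*-zeroʳ c) (sym (*-zeroʳ d))))))

  fromℕ-≤ : ∀ {m n} → m ℕ.≤ n → fromℕ m ≤ fromℕ n
  fromℕ-≤ {m} {n} m≤n = *≤* (subst₂ ℤ._≤_ (sym (ℤₚ.*-identityʳ (ℤ.+ m))) (sym (ℤₚ.*-identityʳ (ℤ.+ n))) (ℤ.+≤+ m≤n))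

  -- A lower bound for log log m consists of rational witnesses, and m enters only in the last
  -- inequality.
  loglog-mono : ∀ m n .{{_ : ℕ.NonTrivial m}} .{{_ : ℕ.NonTrivial n}} → m ℕ.≤ n → loglog m ≤ᴿ loglog n
  loglog-mono m n m≤n (r , eᵠ<r , s , eʳ<s , s<m) = r , eᵠ<r , s , eʳ<s , <-≤-trans s<m (fromℕ-≤ m≤n)

  -- exp 0 < 3/2 and exp (3/2) < 11 < 12.
  loglog-positive : ∀ n .{{_ : ℕ.NonTrivial n}} → 12 ℕ.≤ n → Positiveᴿ (loglog n)
  loglog-positive n 12≤n = 3/2 , exp0<r {3/2} (toWitness {a? = 1ℚ <? 3/2} tt) , fromℕ 11 ,
    -- The index 2 stands for the third power: (1 - (3/2)/3)³ = 1/8, and 11/8 > 1.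
    (2 , toWitness {a? = 0ℚ <? _} tt , toWitness {a? = 1ℚ <? _} tt) , <-≤-trans (fromℕ-< {11} {12} ℕₚ.≤-refl) (fromℕ-≤ 12≤n)
    where 3/2 = ℤ.+ 3 / 2

-- The product of the two bounds

module Conclusion where

  open import Data.Nat.Base
  open Comparison using (0≤ρ; ρ-≤)
  open RealInequalities
  open CharacterCounting using (#𝓧; #𝓧′)

  ρ·loglog-mono : ∀ m n .{{_ : NonTrivial m}} .{{_ : NonTrivial n}} .{{_ : NonZero m}} .{{_ : NonZero n}} → 12 ≤ m → m ≤ n →
                  #𝓧′ m * #𝓧 n ≤ #𝓧′ n * #𝓧 m → ρ m · loglog m ≤ᴿ ρ n · loglog n
  ρ·loglog-mono m n 12≤m m≤n h {q} = ·-mono {ρ m} {ρ n} {loglog m} {loglog n}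
    (0≤ρ m) (ρ-≤ m n h) (loglog-positive m 12≤m) (λ {q} → loglog-mono m n m≤n {q}) {q}

open import Data.Nat using (ℕ; _*_; _%_; _>_; NonTrivial; nonTrivial⇒nonZero)
open import Relation.Binary.PropositionalEquality using (_≡_; _≢_)

mainTheorem3 : ∀ (k : ℕ) → k > 1 →
    ∀ (n : ℕ) .{{_ : NonTrivial n}} → n % 4 ≢ 2 → ω n ≡ k →
    ρ (2 * primorial k) {{2*primorial≢0 k}} · loglog (2 * primorial k) {{2*primorial>1 k}}
    ≤ᴿ ρ n {{nonTrivial⇒nonZero n}} · loglog n
mainTheorem3 k k>1 n {{n>1}} n%4≢2 ω≡k {q} = ρ·loglog-mono (2 * primorial k) n
  {{2*primorial>1 k}} {{n>1}} {{2*primorial≢0 k}} {{nonTrivial⇒nonZero n {{n>1}}}} (12≤2*primorial k k>1)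
  (2*primorial≤ k k>1 n {{nonTrivial⇒nonZero n {{n>1}}}} n%4≢2 ω≡k)
  (cross-multiplied k k>1 n {{nonTrivial⇒nonZero n {{n>1}}}} {{2*primorial≢0 k}} n%4≢2 ω≡k) {q}
  where
  open Comparison
  open Conclusion
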